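{- Let $0<|q|<1$. Then $$\vartheta_3(0,-q)^{16}=\tfrac13\det\begin{pmatrix}16U_1-2&16U_3+1\\16U_3+1&16U_5-2\end{pmatrix}$$ and $$\vartheta_3(0,-q)^{24}=\tfrac1{3^2}\det\begin{pmatrix}16G_3+1&16G_5-2\\32G_5-4&32G_7+17\end{pmatrix}.$$
   Context: $\vartheta_3(0,q):=\sum_{j=-\infty}^{\infty}q^{j^2}$, so $\vartheta_3(0,-q)=\sum_{j=-\infty}^{\infty}(-1)^{j}q^{j^2}$. For a positive integer $s$, $$U_s\equiv U_s(q):=\sum_{r=1}^{\infty}(-1)^{r-1}\frac{r^sq^r}{1+q^r},\qquad G_s\equiv G_s(q):=\sum_{r=1}^{\infty}(-1)^{r}\frac{r^sq^r}{1-q^r}.$$ -}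

module Defs where

open import Data.Nat.Base as ℕ using (ℕ; zero; suc)
import Data.Nat.Properties as ℕ
open import Data.Integer.Base as ℤ using (ℤ; +_; -[1+_])
open import Data.Rational.Base as ℚ using (ℚ; 0ℚ; 1ℚ)
import Data.Rational.Properties as ℚ
open import Data.Rational.Solver using (module +-*-Solver)
open import Data.Product.Base using (Σ-syntax; ∃-syntax; _×_; _,_)
open import Data.Vec.Base using (Vec; []; _∷_)
open import Relation.Binary.PropositionalEquality

-- Real numbers are Cauchy sequences of rationals, up to _≈ᴿ_.

IsCauchy : (ℕ → ℚ) → Set
IsCauchy x = ∀ ε → 0ℚ ℚ.< ε →
  ∃[ N ] (∀ m n → N ℕ.≤ m → N ℕ.≤ n → ℚ.∣ x m ℚ.- x n ∣ ℚ.< ε)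

record ℝ : Set where
  constructor mkℝ
  field
    seq    : ℕ → ℚ
    cauchy : IsCauchy seq

open ℝ public

infix 4 _≈ᴿ_ _<ᴿ_

_≈ᴿ_ : ℝ → ℝ → Set
x ≈ᴿ y = ∀ ε → 0ℚ ℚ.< ε →
  ∃[ N ] (∀ n → N ℕ.≤ n → ℚ.∣ seq x n ℚ.- seq y n ∣ ℚ.< ε)

-- Pointwise strict inequality of the sequences would not respect _≈ᴿ_: the
-- gap must eventually be bounded below by a positive rational.
_<ᴿ_ : ℝ → ℝ → Set
x <ᴿ y = ∃[ δ ] (0ℚ ℚ.< δ × ∃[ N ] (∀ n → N ℕ.≤ n → seq x n ℚ.+ δ ℚ.≤ seq y n))

-- The proofs never matter, only the sequences; keep them from unfolding.
abstract
  half : ∀ ε → 0ℚ ℚ.< ε → 0ℚ ℚ.< ε ℚ.* ℚ.½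
  half ε 0<ε = ℚ.positive⁻¹ (ε ℚ.* ℚ.½)
    {{ℚ.pos*pos⇒pos ε {{ℚ.positive 0<ε}} ℚ.½}}

  half+half : ∀ ε → ε ℚ.* ℚ.½ ℚ.+ ε ℚ.* ℚ.½ ≡ ε
  half+half ε = trans (sym (ℚ.*-distribˡ-+ ε ℚ.½ ℚ.½)) (ℚ.*-identityʳ ε)

  cauchy-const : ∀ p → IsCauchy (λ _ → p)
  cauchy-const p ε 0<ε = 0 , λ _ _ _ _ →
    subst (ℚ._< ε) (sym (cong ℚ.∣_∣ (ℚ.+-inverseʳ p))) 0<ε

  cauchy-+ : ∀ x y → IsCauchy x → IsCauchy y → IsCauchy (λ n → x n ℚ.+ y n)
  cauchy-+ x y cx cy ε 0<ε
    with cx (ε ℚ.* ℚ.½) (half ε 0<ε) | cy (ε ℚ.* ℚ.½) (half ε 0<ε)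
  ... | M , p | N , q = M ℕ.⊔ N , λ m n m≥ n≥ → begin-strict
      ℚ.∣ (x m ℚ.+ y m) ℚ.- (x n ℚ.+ y n) ∣
        ≡⟨ cong ℚ.∣_∣ (rearrange (x m) (y m) (x n) (y n)) ⟩
      ℚ.∣ (x m ℚ.- x n) ℚ.+ (y m ℚ.- y n) ∣
        ≤⟨ ℚ.∣p+q∣≤∣p∣+∣q∣ (x m ℚ.- x n) (y m ℚ.- y n) ⟩
      ℚ.∣ x m ℚ.- x n ∣ ℚ.+ ℚ.∣ y m ℚ.- y n ∣
        <⟨ ℚ.+-mono-< (p m n (ℕ.m⊔n≤o⇒m≤o M N m≥) (ℕ.m⊔n≤o⇒m≤o M N n≥))
                      (q m n (ℕ.m⊔n≤o⇒n≤o M N m≥) (ℕ.m⊔n≤o⇒n≤o M N n≥)) ⟩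
      ε ℚ.* ℚ.½ ℚ.+ ε ℚ.* ℚ.½
        ≡⟨ half+half ε ⟩
      ε ∎
    where
    open ℚ.≤-Reasoning
    rearrange : ∀ a b c d →
      (a ℚ.+ b) ℚ.- (c ℚ.+ d) ≡ (a ℚ.- c) ℚ.+ (b ℚ.- d)
    rearrange = solve 4 (λ a b c d →
      (a :+ b) :- (c :+ d) := (a :- c) :+ (b :- d)) refl
      where open +-*-Solver

  cauchy-neg : ∀ x → IsCauchy x → IsCauchy (λ n → ℚ.- x n)
  cauchy-neg x cx ε 0<ε with cx ε 0<ε
  ... | N , p = N , λ m n m≥ n≥ → subst (ℚ._< ε)
      (trans (sym (ℚ.∣-p∣≡∣p∣ (x m ℚ.- x n)))
             (cong ℚ.∣_∣ (ℚ.neg-distrib-+ (x m) (ℚ.- x n))))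
      (p m n m≥ n≥)

  bounded : ∀ x → IsCauchy x →
    ∃[ B ] (0ℚ ℚ.< B × ∃[ N ] (∀ n → N ℕ.≤ n → ℚ.∣ x n ∣ ℚ.≤ B))
  bounded x cx with cx 1ℚ (ℚ.positive⁻¹ 1ℚ)
  ... | N , p = 1ℚ ℚ.+ ℚ.∣ x N ∣
      , ℚ.+-mono-<-≤ (ℚ.positive⁻¹ 1ℚ) (ℚ.0≤∣p∣ (x N))
      , N , λ n n≥ → begin
      ℚ.∣ x n ∣                         ≡⟨ cong ℚ.∣_∣ (split (x n) (x N)) ⟩
      ℚ.∣ (x n ℚ.- x N) ℚ.+ x N ∣       ≤⟨ ℚ.∣p+q∣≤∣p∣+∣q∣ (x n ℚ.- x N) (x N) ⟩
      ℚ.∣ x n ℚ.- x N ∣ ℚ.+ ℚ.∣ x N ∣   ≤⟨ ℚ.+-monoˡ-≤ ℚ.∣ x N ∣ (ℚ.<⇒≤ (p n N n≥ ℕ.≤-refl)) ⟩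
      1ℚ ℚ.+ ℚ.∣ x N ∣ ∎
    where
    open ℚ.≤-Reasoning
    split : ∀ a b → a ≡ (a ℚ.- b) ℚ.+ b
    split = solve 2 (λ a b → a := (a :- b) :+ b) refl
      where open +-*-Solver

  -- Every ε > 0 is B δ for some δ > 0.
  divide : ∀ ε B → 0ℚ ℚ.< ε → 0ℚ ℚ.< B → ∃[ δ ] (0ℚ ℚ.< δ × B ℚ.* δ ≡ ε)
  divide ε B 0<ε 0<B = ε ℚ.* B⁻¹ , 0<δ , eq
    where
    instance
      B-positive : ℚ.Positive B
      B-positive = ℚ.positive 0<B
      B-nonZero : ℚ.NonZero B
      B-nonZero = ℚ.pos⇒nonZero B
    B⁻¹ : ℚ
    B⁻¹ = ℚ.1/ B
    0<δ : 0ℚ ℚ.< ε ℚ.* B⁻¹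
    0<δ = ℚ.positive⁻¹ (ε ℚ.* B⁻¹)
      {{ℚ.pos*pos⇒pos ε {{ℚ.positive 0<ε}} B⁻¹ {{ℚ.1/pos⇒pos B}}}}
    open ≡-Reasoning
    eq : B ℚ.* (ε ℚ.* B⁻¹) ≡ ε
    eq = begin
      B ℚ.* (ε ℚ.* B⁻¹) ≡⟨ ℚ.*-comm B (ε ℚ.* B⁻¹) ⟩
      ε ℚ.* B⁻¹ ℚ.* B   ≡⟨ ℚ.*-assoc ε B⁻¹ B ⟩
      ε ℚ.* (B⁻¹ ℚ.* B) ≡⟨ cong (ε ℚ.*_) (ℚ.*-inverseˡ B) ⟩
      ε ℚ.* 1ℚ          ≡⟨ ℚ.*-identityʳ ε ⟩
      ε ∎

  ∣*∣-≤-< : ∀ {a b B δ} → 0ℚ ℚ.< B → ℚ.∣ a ∣ ℚ.≤ B → ℚ.∣ b ∣ ℚ.< δ →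
    ℚ.∣ a ℚ.* b ∣ ℚ.< B ℚ.* δ
  ∣*∣-≤-< {a} {b} {B} {δ} 0<B a≤B b<δ = begin-strict
      ℚ.∣ a ℚ.* b ∣         ≡⟨ ℚ.∣p*q∣≡∣p∣*∣q∣ a b ⟩
      ℚ.∣ a ∣ ℚ.* ℚ.∣ b ∣   ≤⟨ ℚ.*-monoʳ-≤-nonNeg ℚ.∣ b ∣ {{ℚ.∣-∣-nonNeg b}} a≤B ⟩
      B ℚ.* ℚ.∣ b ∣         <⟨ ℚ.*-monoʳ-<-pos B {{ℚ.positive 0<B}} b<δ ⟩
      B ℚ.* δ ∎
    where open ℚ.≤-Reasoning

  cauchy-* : ∀ x y → IsCauchy x → IsCauchy y → IsCauchy (λ n → x n ℚ.* y n)
  cauchy-* x y cx cy ε 0<ε =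
    let B , 0<B , K , x≤B = bounded x cx
        C , 0<C , L , y≤C = bounded y cy
        β , 0<β , Bβ      = divide (ε ℚ.* ℚ.½) B (half ε 0<ε) 0<B
        γ , 0<γ , Cγ      = divide (ε ℚ.* ℚ.½) C (half ε 0<ε) 0<C
        M , p             = cx γ 0<γ
        N , q             = cy β 0<β
    in (K ℕ.⊔ L) ℕ.⊔ (M ℕ.⊔ N)
     , estimate B C β γ 0<B 0<C x≤B y≤C Bβ Cγ p q
    where
    open ℚ.≤-Reasoning
    rearrange : ∀ a b c d →
      a ℚ.* b ℚ.- c ℚ.* d ≡ a ℚ.* (b ℚ.- d) ℚ.+ d ℚ.* (a ℚ.- c)
    rearrange = solve 4 (λ a b c d →
      a :* b :- c :* d := a :* (b :- d) :+ d :* (a :- c)) refl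
      where open +-*-Solver
    estimate : ∀ {K L M N} B C β γ → 0ℚ ℚ.< B → 0ℚ ℚ.< C →
      (∀ n → K ℕ.≤ n → ℚ.∣ x n ∣ ℚ.≤ B) →
      (∀ n → L ℕ.≤ n → ℚ.∣ y n ∣ ℚ.≤ C) →
      B ℚ.* β ≡ ε ℚ.* ℚ.½ → C ℚ.* γ ≡ ε ℚ.* ℚ.½ →
      (∀ m n → M ℕ.≤ m → M ℕ.≤ n → ℚ.∣ x m ℚ.- x n ∣ ℚ.< γ) →
      (∀ m n → N ℕ.≤ m → N ℕ.≤ n → ℚ.∣ y m ℚ.- y n ∣ ℚ.< β) →
      ∀ m n → (K ℕ.⊔ L) ℕ.⊔ (M ℕ.⊔ N) ℕ.≤ m → (K ℕ.⊔ L) ℕ.⊔ (M ℕ.⊔ N) ℕ.≤ n →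
      ℚ.∣ x m ℚ.* y m ℚ.- x n ℚ.* y n ∣ ℚ.< ε
    estimate {K} {L} {M} {N} B C β γ 0<B 0<C x≤B y≤C Bβ Cγ p q m n m≥ n≥ = begin-strict
      ℚ.∣ x m ℚ.* y m ℚ.- x n ℚ.* y n ∣
        ≡⟨ cong ℚ.∣_∣ (rearrange (x m) (y m) (x n) (y n)) ⟩
      ℚ.∣ x m ℚ.* (y m ℚ.- y n) ℚ.+ y n ℚ.* (x m ℚ.- x n) ∣
        ≤⟨ ℚ.∣p+q∣≤∣p∣+∣q∣ (x m ℚ.* (y m ℚ.- y n)) (y n ℚ.* (x m ℚ.- x n)) ⟩
      ℚ.∣ x m ℚ.* (y m ℚ.- y n) ∣ ℚ.+ ℚ.∣ y n ℚ.* (x m ℚ.- x n) ∣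
        <⟨ ℚ.+-mono-<
             (∣*∣-≤-< {x m} {y m ℚ.- y n} 0<B (x≤B m (ge-K m≥)) (q m n (ge-N m≥) (ge-N n≥)))
             (∣*∣-≤-< {y n} {x m ℚ.- x n} 0<C (y≤C n (ge-L n≥)) (p m n (ge-M m≥) (ge-M n≥))) ⟩
      B ℚ.* β ℚ.+ C ℚ.* γ
        ≡⟨ cong₂ ℚ._+_ Bβ Cγ ⟩
      ε ℚ.* ℚ.½ ℚ.+ ε ℚ.* ℚ.½
        ≡⟨ half+half ε ⟩
      ε ∎
      where
      ge-KL : ∀ {k} → (K ℕ.⊔ L) ℕ.⊔ (M ℕ.⊔ N) ℕ.≤ k → K ℕ.⊔ L ℕ.≤ k
      ge-KL = ℕ.m⊔n≤o⇒m≤o (K ℕ.⊔ L) (M ℕ.⊔ N)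
      ge-MN : ∀ {k} → (K ℕ.⊔ L) ℕ.⊔ (M ℕ.⊔ N) ℕ.≤ k → M ℕ.⊔ N ℕ.≤ k
      ge-MN = ℕ.m⊔n≤o⇒n≤o (K ℕ.⊔ L) (M ℕ.⊔ N)
      ge-K : ∀ {k} → (K ℕ.⊔ L) ℕ.⊔ (M ℕ.⊔ N) ℕ.≤ k → K ℕ.≤ k
      ge-K h = ℕ.m⊔n≤o⇒m≤o K L (ge-KL h)
      ge-L : ∀ {k} → (K ℕ.⊔ L) ℕ.⊔ (M ℕ.⊔ N) ℕ.≤ k → L ℕ.≤ k
      ge-L h = ℕ.m⊔n≤o⇒n≤o K L (ge-KL h)
      ge-M : ∀ {k} → (K ℕ.⊔ L) ℕ.⊔ (M ℕ.⊔ N) ℕ.≤ k → M ℕ.≤ k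
      ge-M h = ℕ.m⊔n≤o⇒m≤o M N (ge-MN h)
      ge-N : ∀ {k} → (K ℕ.⊔ L) ℕ.⊔ (M ℕ.⊔ N) ℕ.≤ k → N ℕ.≤ k
      ge-N h = ℕ.m⊔n≤o⇒n≤o M N (ge-MN h)

infixl 6 _+ᴿ_ _-ᴿ_
infixl 7 _*ᴿ_
infix  8 -ᴿ_

fromℚᴿ : ℚ → ℝ
fromℚᴿ p = mkℝ (λ _ → p) (cauchy-const p)

0ᴿ 1ᴿ : ℝ
0ᴿ = fromℚᴿ 0ℚ
1ᴿ = fromℚᴿ 1ℚ

_+ᴿ_ : ℝ → ℝ → ℝ
x +ᴿ y = mkℝ (λ n → seq x n ℚ.+ seq y n) (cauchy-+ (seq x) (seq y) (cauchy x) (cauchy y))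

_*ᴿ_ : ℝ → ℝ → ℝ
x *ᴿ y = mkℝ (λ n → seq x n ℚ.* seq y n) (cauchy-* (seq x) (seq y) (cauchy x) (cauchy y))

-ᴿ_ : ℝ → ℝ
-ᴿ x = mkℝ (λ n → ℚ.- seq x n) (cauchy-neg (seq x) (cauchy x))

_-ᴿ_ : ℝ → ℝ → ℝ
x -ᴿ y = x +ᴿ (-ᴿ y)

record ℂ : Set where
  constructor _+i_
  field
    re im : ℝ

open ℂ public

infix  4 _≈_
infixl 6 _+_ _-_
infixl 7 _*_
infix  8 -_
infixr 9 _^_

_≈_ : ℂ → ℂ → Set
z ≈ w = (re z ≈ᴿ re w) × (im z ≈ᴿ im w)

fromℚ : ℚ → ℂ
fromℚ p = fromℚᴿ p +i 0ᴿ

fromℕ : ℕ → ℂ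
fromℕ n = fromℚ (+ n ℚ./ 1)

0ᶜ 1ᶜ : ℂ
0ᶜ = fromℕ 0
1ᶜ = fromℕ 1

_+_ : ℂ → ℂ → ℂ
z + w = (re z +ᴿ re w) +i (im z +ᴿ im w)

-_ : ℂ → ℂ
- z = (-ᴿ re z) +i (-ᴿ im z)

_-_ : ℂ → ℂ → ℂ
z - w = z + (- w)

_*_ : ℂ → ℂ → ℂ
z * w = (re z *ᴿ re w -ᴿ im z *ᴿ im w) +i (re z *ᴿ im w +ᴿ im z *ᴿ re w)

_^_ : ℂ → ℕ → ℂ
z ^ zero  = 1ᶜ
z ^ suc n = z * z ^ n

∣_∣² : ℂ → ℝ
∣ z ∣² = re z *ᴿ re z +ᴿ im z *ᴿ im z

-- t = a / b.  Nonvanishing of b is part of the assertion, so t is unique.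
IsQuotient : (a b t : ℂ) → Set
IsQuotient a b t = (0ᴿ <ᴿ ∣ b ∣²) × (t * b ≈ a)

det : Vec (Vec ℂ 2) 2 → ℂ
det ((a ∷ b ∷ []) ∷ (c ∷ d ∷ []) ∷ []) = a * d - b * c

-- |zₙ - l| < ε eventually, for each ε > 0, with both sides squared.
HasLimit : (ℕ → ℂ) → ℂ → Set
HasLimit z l = ∀ ε → 0ℚ ℚ.< ε →
  ∃[ N ] (∀ n → N ℕ.≤ n → ∣ z n - l ∣² <ᴿ fromℚᴿ (ε ℚ.* ε))

partialSum : (ℕ → ℂ) → ℕ → ℂ
partialSum f zero    = 0ᶜ
partialSum f (suc n) = partialSum f n + f n

HasSum : (ℕ → ℂ) → ℂ → Set
HasSum f s = HasLimit (partialSum f) s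

-- A bilateral series converges when its two halves converge separately.
HasSumℤ : (ℤ → ℂ) → ℂ → Set
HasSumℤ f s = ∃[ a ] ∃[ b ]
  (HasSum (λ n → f (+ n)) a × HasSum (λ n → f -[1+ n ]) b × s ≈ a + b)

-- Limits are unique up to _≈_, so each predicate IsTheta₃, IsU,
-- IsG determines its last argument.

-- θ = ϑ₃(0, q); the exponent is j².
IsTheta₃ : (q θ : ℂ) → Set
IsTheta₃ q θ = HasSumℤ (λ j → q ^ (ℤ.∣ j ∣ ℕ.^ 2)) θ

-- u = U_s(q); the n-th term of the series is the one with r = n + 1.
IsU : (s : ℕ) (q u : ℂ) → Set
IsU s q u = Σ[ t ∈ (ℕ → ℂ) ]
  ( (∀ n → let r = suc n in
       IsQuotient (fromℕ (r ℕ.^ s) * q ^ r) (1ᶜ + q ^ r) (t n))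
  × HasSum (λ n → (- 1ᶜ) ^ n * t n) u )

-- g = G_s(q), indexed in the same way.
IsG : (s : ℕ) (q g : ℂ) → Set
IsG s q g = Σ[ t ∈ (ℕ → ℂ) ]
  ( (∀ n → let r = suc n in
       IsQuotient (fromℕ (r ℕ.^ s) * q ^ r) (1ᶜ - q ^ r) (t n))
  × HasSum (λ n → (- 1ᶜ) ^ suc n * t n) g )

{-# OPTIONS --safe #-}

-- Put t = qᵃ/(1 + qᵃ) and w = qᵃ/(1 - qᵃ).  The partial fractions
--   t(a) t(b) = w(a+b) (1 - t(a) - t(b)),   w(a) t(b) = t(a+b) (1 + w(a) - t(b)),
-- summed over all a, b with polynomial weights, evaluate products of two Lambert series.  With
-- A = 1 - 8 U₁ and L = 1 + 24 Σ a t(a) they give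
--   A² = 1 + 16 G₃,   A (16 U₃ + 1) = 1 - 8 G₅,   A L = 16 U₃ + 1,   2 (16 U₅ - 2) = - A (3 A² + L²),
--   32 G₇ + 17 = 3 (16 U₁ - 2) (16 U₅ - 2) + 5 (16 U₃ + 1)²,
-- so that the two determinants are 3 A⁴ and 9 A⁶.  A further such sum shows that A solves
-- q X′ = - 4 X Σ a (w(a) + t(a)), an equation which ϑ₃(0,-q)⁴ satisfies by Gauss' product
-- ϑ₃(0,-q) = Π (1 - qᵃ)/(1 + qᵃ); hence ϑ₃(0,-q)⁴ = A.
--
-- All of this takes place among formal power series modulo qᴺ, where every sum is finite.  The
-- series involved have coefficients of polynomial growth, and evaluation at q is a ring
-- homomorphism on such series; as the t(a) and w(a) are themselves values of power series, no
-- complex division is needed.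
module Submission where

-- Behind the relations stands the elliptic function E(u) = ¼ tan ½u + Σ (-1)ᵃ t(a) sin au, of which
-- only Taylor coefficients at u = 0 are formed. The series of tan gives -16 E(u) = (16 U₁ - 2) u -
-- (16 U₃ + 1) u³/3! + (16 U₅ - 2) u⁵/5! - ..., and that of tan² puts the constants 1, 2 and 17 next
-- to G₃, G₅, G₇ in the expansion of E². Thus squaring E expresses the G's by the U's, while E″ = 8
-- E³ + ½ L E, read in degrees 1 and 3, is A L = 16 U₃ + 1 and the formula for 16 U₅ - 2. The
-- obstacle is that a partial fraction does not remove products: t(a) t(b) returns as w(a+b) t(a)
-- and w(a+b) t(b). Sorting every pair by its larger index makes all products comparable; weights
-- are then chosen so that a combination of the two partial fractions reproduces exactly the wanted
-- product. What is left over is linear in t and w, up to a diagonal, with inner sums that have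
-- closed forms.

open import Algebra.Bundles using (CommutativeRing)
open import Algebra.Solver.Ring.AlmostCommutativeRing
  using (fromCommutativeRing; _-Raw-AlmostCommutative⟶_)
import Algebra.Solver.Ring as RingSolver
open import Data.Bool.Base using (T)
open import Data.Integer.Base as ℤ using (ℤ; +_; -[1+_])
import Data.Integer.Properties as ℤ
open import Data.Integer.Solver using () renaming (module +-*-Solver to ℤ-Solver)
open import Data.Maybe.Base as Maybe using (Maybe; is-just)
open import Data.Maybe using (to-witness-T)
open import Data.Nat.Base as ℕ using (ℕ; zero; suc)
import Data.Nat.Properties as ℕ
open import Data.Nat.Solver using () renaming (module +-*-Solver to ℕ-Solver)
open import Data.Product.Base using (∃-syntax; Σ-syntax; _×_; _,_; proj₁; proj₂)
open import Data.Sum.Base using (_⊎_; inj₁; inj₂)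
open import Data.Vec.Base as Vec using (Vec; []; _∷_)
open import Data.Vec.N-ary using (N-ary; curryⁿ; _$ⁿ_; ∀ⁿ)
open import Function.Base using (_∘_)
open import Level using (0ℓ)
open import Relation.Binary.PropositionalEquality as ≡ using (_≡_)
open import Relation.Nullary.Decidable using (yes; no; dec⇒maybe)
open import Relation.Nullary.Negation using (contradiction)

-- The ring solver of the standard library with the normal forms compared by a decision procedure,
-- which is much cheaper than checking that their values are convertible.
module PolynomialSolver (R : CommutativeRing 0ℓ 0ℓ)
  (ι : CommutativeRing.rawRing ℤ.+-*-commutativeRing
         -Raw-AlmostCommutative⟶ fromCommutativeRing R) where

  open CommutativeRing R using (Carrier; _≈_; reflexive; trans; sym)
  open _-Raw-AlmostCommutative⟶_ ι using () renaming (⟦_⟧ to literal)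

  open RingSolver (CommutativeRing.rawRing ℤ.+-*-commutativeRing) (fromCommutativeRing R) ι
    (λ x y → Maybe.map (λ e → reflexive (≡.cong literal e)) (dec⇒maybe (x ℤ.≟ y)))
    public hiding (solve)

  private
    close : ∀ {A : Set} n → N-ary n (Polynomial n) A → A
    close n f = f $ⁿ Vec.map var (Vec.allFin n)

    curry-∀ : ∀ n {P : Vec Carrier n → Set} → (∀ ρ → P ρ) → ∀ⁿ n (curryⁿ P)
    curry-∀ zero    p = p []
    curry-∀ (suc n) p = λ x → curry-∀ n (λ ρ → p (x ∷ ρ))

    same-normal-form : ∀ {n} (p : Polynomial n × Polynomial n) →
      Maybe (normalise (proj₁ p) ≈N normalise (proj₂ p))
    same-normal-form (p₁ , p₂) = normalise p₁ ≟N normalise p₂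

  solve : ∀ n (f : N-ary n (Polynomial n) (Polynomial n × Polynomial n)) →
    {_ : T (is-just (same-normal-form (close n f)))} →
    ∀ⁿ n (curryⁿ (λ ρ → ⟦ proj₁ (close n f) ⟧ ρ ≈ ⟦ proj₂ (close n f) ⟧ ρ))
  solve n f {same} = curry-∀ n (λ ρ → trans (sym (correct (proj₁ (close n f)) ρ))
    (trans (⟦ to-witness-T (same-normal-form (close n f)) same ⟧N-cong ρ) (correct (proj₂ (close n f)) ρ)))

-- Finite double sums in a commutative ring

module Nome (R : CommutativeRing 0ℓ 0ℓ)
  (ι : CommutativeRing.rawRing ℤ.+-*-commutativeRing
         -Raw-AlmostCommutative⟶ fromCommutativeRing R) where

  open CommutativeRing R public
  open _-Raw-AlmostCommutative⟶_ ι public using (⟦_⟧; +-homo; *-homo; -‿homo; 0-homo; 1-homo)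
  open import Relation.Binary.Reasoning.Setoid setoid public

  open PolynomialSolver R ι using (solve; _:=_; _:+_; _:*_; _:-_; :-_; _:^_; con) public

  ∑ : ℕ → (ℕ → Carrier) → Carrier
  ∑ zero    f = 0#
  ∑ (suc n) f = f 0 + ∑ n (f ∘ suc)

  ∑-cong : ∀ n {f g} → (∀ i → f i ≈ g i) → ∑ n f ≈ ∑ n g
  ∑-cong zero    eq = refl
  ∑-cong (suc n) eq = +-cong (eq 0) (∑-cong n (eq ∘ suc))

  ∑-0 : ∀ n {f} → (∀ i → f i ≈ 0#) → ∑ n f ≈ 0#
  ∑-0 zero    eq = refl
  ∑-0 (suc n) eq = trans (+-cong (eq 0) (∑-0 n (eq ∘ suc))) (+-identityˡ 0#)

  +-interchange : ∀ a b c d → (a + b) + (c + d) ≈ (a + c) + (b + d)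
  +-interchange = solve 4 (λ a b c d → (a :+ b) :+ (c :+ d) := (a :+ c) :+ (b :+ d))

  ∑-+ : ∀ n f g → ∑ n (λ i → f i + g i) ≈ ∑ n f + ∑ n g
  ∑-+ zero    f g = sym (+-identityˡ 0#)
  ∑-+ (suc n) f g = trans (+-congˡ (∑-+ n (f ∘ suc) (g ∘ suc))) (+-interchange _ _ _ _)

  ∑-*ˡ : ∀ n x f → ∑ n (λ i → x * f i) ≈ x * ∑ n f
  ∑-*ˡ zero    x f = sym (zeroʳ x)
  ∑-*ˡ (suc n) x f = trans (+-congˡ (∑-*ˡ n x (f ∘ suc))) (sym (distribˡ x _ _))

  ∑-*ʳ : ∀ n x f → ∑ n (λ i → f i * x) ≈ ∑ n f * x
  ∑-*ʳ n x f = trans (∑-cong n (λ i → *-comm (f i) x)) (trans (∑-*ˡ n x f) (*-comm x _))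

  ∑-snoc : ∀ n f → ∑ (suc n) f ≈ ∑ n f + f n
  ∑-snoc zero    f = +-comm (f 0) 0#
  ∑-snoc (suc n) f = trans (+-congˡ (∑-snoc n (f ∘ suc))) (sym (+-assoc _ _ _))

  ∑-swap : ∀ m n (f : ℕ → ℕ → Carrier) → ∑ m (λ i → ∑ n (f i)) ≈ ∑ n (λ j → ∑ m (λ i → f i j))
  ∑-swap zero    n f = sym (∑-0 n (λ _ → refl))
  ∑-swap (suc m) n f = trans (+-congˡ (∑-swap m n (f ∘ suc))) (sym (∑-+ n _ _))

  box tri : ℕ → (ℕ → ℕ → Carrier) → Carrier
  box n f = ∑ n (λ i → ∑ n (f i))
  tri n f = ∑ n (λ k → ∑ k (λ c → f c k))

  box-cong : ∀ n {f g} → (∀ i j → f i j ≈ g i j) → box n f ≈ box n g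
  box-cong n eq = ∑-cong n (λ i → ∑-cong n (eq i))

  tri-cong : ∀ n {f g} → (∀ i j → f i j ≈ g i j) → tri n f ≈ tri n g
  tri-cong n eq = ∑-cong n (λ k → ∑-cong k (λ c → eq c k))

  box-+ : ∀ n f g → box n (λ i j → f i j + g i j) ≈ box n f + box n g
  box-+ n f g = trans (∑-cong n (λ i → ∑-+ n (f i) (g i))) (∑-+ n _ _)

  tri-+ : ∀ n f g → tri n (λ i j → f i j + g i j) ≈ tri n f + tri n g
  tri-+ n f g = trans (∑-cong n (λ k → ∑-+ k _ _)) (∑-+ n _ _)

  tri-*ˡ : ∀ n x f → tri n (λ i j → x * f i j) ≈ x * tri n f
  tri-*ˡ n x f = trans (∑-cong n (λ k → ∑-*ˡ k x _)) (∑-*ˡ n x _)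

  box-product : ∀ n f g → box n (λ i j → f i * g j) ≈ ∑ n f * ∑ n g
  box-product n f g = trans (∑-cong n (λ i → ∑-*ˡ n (f i) g)) (∑-*ʳ n (∑ n g) f)

  box-split : ∀ n f → box n f ≈ tri n (λ c k → f c k + f k c) + ∑ n (λ k → f k k)
  box-split zero    f = sym (+-identityˡ 0#)
  box-split (suc n) f = begin
    box (suc n) f
      ≈⟨ ∑-snoc n (λ i → ∑ (suc n) (f i)) ⟩
    ∑ n (λ i → ∑ (suc n) (f i)) + ∑ (suc n) (f n)
      ≈⟨ +-cong (∑-cong n (λ i → ∑-snoc n (f i))) (∑-snoc n (f n)) ⟩
    ∑ n (λ i → ∑ n (f i) + f i n) + (∑ n (f n) + f n n)
      ≈⟨ +-congʳ (∑-+ n (λ i → ∑ n (f i)) (λ i → f i n)) ⟩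
    (box n f + ∑ n (λ i → f i n)) + (∑ n (f n) + f n n)
      ≈⟨ +-congʳ (+-congʳ (box-split n f)) ⟩
    ((tri n f₂ + ∑ n (λ k → f k k)) + ∑ n (λ i → f i n)) + (∑ n (f n) + f n n)
      ≈⟨ rearrange _ _ _ _ _ ⟩
    (tri n f₂ + (∑ n (λ i → f i n) + ∑ n (f n))) + (∑ n (λ k → f k k) + f n n)
      ≈⟨ +-cong (+-congˡ (sym (∑-+ n (λ i → f i n) (f n)))) (sym (∑-snoc n (λ k → f k k))) ⟩
    (tri n f₂ + ∑ n (λ c → f₂ c n)) + ∑ (suc n) (λ k → f k k)
      ≈⟨ +-congʳ (sym (∑-snoc n (λ k → ∑ k (λ c → f₂ c k)))) ⟩
    tri (suc n) f₂ + ∑ (suc n) (λ k → f k k) ∎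
    where
    f₂ : ℕ → ℕ → Carrier
    f₂ c k = f c k + f k c
    rearrange : ∀ a b c d e → ((a + b) + c) + (d + e) ≈ (a + (c + d)) + (b + e)
    rearrange = solve 5 (λ a b c d e → ((a :+ b) :+ c) :+ (d :+ e) := (a :+ (c :+ d)) :+ (b :+ e))

  -- The pairs with i + j + 1 < n correspond to the points c = i < k = i + j + 1 of the triangle. In
  -- the rest of the square k is at least n, where f vanishes.
  box≈tri : ∀ n f → (∀ c k → n ℕ.≤ k → f c k ≈ 0#) →
    box n (λ i j → f i (suc (i ℕ.+ j))) ≈ tri n f
  box≈tri zero    f van = refl
  box≈tri (suc n) f van = begin
    ∑ (suc n) (λ j → f 0 (suc j)) + ∑ n (λ i → ∑ (suc n) (λ j → f (suc i) (suc (suc (i ℕ.+ j)))))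
      ≈⟨ +-cong (trans (∑-snoc n _) (trans (+-congˡ (van 0 (suc n) ℕ.≤-refl)) (+-identityʳ _)))
           (∑-cong n (λ i → trans (∑-snoc n _)
             (trans (+-congˡ (van (suc i) _ (ℕ.s≤s (ℕ.m≤n⇒m≤1+n (ℕ.m≤n+m n i))))) (+-identityʳ _)))) ⟩
    ∑ n (λ j → f 0 (suc j)) + box n (λ i j → f (suc i) (suc (suc (i ℕ.+ j))))
      ≈⟨ +-congˡ (box≈tri n (λ c k → f (suc c) (suc k)) (λ c k n≤k → van (suc c) (suc k) (ℕ.s≤s n≤k))) ⟩
    ∑ n (λ j → f 0 (suc j)) + tri n (λ c k → f (suc c) (suc k))
      ≈⟨ sym (∑-+ n _ _) ⟩
    ∑ n (λ k → f 0 (suc k) + ∑ k (λ c → f (suc c) (suc k)))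
      ≈⟨ sym (+-identityˡ _) ⟩
    tri (suc n) f ∎

  box≈tri′ : ∀ n f → (∀ c k → n ℕ.≤ k → f c k ≈ 0#) →
    box n (λ i j → f j (suc (i ℕ.+ j))) ≈ tri n f
  box≈tri′ n f van = trans (∑-swap n n (λ i j → f j (suc (i ℕ.+ j))))
    (trans (box-cong n (λ j i → reflexive (≡.cong (f j ∘ suc) (ℕ.+-comm i j)))) (box≈tri n f van))

  -- The partial fraction xᵢ yⱼ = zᵢ₊ⱼ₊₁ (1 + xᵢ + yⱼ), summed over all pairs and sorted by
  -- the index k = i + j + 1.
  module _ (n : ℕ) {x y z : ℕ → Carrier} (z-vanish : ∀ k → n ℕ.≤ k → z k ≈ 0#)
    (fraction : ∀ i j → x i * y j ≈ z (suc (i ℕ.+ j)) * (⟦ + 1 ⟧ + x i + y j)) where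

    private
      van : ∀ (f : ℕ → ℕ → Carrier) c k → n ℕ.≤ k → f c k * z k ≈ 0#
      van f c k n≤k = trans (*-congˡ (z-vanish k n≤k)) (zeroʳ _)

    -- `Q` and `Q′` are the weight `P` rewritten in terms of k = i + j + 1 and one index: c is the
    -- first index in `Q` and the second in `Q′`. Two versions occur because x and y are kept with
    -- different indices.
    convolution : ∀ (P Q Q′ : ℕ → ℕ → Carrier) →
      (∀ i j → Q i (suc (i ℕ.+ j)) ≈ P i j) → (∀ i j → Q′ j (suc (i ℕ.+ j)) ≈ P i j) →
      box n (λ i j → P i j * (x i * y j)) ≈
      tri n (λ c k → Q c k * z k) + tri n (λ c k → Q c k * (x c * z k) + Q′ c k * (y c * z k))
    convolution P Q Q′ Q≈P Q′≈P = begin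
      box n (λ i j → P i j * (x i * y j))
        ≈⟨ box-cong n (λ i j → trans (*-congˡ (fraction i j)) (trans (expand _ _ _ _)
             (+-cong (*-congʳ (sym (Q≈P i j)))
               (+-cong (*-congʳ (*-congʳ (sym (Q≈P i j)))) (*-congʳ (*-congʳ (sym (Q′≈P i j)))))))) ⟩
      box n (λ i j → Q i (k i j) * z (k i j) +
                     (Q i (k i j) * x i * z (k i j) + Q′ j (k i j) * y j * z (k i j)))
        ≈⟨ trans (box-+ n _ _) (+-congˡ (box-+ n _ _)) ⟩
      box n (λ i j → Q i (k i j) * z (k i j)) +
      (box n (λ i j → Q i (k i j) * x i * z (k i j)) + box n (λ i j → Q′ j (k i j) * y j * z (k i j)))
        ≈⟨ +-cong (box≈tri n (λ c k → Q c k * z k) (van _))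
             (+-cong (box≈tri n (λ c k → Q c k * x c * z k) (van _))
                     (box≈tri′ n (λ c k → Q′ c k * y c * z k) (van _))) ⟩
      tri n (λ c k → Q c k * z k) +
      (tri n (λ c k → Q c k * x c * z k) + tri n (λ c k → Q′ c k * y c * z k))
        ≈⟨ +-congˡ (sym (tri-+ n _ _)) ⟩
      tri n (λ c k → Q c k * z k) + tri n (λ c k → Q c k * x c * z k + Q′ c k * y c * z k)
        ≈⟨ +-congˡ (tri-cong n (λ c k → +-cong (*-assoc _ _ _) (*-assoc _ _ _))) ⟩
      tri n (λ c k → Q c k * z k) + tri n (λ c k → Q c k * (x c * z k) + Q′ c k * (y c * z k)) ∎
      where
      k : ℕ → ℕ → ℕ
      k i j = suc (i ℕ.+ j)
      expand : ∀ p z x y → p * (z * (⟦ + 1 ⟧ + x + y)) ≈ p * z + (p * x * z + p * y * z)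
      expand = solve 4 (λ p z x y → p :* (z :* (con (+ 1) :+ x :+ y)) :=
                                    p :* z :+ (p :* x :* z :+ p :* y :* z))

  -- This is the substitution c ↦ k - 1 - c in the inner sum. Passing through the square, where it
  -- exchanges i and j, avoids truncated subtraction.
  reflect : ∀ n {z : ℕ → Carrier} → (∀ k → n ℕ.≤ k → z k ≈ 0#) → ∀ (Q Q′ : ℕ → ℕ → Carrier) →
    (∀ i j → Q i (suc (i ℕ.+ j)) ≈ Q′ j (suc (i ℕ.+ j))) →
    tri n (λ c k → Q c k * z k) ≈ tri n (λ c k → Q′ c k * z k)
  reflect n {z} z-vanish Q Q′ eq = begin
    tri n (λ c k → Q c k * z k)  ≈⟨ sym (box≈tri n (λ c k → Q c k * z k) (van Q)) ⟩
    box n (λ i j → Q i (suc (i ℕ.+ j)) * z (suc (i ℕ.+ j)))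
      ≈⟨ box-cong n (λ i j → *-congʳ (eq i j)) ⟩
    box n (λ i j → Q′ j (suc (i ℕ.+ j)) * z (suc (i ℕ.+ j)))
      ≈⟨ box≈tri′ n (λ c k → Q′ c k * z k) (van Q′) ⟩
    tri n (λ c k → Q′ c k * z k) ∎
    where
    van : ∀ (f : ℕ → ℕ → Carrier) c k → n ℕ.≤ k → f c k * z k ≈ 0#
    van f c k n≤k = trans (*-congˡ (z-vanish k n≤k)) (zeroʳ _)

  -- Lambert sums sorted by the larger index

  open import Algebra.Properties.Semiring.Exp semiring public using (_^_; ^-congˡ)

  -- With a = i + 1, `ν i` is a and `s i` is (-1)ᵃ. The sum of the numbers at i and j therefore sits
  -- at index i + j + 1.
  ν s : ℕ → Carrier
  ν i = ⟦ + suc i ⟧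
  s zero    = - ⟦ + 1 ⟧
  s (suc i) = - s i

  ν-suc : ∀ i → ν (suc i) ≈ ν i + ⟦ + 1 ⟧
  ν-suc i = trans (reflexive (≡.cong (⟦_⟧ ∘ +_) (≡.sym (ℕ.+-comm (suc i) 1)))) (+-homo (+ suc i) (+ 1))

  ν-+ : ∀ i j → ν (suc (i ℕ.+ j)) ≈ ν i + ν j
  ν-+ i j = trans (reflexive (≡.cong (⟦_⟧ ∘ +_) (≡.sym (ℕ.+-suc (suc i) j)))) (+-homo (+ suc i) (+ suc j))

  s-+ : ∀ i j → s (suc (i ℕ.+ j)) ≈ s i * s j
  s-+ zero    j = solve 1 (λ x → :- x := :- con (+ 1) :* x) (s j)
  s-+ (suc i) j = trans (-‿cong (s-+ i j)) (solve 2 (λ x y → :- (x :* y) := :- x :* y) (s i) (s j))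

  s² : ∀ i → s i * s i ≈ ⟦ + 1 ⟧
  s² zero    = solve 0 (:- con (+ 1) :* :- con (+ 1) := con (+ 1))
  s² (suc i) = trans (solve 1 (λ x → :- x :* :- x := x :* x) (s i)) (s² i)

  ν-difference : ∀ i j → ν (suc (i ℕ.+ j)) - ν i ≈ ν j
  ν-difference i j = trans (+-congʳ (ν-+ i j))
    (solve 2 (λ x y → x :+ y :- x := y) (ν i) (ν j))

  ν-difference′ : ∀ i j → ν (suc (i ℕ.+ j)) - ν j ≈ ν i
  ν-difference′ i j = trans (+-congʳ (ν-+ i j))
    (solve 2 (λ x y → x :+ y :- y := x) (ν i) (ν j))

  s-quotient : ∀ i j → s (suc (i ℕ.+ j)) * s i ≈ s j
  s-quotient i j = begin
    s (suc (i ℕ.+ j)) * s i  ≈⟨ *-congʳ (s-+ i j) ⟩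
    s i * s j * s i          ≈⟨ solve 2 (λ x y → x :* y :* x := x :* x :* y) (s i) (s j) ⟩
    s i * s i * s j          ≈⟨ *-congʳ (s² i) ⟩
    ⟦ + 1 ⟧ * s j            ≈⟨ solve 1 (λ x → con (+ 1) :* x := x) (s j) ⟩
    s j ∎

  s-quotient′ : ∀ i j → s (suc (i ℕ.+ j)) * s j ≈ s i
  s-quotient′ i j = trans (*-congʳ (trans (s-+ i j) (*-comm (s i) (s j))))
    (trans (solve 2 (λ x y → y :* x :* y := y :* y :* x) (s i) (s j))
      (trans (*-congʳ (s² j)) (solve 1 (λ x → con (+ 1) :* x := x) (s i))))

  ∑-lin₂ : ∀ n a f b g → ∑ n (λ i → a * f i + b * g i) ≈ a * ∑ n f + b * ∑ n g
  ∑-lin₂ n a f b g = trans (∑-+ n _ _) (+-cong (∑-*ˡ n a f) (∑-*ˡ n b g))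

  ∑-lin₃ : ∀ n a f b g c h →
    ∑ n (λ i → a * f i + b * g i + c * h i) ≈ a * ∑ n f + b * ∑ n g + c * ∑ n h
  ∑-lin₃ n a f b g c h = trans (∑-+ n _ _) (+-cong (∑-lin₂ n a f b g) (∑-*ˡ n c h))

  ∑-neg : ∀ n f → ∑ n (λ i → - f i) ≈ - ∑ n f
  ∑-neg n f = trans (∑-cong n (λ i → solve 1 (λ x → :- x := con -[1+ 0 ] :* x) (f i)))
    (trans (∑-*ˡ n _ f) (solve 1 (λ x → con -[1+ 0 ] :* x := :- x) (∑ n f)))

  ∑-const : ∀ k x → ∑ k (λ _ → x) ≈ (ν k - ⟦ + 1 ⟧) * x
  ∑-const zero    x = trans (sym 0-homo)
    (solve 1 (λ x → con (+ 0) := (con (+ 1) :- con (+ 1)) :* x) x)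
  ∑-const (suc k) x = begin
    x + ∑ k (λ _ → x)                 ≈⟨ +-congˡ (∑-const k x) ⟩
    x + (ν k - ⟦ + 1 ⟧) * x           ≈⟨ solve 2 (λ v x → x :+ (v :- con (+ 1)) :* x :=
                                           (v :+ con (+ 1) :- con (+ 1)) :* x) (ν k) x ⟩
    (ν k + ⟦ + 1 ⟧ - ⟦ + 1 ⟧) * x     ≈⟨ *-congʳ (+-congʳ (sym (ν-suc k))) ⟩
    (ν (suc k) - ⟦ + 1 ⟧) * x ∎

  -- Indices are shifted by one: t i and w i stand for qᵃ/(1 + qᵃ) and qᵃ/(1 - qᵃ) with a = i + 1,
  -- in a ring where qⁿ⁺¹ = 0.
  record IsLambert (n : ℕ) (t w : ℕ → Carrier) : Set where
    field
      t-vanish : ∀ k → n ℕ.≤ k → t k ≈ 0#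
      w-vanish : ∀ k → n ℕ.≤ k → w k ≈ 0#
      tt       : ∀ i j → t i * t j ≈ w (suc (i ℕ.+ j)) * (⟦ + 1 ⟧ - t i - t j)
      wt       : ∀ i j → w i * t j ≈ t (suc (i ℕ.+ j)) * (⟦ + 1 ⟧ + w i - t j)
      halving  : ∀ i → ⟦ + 2 ⟧ * (w i * t i) ≈ w i - t i

  module Sorted {n t w} (L : IsLambert n t w) where
    open IsLambert L

    -- The partial fraction fits `convolution` with x = y = - t and z = w. The bilinear terms of
    -- both sides are collected on the left, after the square is split along its diagonal; the right
    -- side is linear up to that diagonal.
    sorted-tt : ∀ (P Q Q′ : ℕ → ℕ → Carrier) →
      (∀ i j → Q i (suc (i ℕ.+ j)) ≈ P i j) → (∀ i j → Q′ j (suc (i ℕ.+ j)) ≈ P i j) →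
      tri n (λ c k → (P c k + P k c) * (t c * t k) + (Q c k + Q′ c k) * (w k * t c)) ≈
      tri n (λ c k → Q′ c k * w k) - ∑ n (λ k → P k k * (t k * t k))
    sorted-tt P Q Q′ Q≈P Q′≈P = begin
      tri n (λ c k → (P c k + P k c) * (t c * t k) + (Q c k + Q′ c k) * (w k * t c))
        ≈⟨ trans (tri-cong n (λ c k → regroup _ _ _ _ _ _ _)) (tri-+ n _ _) ⟩
      tri n S + tri n (λ c k → - B c k)
        ≈⟨ +-congˡ (tri-neg B) ⟩
      tri n S - tri n B
        ≈⟨ solve 3 (λ S D B → S :- B := (S :+ D) :- (D :+ B)) (tri n S) D (tri n B) ⟩
      (tri n S + D) - (D + tri n B)
        ≈⟨ +-congʳ (sym (box-split n (λ i j → P i j * (t i * t j)))) ⟩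
      box n (λ i j → P i j * (t i * t j)) - (D + tri n B)
        ≈⟨ +-congʳ (box-cong n (λ i j → solve 3 (λ p x y → p :* (x :* y) := p :* (:- x :* :- y)) (P i j) (t i) (t j))) ⟩
      box n (λ i j → P i j * (- t i * - t j)) - (D + tri n B)
        ≈⟨ +-congʳ (convolution n w-vanish fraction P Q Q′ Q≈P Q′≈P) ⟩
      (tri n (λ c k → Q c k * w k) + tri n B) - (D + tri n B)
        ≈⟨ solve 3 (λ Q B D → (Q :+ B) :- (D :+ B) := Q :- D) _ (tri n B) D ⟩
      tri n (λ c k → Q c k * w k) - D
        ≈⟨ +-congʳ (reflect n w-vanish Q Q′ (λ i j → trans (Q≈P i j) (sym (Q′≈P i j)))) ⟩
      tri n (λ c k → Q′ c k * w k) - D ∎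
      where
      S B : ℕ → ℕ → Carrier
      S c k = P c k * (t c * t k) + P k c * (t k * t c)
      B c k = Q c k * (- t c * w k) + Q′ c k * (- t c * w k)
      D = ∑ n (λ k → P k k * (t k * t k))
      fraction : ∀ i j → - t i * - t j ≈ w (suc (i ℕ.+ j)) * (⟦ + 1 ⟧ + - t i + - t j)
      fraction i j = trans (solve 2 (λ x y → :- x :* :- y := x :* y) (t i) (t j)) (tt i j)
      regroup : ∀ p p′ q q′ x y z → (p + p′) * (x * y) + (q + q′) * (z * x) ≈
        (p * (x * y) + p′ * (y * x)) + - (q * (- x * z) + q′ * (- x * z))
      regroup = solve 7 (λ p p′ q q′ x y z → (p :+ p′) :* (x :* y) :+ (q :+ q′) :* (z :* x) :=
        (p :* (x :* y) :+ p′ :* (y :* x)) :+ :- (q :* (:- x :* z) :+ q′ :* (:- x :* z)))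
      tri-neg : ∀ f → tri n (λ c k → - f c k) ≈ - tri n f
      tri-neg f = trans (∑-cong n (λ k → ∑-neg k _)) (∑-neg n _)

    -- Here x = w, y = - t and z = - t in `convolution`. The two factors differ, so P c k and P k c
    -- multiply the different products w c * t k and w k * t c; `sorted-tt` can cancel the second
    -- kind.
    sorted-wt : ∀ (P Q Q′ : ℕ → ℕ → Carrier) →
      (∀ i j → Q i (suc (i ℕ.+ j)) ≈ P i j) → (∀ i j → Q′ j (suc (i ℕ.+ j)) ≈ P i j) →
      tri n (λ c k → Q′ c k * (t c * t k) + (P c k - Q c k) * (w c * t k) + P k c * (w k * t c)) ≈
      tri n (λ c k → Q c k * t k) - ∑ n (λ k → P k k * (w k * t k))
    sorted-wt P Q Q′ Q≈P Q′≈P = begin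
      tri n (λ c k → Q′ c k * (t c * t k) + (P c k - Q c k) * (w c * t k) + P k c * (w k * t c))
        ≈⟨ trans (tri-cong n (λ c k → regroup _ _ _ _ _ _ _ _)) (tri-+ n _ _) ⟩
      tri n S + tri n (λ c k → B c k)
        ≈⟨ solve 3 (λ S D B → S :+ B := (S :+ D) :+ (B :- D)) (tri n S) D (tri n B) ⟩
      (tri n S + D) + (tri n B - D)
        ≈⟨ +-congʳ (sym (box-split n (λ i j → P i j * (w i * t j)))) ⟩
      box n (λ i j → P i j * (w i * t j)) + (tri n B - D)
        ≈⟨ +-congʳ (trans (box-cong n (λ i j → solve 3 (λ p x y → p :* (x :* y) := con -[1+ 0 ] :* (p :* (x :* :- y))) (P i j) (w i) (t j)))
             (trans (∑-cong n (λ i → ∑-*ˡ n _ _)) (∑-*ˡ n _ _))) ⟩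
      ⟦ -[1+ 0 ] ⟧ * box n (λ i j → P i j * (w i * - t j)) + (tri n B - D)
        ≈⟨ +-congʳ (*-congˡ (convolution n -t-vanish fraction P Q Q′ Q≈P Q′≈P)) ⟩
      ⟦ -[1+ 0 ] ⟧ * (tri n (λ c k → Q c k * - t k) + tri n C) + (tri n B - D)
        ≈⟨ +-congʳ (distribˡ _ _ _) ⟩
      (⟦ -[1+ 0 ] ⟧ * tri n (λ c k → Q c k * - t k) + ⟦ -[1+ 0 ] ⟧ * tri n C) + (tri n B - D)
        ≈⟨ +-congʳ (+-cong
             (trans (sym (tri-*ˡ n _ _)) (tri-cong n (λ c k → solve 2 (λ q x → con -[1+ 0 ] :* (q :* :- x) := q :* x) (Q c k) (t k))))
             (*-congˡ (tri-cong n (λ c k → solve 5 (λ q q′ x y z → q :* (z :* :- y) :+ q′ :* (:- x :* :- y) :=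
                q′ :* (x :* y) :- q :* (z :* y)) (Q c k) (Q′ c k) (t c) (t k) (w c))))) ⟩
      (tri n (λ c k → Q c k * t k) + ⟦ -[1+ 0 ] ⟧ * tri n B) + (tri n B - D)
        ≈⟨ solve 3 (λ Q B D → (Q :+ con -[1+ 0 ] :* B) :+ (B :- D) := Q :- D) _ (tri n B) D ⟩
      tri n (λ c k → Q c k * t k) - D ∎
      where
      S B C : ℕ → ℕ → Carrier
      S c k = P c k * (w c * t k) + P k c * (w k * t c)
      B c k = Q′ c k * (t c * t k) - Q c k * (w c * t k)
      C c k = Q c k * (w c * - t k) + Q′ c k * (- t c * - t k)
      D = ∑ n (λ k → P k k * (w k * t k))
      -t-vanish : ∀ k → n ℕ.≤ k → - t k ≈ 0#
      -t-vanish k n≤k = trans (-‿cong (trans (t-vanish k n≤k) (sym 0-homo)))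
        (trans (solve 0 (:- con (+ 0) := con (+ 0))) 0-homo)
      fraction : ∀ i j → w i * - t j ≈ - t (suc (i ℕ.+ j)) * (⟦ + 1 ⟧ + w i + - t j)
      fraction i j = trans (solve 2 (λ x y → x :* :- y := :- (x :* y)) (w i) (t j))
        (trans (-‿cong (wt i j)) (solve 2 (λ x y → :- (x :* y) := :- x :* y) _ _))
      regroup : ∀ p p′ q q′ x y z z′ →
        q′ * (x * y) + (p - q) * (z * y) + p′ * (z′ * x) ≈
        (p * (z * y) + p′ * (z′ * x)) + (q′ * (x * y) - q * (z * y))
      regroup = solve 8 (λ p p′ q q′ x y z z′ →
        q′ :* (x :* y) :+ (p :- q) :* (z :* y) :+ p′ :* (z′ :* x) :=
        (p :* (z :* y) :+ p′ :* (z′ :* x)) :+ (q′ :* (x :* y) :- q :* (z :* y)))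

  -- The square of an elliptic function

  -- Both sides grow by s k * (F (ν k) - F (ν k + 1)) when k is replaced by k + 1.
  alternating : ∀ (F φ : Carrier → Carrier) →
    (∀ {x y} → x ≈ y → F x ≈ F y) → (∀ {x y} → x ≈ y → φ x ≈ φ y) →
    F ⟦ + 1 ⟧ ≈ φ ⟦ + 1 ⟧ → (∀ x → φ (x + ⟦ + 1 ⟧) + φ x ≈ F (x + ⟦ + 1 ⟧) - F x) →
    ∀ k → ⟦ + 2 ⟧ * ∑ k (λ c → s c * F (ν c)) + s k * F (ν k) ≈ s k * φ (ν k)
  alternating F φ F-cong φ-cong base step zero = trans (+-congʳ (*-congˡ (sym 0-homo)))
    (trans (solve 2 (λ s f → con (+ 2) :* con (+ 0) :+ s :* f := s :* f) (s 0) (F (ν 0))) (*-congˡ base))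
  alternating F φ F-cong φ-cong base step (suc k) = begin
    ⟦ + 2 ⟧ * ∑ (suc k) (λ c → s c * F (ν c)) + s (suc k) * F (ν (suc k))
      ≈⟨ +-cong (*-congˡ (∑-snoc k _)) (*-congˡ (F-cong (ν-suc k))) ⟩
    ⟦ + 2 ⟧ * (∑ k (λ c → s c * F (ν c)) + s k * F (ν k)) + - s k * F (ν k + ⟦ + 1 ⟧)
      ≈⟨ solve 4 (λ a s f g → con (+ 2) :* (a :+ s :* f) :+ :- s :* g :=
           (con (+ 2) :* a :+ s :* f) :- s :* (g :- f)) _ (s k) (F (ν k)) (F (ν k + ⟦ + 1 ⟧)) ⟩
    (⟦ + 2 ⟧ * ∑ k (λ c → s c * F (ν c)) + s k * F (ν k)) - s k * (F (ν k + ⟦ + 1 ⟧) - F (ν k))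
      ≈⟨ +-cong (alternating F φ F-cong φ-cong base step k) (-‿cong (*-congˡ (sym (step (ν k))))) ⟩
    s k * φ (ν k) - s k * (φ (ν k + ⟦ + 1 ⟧) + φ (ν k))
      ≈⟨ solve 3 (λ s x y → s :* x :- s :* (y :+ x) := :- s :* y) (s k) (φ (ν k)) (φ (ν k + ⟦ + 1 ⟧)) ⟩
    - s k * φ (ν k + ⟦ + 1 ⟧)
      ≈⟨ *-congˡ (φ-cong (sym (ν-suc k))) ⟩
    s (suc k) * φ (ν (suc k)) ∎

  module _ {n t w} (L : IsLambert n t w) (F φ : Carrier → Carrier)
    (F-cong : ∀ {x y} → x ≈ y → F x ≈ F y) (F-even : ∀ x → F (- x) ≈ F x) (F-0 : F ⟦ + 0 ⟧ ≈ ⟦ + 0 ⟧)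
    (closed : ∀ k → ⟦ + 2 ⟧ * ∑ k (λ c → s c * F (ν c)) + s k * F (ν k) ≈ s k * φ (ν k)) where

    open IsLambert L
    open Sorted L

    -- By sin au sin bu = ½ (cos (a - b)u - cos (a + b)u), this is the Fourier expansion of the square
    -- of the elliptic function Σ (-1)ᵃ t(a) sin au + ¼ tan ½u, with F k in place of cos ku.
    square : box n (λ i j → s i * s j * (F (ν i - ν j) - F (ν i + ν j)) * (t i * t j)) ≈
             ∑ n (λ k → s k * φ (ν k) * t k) - ∑ n (λ k → s k * (ν k * F (ν k)) * w k)
    square = begin
      box n (λ i j → P i j * (t i * t j))
        ≈⟨ box-split n (λ i j → P i j * (t i * t j)) ⟩
      tri n (λ c k → P c k * (t c * t k) + P k c * (t k * t c)) + ∑ n (λ k → P k k * (t k * t k))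
        -- Twice the w t relation for `P₂` minus the t t relation for `P₁`. The terms in w k * t c
        -- cancel because P₂ k c = Q₁ c k, those in w c * t k because `P₂` depends on its first
        -- index only and serves as its own Q. What remains is the product t c * t k with the weight
        -- `P`.
        ≈⟨ +-congʳ (trans (tri-cong n sorted) (trans (tri-+ n _ _) (+-cong (tri-*ˡ n _ _) (tri-*ˡ n _ _)))) ⟩
      (⟦ + 2 ⟧ * tri n (λ c k → Q₂′ c k * (t c * t k) + (P₂ c k - P₂ c k) * (w c * t k) + P₂ k c * (w k * t c))
       + ⟦ -[1+ 0 ] ⟧ * tri n (λ c k → (P₁ c k + P₁ k c) * (t c * t k) + (Q₁ c k + Q₁ c k) * (w k * t c)))
       + ∑ n (λ k → P k k * (t k * t k))
        ≈⟨ +-congʳ (+-cong (*-congˡ (sorted-wt P₂ P₂ Q₂′ (λ i j → refl) Q₂′≈P₂))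
                           (*-congˡ (sorted-tt P₁ Q₁ Q₁ Q₁≈P₁ Q₁≈P₁))) ⟩
      (⟦ + 2 ⟧ * (tri n (λ c k → P₂ c k * t k) - ∑ n (λ k → P₂ k k * (w k * t k)))
       + ⟦ -[1+ 0 ] ⟧ * (tri n (λ c k → Q₁ c k * w k) - ∑ n (λ k → P₁ k k * (t k * t k))))
       + ∑ n (λ k → P k k * (t k * t k))
        ≈⟨ solve 5 (λ l₂ d₂ l₁ d₁ d → con (+ 2) :* (l₂ :- d₂) :+ con -[1+ 0 ] :* (l₁ :- d₁) :+ d :=
             (con (+ 2) :* l₂ :- (l₁ :+ con (+ 2) :* d₂)) :+ (d₁ :+ d)) _ _ _ _ _ ⟩
      (⟦ + 2 ⟧ * tri n (λ c k → P₂ c k * t k)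
        - (tri n (λ c k → Q₁ c k * w k) + ⟦ + 2 ⟧ * ∑ n (λ k → P₂ k k * (w k * t k))))
       + (∑ n (λ k → P₁ k k * (t k * t k)) + ∑ n (λ k → P k k * (t k * t k)))
        -- By `halving` the diagonal of w t becomes linear, and its t part matches the end term in
        -- `linear-t`. The diagonals of `P₁` and `P` add up to a multiple of F 0.
        ≈⟨ +-cong (+-cong linear-t (-‿cong linear-w)) (trans (sym (∑-+ n _ _)) (∑-0 n diagonal)) ⟩
      ((∑ n (λ k → s k * φ (ν k) * t k) - ∑ n (λ k → s k * F (ν k) * t k))
        - (∑ n (λ k → s k * (ν k * F (ν k)) * w k) - ∑ n (λ k → s k * F (ν k) * t k)))
       + 0#
        ≈⟨ +-identityʳ _ ⟩
      (∑ n (λ k → s k * φ (ν k) * t k) - ∑ n (λ k → s k * F (ν k) * t k))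
        - (∑ n (λ k → s k * (ν k * F (ν k)) * w k) - ∑ n (λ k → s k * F (ν k) * t k))
        ≈⟨ solve 3 (λ x y z → (x :- z) :- (y :- z) := x :- y) _ _ _ ⟩
      ∑ n (λ k → s k * φ (ν k) * t k) - ∑ n (λ k → s k * (ν k * F (ν k)) * w k) ∎
      where
      P P₁ P₂ Q₁ Q₂′ : ℕ → ℕ → Carrier
      P  i j = s i * s j * (F (ν i - ν j) - F (ν i + ν j))
      P₁ i j = s i * s j * F (ν i + ν j)
      P₂ i j = s i * F (ν i)
      Q₁ c k = s k * F (ν k)
      Q₂′ c k = s k * s c * F (ν k - ν c)

      Q₁≈P₁ : ∀ i j → s (suc (i ℕ.+ j)) * F (ν (suc (i ℕ.+ j))) ≈ s i * s j * F (ν i + ν j)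
      Q₁≈P₁ i j = *-cong (s-+ i j) (F-cong (ν-+ i j))

      Q₂′≈P₂ : ∀ i j → Q₂′ j (suc (i ℕ.+ j)) ≈ s i * F (ν i)
      Q₂′≈P₂ i j = *-cong (s-quotient′ i j) (F-cong (ν-difference′ i j))

      swap : ∀ i j → F (ν i - ν j) ≈ F (ν j - ν i)
      swap i j = trans (F-cong (solve 2 (λ x y → x :- y := :- (y :- x)) (ν i) (ν j))) (F-even _)

      sorted : ∀ c k → P c k * (t c * t k) + P k c * (t k * t c) ≈
        ⟦ + 2 ⟧ * (Q₂′ c k * (t c * t k) + (P₂ c k - P₂ c k) * (w c * t k) + P₂ k c * (w k * t c)) +
        ⟦ -[1+ 0 ] ⟧ * ((P₁ c k + P₁ k c) * (t c * t k) + (Q₁ c k + Q₁ c k) * (w k * t c))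
      sorted c k = begin
        P c k * (t c * t k) + P k c * (t k * t c)
          ≈⟨ +-cong (*-congʳ (*-congˡ (+-congʳ (swap c k))))
                    (*-congʳ (*-congˡ (+-congˡ (-‿cong (F-cong (+-comm (ν k) (ν c))))))) ⟩
        s c * s k * (F (ν k - ν c) - F (ν c + ν k)) * (t c * t k) +
        s k * s c * (F (ν k - ν c) - F (ν c + ν k)) * (t k * t c)
          ≈⟨ solve 10 (λ sc sk a b fc fk tc tk wc wk →
               sc :* sk :* (a :- b) :* (tc :* tk) :+ sk :* sc :* (a :- b) :* (tk :* tc) :=
               con (+ 2) :* (sk :* sc :* a :* (tc :* tk) :+ (sc :* fc :- sc :* fc) :* (wc :* tk) :+ sk :* fk :* (wk :* tc)) :+
               con -[1+ 0 ] :* ((sc :* sk :* b :+ sk :* sc :* b) :* (tc :* tk) :+ (sk :* fk :+ sk :* fk) :* (wk :* tc))) (s c) (s k) (F (ν k - ν c)) (F (ν c + ν k)) (F (ν c)) (F (ν k)) (t c) (t k) (w c) (w k) ⟩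
        ⟦ + 2 ⟧ * (Q₂′ c k * (t c * t k) + (P₂ c k - P₂ c k) * (w c * t k) + P₂ k c * (w k * t c)) +
        ⟦ -[1+ 0 ] ⟧ * ((P₁ c k + s k * s c * F (ν c + ν k)) * (t c * t k) + (Q₁ c k + Q₁ c k) * (w k * t c))
          ≈⟨ +-congˡ (*-congˡ (+-congʳ (*-congʳ (+-congˡ (*-congˡ (F-cong (+-comm (ν c) (ν k)))))))) ⟩
        ⟦ + 2 ⟧ * (Q₂′ c k * (t c * t k) + (P₂ c k - P₂ c k) * (w c * t k) + P₂ k c * (w k * t c)) +
        ⟦ -[1+ 0 ] ⟧ * ((P₁ c k + P₁ k c) * (t c * t k) + (Q₁ c k + Q₁ c k) * (w k * t c)) ∎

      linear-t : ⟦ + 2 ⟧ * tri n (λ c k → P₂ c k * t k) ≈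
        ∑ n (λ k → s k * φ (ν k) * t k) - ∑ n (λ k → s k * F (ν k) * t k)
      linear-t = begin
        ⟦ + 2 ⟧ * tri n (λ c k → P₂ c k * t k)
          ≈⟨ *-congˡ (∑-cong n (λ k → ∑-*ʳ k (t k) _)) ⟩
        ⟦ + 2 ⟧ * ∑ n (λ k → ∑ k (λ c → s c * F (ν c)) * t k)
          ≈⟨ trans (sym (∑-*ˡ n _ _)) (∑-cong n (λ k → trans
               (solve 4 (λ x s f t → con (+ 2) :* (x :* t) := (con (+ 2) :* x :+ s :* f) :* t :+ :- (s :* f :* t)) _ (s k) (F (ν k)) (t k))
               (+-congʳ (*-congʳ (closed k))))) ⟩
        ∑ n (λ k → s k * φ (ν k) * t k + - (s k * F (ν k) * t k))
          ≈⟨ trans (∑-+ n _ _) (+-congˡ (∑-neg n _)) ⟩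
        ∑ n (λ k → s k * φ (ν k) * t k) - ∑ n (λ k → s k * F (ν k) * t k) ∎

      linear-w : tri n (λ c k → Q₁ c k * w k) + ⟦ + 2 ⟧ * ∑ n (λ k → P₂ k k * (w k * t k)) ≈
        ∑ n (λ k → s k * (ν k * F (ν k)) * w k) - ∑ n (λ k → s k * F (ν k) * t k)
      linear-w = begin
        tri n (λ c k → Q₁ c k * w k) + ⟦ + 2 ⟧ * ∑ n (λ k → P₂ k k * (w k * t k))
          ≈⟨ +-cong (∑-cong n (λ k → ∑-const k _)) (sym (∑-*ˡ n _ _)) ⟩
        ∑ n (λ k → (ν k - ⟦ + 1 ⟧) * (Q₁ 0 k * w k)) + ∑ n (λ k → ⟦ + 2 ⟧ * (P₂ k k * (w k * t k)))
          ≈⟨ sym (∑-+ n _ _) ⟩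
        ∑ n (λ k → (ν k - ⟦ + 1 ⟧) * (Q₁ 0 k * w k) + ⟦ + 2 ⟧ * (P₂ k k * (w k * t k)))
          ≈⟨ ∑-cong n (λ k → trans
               (solve 5 (λ s f v w t → (v :- con (+ 1)) :* (s :* f :* w) :+ con (+ 2) :* (s :* f :* (w :* t)) :=
                  (v :- con (+ 1)) :* (s :* f :* w) :+ s :* f :* (con (+ 2) :* (w :* t))) (s k) (F (ν k)) (ν k) (w k) (t k))
               (trans (+-congˡ (*-congˡ (halving k)))
               (solve 5 (λ s f v w t → (v :- con (+ 1)) :* (s :* f :* w) :+ s :* f :* (w :- t) :=
                  s :* (v :* f) :* w :+ :- (s :* f :* t)) (s k) (F (ν k)) (ν k) (w k) (t k)))) ⟩
        ∑ n (λ k → s k * (ν k * F (ν k)) * w k + - (s k * F (ν k) * t k))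
          ≈⟨ trans (∑-+ n _ _) (+-congˡ (∑-neg n _)) ⟩
        ∑ n (λ k → s k * (ν k * F (ν k)) * w k) - ∑ n (λ k → s k * F (ν k) * t k) ∎

      diagonal : ∀ k → P₁ k k * (t k * t k) + P k k * (t k * t k) ≈ 0#
      diagonal k = begin
        P₁ k k * (t k * t k) + P k k * (t k * t k)
          ≈⟨ solve 4 (λ s a b t → s :* s :* a :* (t :* t) :+ s :* s :* (b :- a) :* (t :* t) := s :* s :* b :* (t :* t)) (s k) (F (ν k + ν k)) (F (ν k - ν k)) (t k) ⟩
        s k * s k * F (ν k - ν k) * (t k * t k)
          ≈⟨ *-congʳ (*-congˡ (trans (F-cong (solve 1 (λ x → x :- x := con (+ 0)) (ν k))) F-0)) ⟩
        s k * s k * ⟦ + 0 ⟧ * (t k * t k)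
          ≈⟨ solve 2 (λ s t → s :* s :* con (+ 0) :* (t :* t) := con (+ 0)) (s k) (t k) ⟩
        ⟦ + 0 ⟧  ≈⟨ 0-homo ⟩
        0# ∎

  -- Its product with that square

  ∑ν : ∀ k → ⟦ + 2 ⟧ * ∑ k ν ≈ ν k * (ν k - ⟦ + 1 ⟧)
  ∑ν zero    = trans (*-congˡ (sym 0-homo))
    (solve 0 (con (+ 2) :* con (+ 0) := con (+ 1) :* (con (+ 1) :- con (+ 1))))
  ∑ν (suc k) = begin
    ⟦ + 2 ⟧ * ∑ (suc k) ν        ≈⟨ *-congˡ (∑-snoc k ν) ⟩
    ⟦ + 2 ⟧ * (∑ k ν + ν k)      ≈⟨ distribˡ _ _ _ ⟩
    ⟦ + 2 ⟧ * ∑ k ν + ⟦ + 2 ⟧ * ν k  ≈⟨ +-congʳ (∑ν k) ⟩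
    ν k * (ν k - ⟦ + 1 ⟧) + ⟦ + 2 ⟧ * ν k
      ≈⟨ solve 1 (λ v → v :* (v :- con (+ 1)) :+ con (+ 2) :* v :=
           (v :+ con (+ 1)) :* (v :+ con (+ 1) :- con (+ 1))) (ν k) ⟩
    (ν k + ⟦ + 1 ⟧) * (ν k + ⟦ + 1 ⟧ - ⟦ + 1 ⟧)
      ≈⟨ sym (*-cong (ν-suc k) (+-congʳ (ν-suc k))) ⟩
    ν (suc k) * (ν (suc k) - ⟦ + 1 ⟧) ∎

  -- `ε` and `δ` are closed forms, given through their difference equations, of the first and second
  -- summation of `ψ`. Counting the end point half in `∑ψ` simplifies alternating sums; m clears the
  -- denominators and is 2 for (-1)ᵃ a and 4 for (-1)ᵃ a³.
  module Closed (ψ ε δ : ℕ → Carrier) (m : Carrier)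
    (ε-0 : ε 0 ≈ m * ψ 0) (ε-suc : ∀ k → ε k + m * (ψ k + ψ (suc k)) ≈ ε (suc k))
    (δ-0 : δ 0 ≈ ⟦ + 0 ⟧) (δ-suc : ∀ k → δ k + (ε k + m * ψ k) ≈ δ (suc k)) where

    ∑ψ : ∀ k → m * (⟦ + 2 ⟧ * ∑ k ψ + ψ k) ≈ ε k
    ∑ψ zero = trans (*-congˡ (+-congʳ (*-congˡ (sym 0-homo))))
      (trans (solve 2 (λ m p → m :* (con (+ 2) :* con (+ 0) :+ p) := m :* p) m (ψ 0)) (sym ε-0))
    ∑ψ (suc k) = begin
      m * (⟦ + 2 ⟧ * ∑ (suc k) ψ + ψ (suc k))  ≈⟨ *-congˡ (+-congʳ (*-congˡ (∑-snoc k ψ))) ⟩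
      m * (⟦ + 2 ⟧ * (∑ k ψ + ψ k) + ψ (suc k))
        ≈⟨ solve 4 (λ m a p q → m :* (con (+ 2) :* (a :+ p) :+ q) :=
             m :* (con (+ 2) :* a :+ p) :+ m :* (p :+ q)) m (∑ k ψ) (ψ k) (ψ (suc k)) ⟩
      m * (⟦ + 2 ⟧ * ∑ k ψ + ψ k) + m * (ψ k + ψ (suc k))  ≈⟨ +-congʳ (∑ψ k) ⟩
      ε k + m * (ψ k + ψ (suc k))  ≈⟨ ε-suc k ⟩
      ε (suc k) ∎

    ∑-tent : ∀ k → m * (⟦ + 2 ⟧ * ∑ k (λ c → (ν k - ν c) * ψ c)) ≈ δ k
    ∑-tent zero = trans (*-congˡ (*-congˡ (sym 0-homo)))
      (trans (solve 1 (λ m → m :* (con (+ 2) :* con (+ 0)) := con (+ 0)) m) (sym δ-0))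
    ∑-tent (suc k) = begin
      m * (⟦ + 2 ⟧ * ∑ (suc k) (λ c → (ν (suc k) - ν c) * ψ c))
        ≈⟨ *-congˡ (*-congˡ (∑-cong (suc k) (λ c → trans (*-congʳ (+-congʳ (ν-suc k)))
             (solve 3 (λ v c p → (v :+ con (+ 1) :- c) :* p := (v :- c) :* p :+ p) (ν k) (ν c) (ψ c))))) ⟩
      m * (⟦ + 2 ⟧ * ∑ (suc k) (λ c → (ν k - ν c) * ψ c + ψ c))
        ≈⟨ *-congˡ (*-congˡ (trans (∑-snoc k _) (+-congʳ (∑-+ k _ ψ)))) ⟩
      m * (⟦ + 2 ⟧ * ((∑ k (λ c → (ν k - ν c) * ψ c) + ∑ k ψ) + ((ν k - ν k) * ψ k + ψ k)))
        ≈⟨ solve 5 (λ m a b v p → m :* (con (+ 2) :* ((a :+ b) :+ ((v :- v) :* p :+ p))) :=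
             m :* (con (+ 2) :* a) :+ (m :* (con (+ 2) :* b :+ p) :+ m :* p)) m _ (∑ k ψ) (ν k) (ψ k) ⟩
      m * (⟦ + 2 ⟧ * ∑ k (λ c → (ν k - ν c) * ψ c)) + (m * (⟦ + 2 ⟧ * ∑ k ψ + ψ k) + m * ψ k)
        ≈⟨ +-cong (∑-tent k) (+-congʳ (∑ψ k)) ⟩
      δ k + (ε k + m * ψ k)  ≈⟨ δ-suc k ⟩
      δ (suc k) ∎

  module _ {n t w} (L : IsLambert n t w) (Ψ : Carrier → Carrier)
    (Ψ-cong : ∀ {x y} → x ≈ y → Ψ x ≈ Ψ y) (Ψ-odd : ∀ x → Ψ (- x) ≈ - Ψ x)
    (Ψ-0 : Ψ ⟦ + 0 ⟧ ≈ ⟦ + 0 ⟧) where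

    open IsLambert L
    open Sorted L

    private
      ψ : ℕ → Carrier
      ψ i = s i * Ψ (ν i)

    -- By sin bu cos au = ½ (sin (b + a)u + sin (b - a)u), the Fourier expansion of the product of the
    -- elliptic function of square with its own square, with Ψ k in place of sin ku.
    mixed :
      box n (λ i j → (s i * s j * ν i * (Ψ (ν j + ν i) + Ψ (ν j - ν i)) - ⟦ + 2 ⟧ * (ν i * ψ j)) * (w i * t j)) +
      box n (λ i j → - (⟦ + 2 ⟧ * (ν i * ψ j)) * (t i * t j)) ≈
      (tri n (λ c k → ψ k * ν c * t k) - tri n (λ c k → (ν k - ν c) * ψ c * t k)
        - tri n (λ c k → ν k * ψ c * w k)) - ∑ n (λ k → ν k * ψ k * (w k * t k))
    mixed = begin
      box n (λ i j → P i j * (w i * t j)) + box n (λ i j → R₀ i j * (t i * t j))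
        ≈⟨ +-cong (box-split n (λ i j → P i j * (w i * t j))) (box-split n (λ i j → R₀ i j * (t i * t j))) ⟩
      (tri n (λ c k → P c k * (w c * t k) + P k c * (w k * t c)) + ∑ n (λ k → P k k * (w k * t k))) +
      (tri n (λ c k → R₀ c k * (t c * t k) + R₀ k c * (t k * t c)) + ∑ n (λ k → R₀ k k * (t k * t k)))
        ≈⟨ trans (+-interchange _ _ _ _) (+-congʳ (sym (tri-+ n _ _))) ⟩
      tri n (λ c k → (P c k * (w c * t k) + P k c * (w k * t c)) + (R₀ c k * (t c * t k) + R₀ k c * (t k * t c))) +
      (∑ n (λ k → P k k * (w k * t k)) + ∑ n (λ k → R₀ k k * (t k * t k)))
        -- The w t relation for `PA`, minus the one for `PB`, minus the t t relation for `PC`,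
        -- contains exactly the products of the left side: Ψ of a sum comes from `PA`, Ψ of a
        -- difference from `QB` and `QC`.
        ≈⟨ +-congʳ (trans (tri-cong n sorted) (trans (tri-+ n _ _) (+-congˡ (trans (tri-*ˡ n _ _) (*-congˡ (tri-+ n _ _)))))) ⟩
      (tri n (λ c k → QA′ c k * (t c * t k) + (PA c k - QA c k) * (w c * t k) + PA k c * (w k * t c)) +
       ⟦ -[1+ 0 ] ⟧ *
       (tri n (λ c k → QB′ c k * (t c * t k) + (PB c k - QB c k) * (w c * t k) + PB k c * (w k * t c)) +
        tri n (λ c k → (PC c k + PC k c) * (t c * t k) + (QC c k + QC′ c k) * (w k * t c)))) +
      (∑ n (λ k → P k k * (w k * t k)) + ∑ n (λ k → R₀ k k * (t k * t k)))
        -- `reflect` trades Ψ (ν k - ν c) for `ψ c`, which puts the inner sum into the form of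
        -- `∑-tent`.
        ≈⟨ +-congʳ (+-cong (sorted-wt PA QA QA′ QA≈ QA′≈)
             (*-congˡ (+-cong (trans (sorted-wt PB QB QB′ QB≈ QB′≈)
                (+-congʳ (reflect n t-vanish QB QB′ (λ i j → trans (QB≈ i j) (sym (QB′≈ i j))))))
                (sorted-tt PC QC QC′ QC≈ QC′≈)))) ⟩
      ((tri n (λ c k → QA c k * t k) - ∑ n (λ k → PA k k * (w k * t k))) +
       ⟦ -[1+ 0 ] ⟧ *
       ((tri n (λ c k → QB′ c k * t k) - ∑ n (λ k → PB k k * (w k * t k))) +
        (tri n (λ c k → QC′ c k * w k) - ∑ n (λ k → PC k k * (t k * t k))))) +
      (∑ n (λ k → P k k * (w k * t k)) + ∑ n (λ k → R₀ k k * (t k * t k)))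
        ≈⟨ solve 8 (λ a a′ b b′ c c′ p r → ((a :- a′) :+ con -[1+ 0 ] :* ((b :- b′) :+ (c :- c′))) :+ (p :+ r) :=
              (a :- b :- c) :+ ((p :+ r) :+ (con -[1+ 0 ] :* a′ :+ (b′ :+ c′)))) _ _ _ _ _ _ _ _ ⟩
      (tri n (λ c k → QA c k * t k) - tri n (λ c k → QB′ c k * t k) - tri n (λ c k → QC′ c k * w k)) +
      ((∑ n (λ k → P k k * (w k * t k)) + ∑ n (λ k → R₀ k k * (t k * t k))) +
       (⟦ -[1+ 0 ] ⟧ * ∑ n (λ k → PA k k * (w k * t k)) +
        (∑ n (λ k → PB k k * (w k * t k)) + ∑ n (λ k → PC k k * (t k * t k)))))
        ≈⟨ +-congˡ (trans (sym (trans (∑-+ n _ _) (+-cong (∑-+ n _ _) (trans (∑-+ n _ _) (+-cong (∑-*ˡ n _ _) (∑-+ n _ _))))))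
             (trans (∑-cong n diagonal) (∑-neg n _))) ⟩
      (tri n (λ c k → QA c k * t k) - tri n (λ c k → QB′ c k * t k) - tri n (λ c k → QC′ c k * w k)) -
      ∑ n (λ k → ν k * ψ k * (w k * t k)) ∎
      where
      P R₀ PA PB PC QA QB QC QA′ QB′ QC′ : ℕ → ℕ → Carrier
      P i j = s i * s j * ν i * (Ψ (ν j + ν i) + Ψ (ν j - ν i)) - ⟦ + 2 ⟧ * (ν i * ψ j)
      R₀ i j = - (⟦ + 2 ⟧ * (ν i * ψ j))
      PA i j = s i * s j * Ψ (ν j + ν i) * ν i
      PB i j = ν i * ψ j
      PC i j = (ν i + ν j) * ψ j
      QA c k = ψ k * ν c
      QB c k = ν c * (s k * s c * Ψ (ν k - ν c))
      QC c k = ν k * (s k * s c * Ψ (ν k - ν c))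
      QA′ c k = ψ k * (ν k - ν c)
      QB′ c k = (ν k - ν c) * ψ c
      QC′ c k = ν k * ψ c

      ψ-+ : ∀ i j → ψ (suc (i ℕ.+ j)) ≈ s i * s j * Ψ (ν j + ν i)
      ψ-+ i j = *-cong (s-+ i j) (Ψ-cong (trans (ν-+ i j) (+-comm _ _)))

      ψ-difference : ∀ i j → s (suc (i ℕ.+ j)) * s i * Ψ (ν (suc (i ℕ.+ j)) - ν i) ≈ ψ j
      ψ-difference i j = *-cong (s-quotient i j) (Ψ-cong (ν-difference i j))

      QA≈ : ∀ i j → QA i (suc (i ℕ.+ j)) ≈ PA i j
      QA≈ i j = *-congʳ (ψ-+ i j)
      QA′≈ : ∀ i j → QA′ j (suc (i ℕ.+ j)) ≈ PA i j
      QA′≈ i j = *-cong (ψ-+ i j) (ν-difference′ i j)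
      QB≈ : ∀ i j → QB i (suc (i ℕ.+ j)) ≈ PB i j
      QB≈ i j = *-congˡ (ψ-difference i j)
      QB′≈ : ∀ i j → QB′ j (suc (i ℕ.+ j)) ≈ PB i j
      QB′≈ i j = *-congʳ (ν-difference′ i j)
      QC≈ : ∀ i j → QC i (suc (i ℕ.+ j)) ≈ PC i j
      QC≈ i j = *-cong (ν-+ i j) (ψ-difference i j)
      QC′≈ : ∀ i j → QC′ j (suc (i ℕ.+ j)) ≈ PC i j
      QC′≈ i j = *-congʳ (ν-+ i j)

      swap : ∀ i j → Ψ (ν i - ν j) ≈ - Ψ (ν j - ν i)
      swap i j = trans (Ψ-cong (solve 2 (λ x y → x :- y := :- (y :- x)) (ν i) (ν j))) (Ψ-odd _)

      sorted : ∀ c k →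
        (P c k * (w c * t k) + P k c * (w k * t c)) + (R₀ c k * (t c * t k) + R₀ k c * (t k * t c)) ≈
        (QA′ c k * (t c * t k) + (PA c k - QA c k) * (w c * t k) + PA k c * (w k * t c)) +
        ⟦ -[1+ 0 ] ⟧ *
        ((QB′ c k * (t c * t k) + (PB c k - QB c k) * (w c * t k) + PB k c * (w k * t c)) +
         ((PC c k + PC k c) * (t c * t k) + (QC c k + QC′ c k) * (w k * t c)))
      sorted c k = begin
        (P c k * (w c * t k) + P k c * (w k * t c)) + (R₀ c k * (t c * t k) + R₀ k c * (t k * t c))
          ≈⟨ +-congʳ (+-congˡ (*-congʳ (+-congʳ (*-congˡ (+-cong (Ψ-cong (+-comm _ _)) (swap c k)))))) ⟩
        (P c k * (w c * t k) + (s k * s c * ν k * (Ψ (ν k + ν c) + - Ψ (ν k - ν c)) - ⟦ + 2 ⟧ * (ν k * ψ c)) * (w k * t c)) +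
        (R₀ c k * (t c * t k) + R₀ k c * (t k * t c))
          ≈⟨ +-cong (+-cong
               (solve 9 (λ sc sk vc vk a b fk wc tk →
                  (sc :* sk :* vc :* (a :+ b) :- con (+ 2) :* (vc :* (sk :* fk))) :* (wc :* tk) :=
                  (sc :* sk :* a :* vc :- sk :* fk :* vc) :* (wc :* tk) :+
                  con -[1+ 0 ] :* ((vc :* (sk :* fk) :- vc :* (sk :* sc :* b)) :* (wc :* tk)))
                  (s c) (s k) (ν c) (ν k) (Ψ (ν k + ν c)) (Ψ (ν k - ν c)) (Ψ (ν k)) (w c) (t k))
               (solve 9 (λ sc sk vc vk a b fc wk tc →
                  (sk :* sc :* vk :* (a :+ :- b) :- con (+ 2) :* (vk :* (sc :* fc))) :* (wk :* tc) :=
                  sk :* sc :* a :* vk :* (wk :* tc) :+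
                  con -[1+ 0 ] :* (vk :* (sc :* fc) :* (wk :* tc) :+ (vk :* (sk :* sc :* b) :+ vk :* (sc :* fc)) :* (wk :* tc)))
                  (s c) (s k) (ν c) (ν k) (Ψ (ν k + ν c)) (Ψ (ν k - ν c)) (Ψ (ν c)) (w k) (t c)))
               (solve 6 (λ vc vk pc pk tc tk →
                  :- (con (+ 2) :* (vc :* pk)) :* (tc :* tk) :+ :- (con (+ 2) :* (vk :* pc)) :* (tk :* tc) :=
                  pk :* (vk :- vc) :* (tc :* tk) :+
                  con -[1+ 0 ] :* ((vk :- vc) :* pc :* (tc :* tk) :+ ((vc :+ vk) :* pk :+ (vk :+ vc) :* pc) :* (tc :* tk)))
                  (ν c) (ν k) (ψ c) (ψ k) (t c) (t k)) ⟩
        (((PA c k - QA c k) * (w c * t k) + ⟦ -[1+ 0 ] ⟧ * ((PB c k - QB c k) * (w c * t k))) +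
         (s k * s c * Ψ (ν k + ν c) * ν k * (w k * t c) +
          ⟦ -[1+ 0 ] ⟧ * (PB k c * (w k * t c) + (QC c k + QC′ c k) * (w k * t c)))) +
        (QA′ c k * (t c * t k) + ⟦ -[1+ 0 ] ⟧ * (QB′ c k * (t c * t k) + (PC c k + PC k c) * (t c * t k)))
          ≈⟨ +-congʳ (+-congˡ (+-congʳ (*-congʳ (*-congʳ (*-congˡ (Ψ-cong (+-comm _ _))))))) ⟩
        (((PA c k - QA c k) * (w c * t k) + ⟦ -[1+ 0 ] ⟧ * ((PB c k - QB c k) * (w c * t k))) +
         (PA k c * (w k * t c) +
          ⟦ -[1+ 0 ] ⟧ * (PB k c * (w k * t c) + (QC c k + QC′ c k) * (w k * t c)))) +
        (QA′ c k * (t c * t k) + ⟦ -[1+ 0 ] ⟧ * (QB′ c k * (t c * t k) + (PC c k + PC k c) * (t c * t k)))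
          ≈⟨ solve 8 (λ a b c d e f g h →
               ((a :+ con -[1+ 0 ] :* b) :+ (c :+ con -[1+ 0 ] :* (d :+ e))) :+ (f :+ con -[1+ 0 ] :* (g :+ h)) :=
               (f :+ a :+ c) :+ con -[1+ 0 ] :* ((g :+ b :+ d) :+ (h :+ e))) _ _ _ _ _ _ _ _ ⟩
        (QA′ c k * (t c * t k) + (PA c k - QA c k) * (w c * t k) + PA k c * (w k * t c)) +
        ⟦ -[1+ 0 ] ⟧ *
        ((QB′ c k * (t c * t k) + (PB c k - QB c k) * (w c * t k) + PB k c * (w k * t c)) +
         ((PC c k + PC k c) * (t c * t k) + (QC c k + QC′ c k) * (w k * t c))) ∎

      diagonal : ∀ k → (P k k * (w k * t k) + R₀ k k * (t k * t k)) +
        (⟦ -[1+ 0 ] ⟧ * (PA k k * (w k * t k)) + (PB k k * (w k * t k) + PC k k * (t k * t k))) ≈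
        - (ν k * ψ k * (w k * t k))
      diagonal k = begin
        (P k k * (w k * t k) + R₀ k k * (t k * t k)) +
        (⟦ -[1+ 0 ] ⟧ * (PA k k * (w k * t k)) + (PB k k * (w k * t k) + PC k k * (t k * t k)))
          ≈⟨ solve 7 (λ s v a b p w t →
               ((s :* s :* v :* (a :+ b) :- con (+ 2) :* (v :* p)) :* (w :* t) :+ :- (con (+ 2) :* (v :* p)) :* (t :* t)) :+
               (con -[1+ 0 ] :* (s :* s :* a :* v :* (w :* t)) :+ (v :* p :* (w :* t) :+ (v :+ v) :* p :* (t :* t))) :=
               s :* s :* v :* b :* (w :* t) :- v :* p :* (w :* t))
               (s k) (ν k) (Ψ (ν k + ν k)) (Ψ (ν k - ν k)) (ψ k) (w k) (t k) ⟩
        s k * s k * ν k * Ψ (ν k - ν k) * (w k * t k) - ν k * ψ k * (w k * t k)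
          ≈⟨ +-congʳ (*-congʳ (*-congˡ (trans (Ψ-cong (solve 1 (λ x → x :- x := con (+ 0)) (ν k))) Ψ-0))) ⟩
        s k * s k * ν k * ⟦ + 0 ⟧ * (w k * t k) - ν k * ψ k * (w k * t k)
          ≈⟨ solve 5 (λ s v p w t → s :* s :* v :* con (+ 0) :* (w :* t) :- v :* p :* (w :* t) := :- (v :* p :* (w :* t))) (s k) (ν k) (ψ k) (w k) (t k) ⟩
        - (ν k * ψ k * (w k * t k)) ∎

    module _ (ε δ : ℕ → Carrier) (m : Carrier)
      (ε-0 : ε 0 ≈ m * ψ 0) (ε-suc : ∀ k → ε k + m * (ψ k + ψ (suc k)) ≈ ε (suc k))
      (δ-0 : δ 0 ≈ ⟦ + 0 ⟧) (δ-suc : ∀ k → δ k + (ε k + m * ψ k) ≈ δ (suc k)) where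

      open Closed ψ ε δ m ε-0 ε-suc δ-0 δ-suc

      -- The inner sums left by `mixed` run over ν c, ψ c and (ν k - ν c) * ψ c. Their closed forms
      -- `∑ν`, `∑ψ`, `∑-tent`, with `halving` for the diagonal, leave sums over the single index k.
      mixed-closed :
        m * (⟦ + 2 ⟧ *
          (box n (λ i j → (s i * s j * ν i * (Ψ (ν j + ν i) + Ψ (ν j - ν i)) - ⟦ + 2 ⟧ * (ν i * ψ j)) * (w i * t j)) +
           box n (λ i j → - (⟦ + 2 ⟧ * (ν i * ψ j)) * (t i * t j)))) ≈
        ∑ n (λ k → (m * (ψ k * ν k * ν k) - δ k) * t k) - ∑ n (λ k → ν k * ε k * w k)
      mixed-closed = begin
        m * (⟦ + 2 ⟧ * _)
          ≈⟨ *-congˡ (*-congˡ mixed) ⟩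
        m * (⟦ + 2 ⟧ *
          ((tri n (λ c k → ψ k * ν c * t k) - tri n (λ c k → (ν k - ν c) * ψ c * t k)
            - tri n (λ c k → ν k * ψ c * w k)) - ∑ n (λ k → ν k * ψ k * (w k * t k))))
          ≈⟨ *-congˡ (*-congˡ (+-congʳ (+-cong (+-cong
               (∑-cong n (λ k → trans (∑-*ʳ k (t k) _) (*-congʳ (∑-*ˡ k (ψ k) ν))))
               (-‿cong (∑-cong n (λ k → ∑-*ʳ k (t k) _))))
               (-‿cong (∑-cong n (λ k → trans (∑-*ʳ k (w k) _) (*-congʳ (∑-*ˡ k (ν k) ψ)))))))) ⟩
        m * (⟦ + 2 ⟧ * (((a - b) - c) - d))
          ≈⟨ solve 5 (λ m a b c d → m :* (con (+ 2) :* (((a :- b) :- c) :- d)) :=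
               m :* (con (+ 2) :* a) :+ (con -[1+ 0 ] :* (m :* (con (+ 2) :* b)) :+
               (con -[1+ 0 ] :* (m :* (con (+ 2) :* c)) :+ con -[1+ 0 ] :* (m :* (con (+ 2) :* d))))) m a b c d ⟩
        m * (⟦ + 2 ⟧ * a) + (⟦ -[1+ 0 ] ⟧ * (m * (⟦ + 2 ⟧ * b)) +
          (⟦ -[1+ 0 ] ⟧ * (m * (⟦ + 2 ⟧ * c)) + ⟦ -[1+ 0 ] ⟧ * (m * (⟦ + 2 ⟧ * d))))
          ≈⟨ sym (trans (∑-+ n _ _) (+-cong (scale _) (trans (∑-+ n _ _) (+-cong (trans (∑-*ˡ n _ _) (*-congˡ (scale _)))
               (trans (∑-+ n _ _) (+-cong (trans (∑-*ˡ n _ _) (*-congˡ (scale _))) (trans (∑-*ˡ n _ _) (*-congˡ (scale _))))))))) ⟩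
        ∑ n (λ k → m * (⟦ + 2 ⟧ * (ψ k * ∑ k ν * t k)) +
          (⟦ -[1+ 0 ] ⟧ * (m * (⟦ + 2 ⟧ * (∑ k (λ c → (ν k - ν c) * ψ c) * t k))) +
          (⟦ -[1+ 0 ] ⟧ * (m * (⟦ + 2 ⟧ * (ν k * ∑ k ψ * w k))) +
           ⟦ -[1+ 0 ] ⟧ * (m * (⟦ + 2 ⟧ * (ν k * ψ k * (w k * t k)))))))
          ≈⟨ ∑-cong n pointwise ⟩
        ∑ n (λ k → (m * (ψ k * ν k * ν k) - δ k) * t k + - (ν k * ε k * w k))
          ≈⟨ trans (∑-+ n _ _) (+-congˡ (∑-neg n _)) ⟩
        ∑ n (λ k → (m * (ψ k * ν k * ν k) - δ k) * t k) - ∑ n (λ k → ν k * ε k * w k) ∎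
        where
        a = ∑ n (λ k → ψ k * ∑ k ν * t k)
        b = ∑ n (λ k → ∑ k (λ c → (ν k - ν c) * ψ c) * t k)
        c = ∑ n (λ k → ν k * ∑ k ψ * w k)
        d = ∑ n (λ k → ν k * ψ k * (w k * t k))
        scale : ∀ f → ∑ n (λ k → m * (⟦ + 2 ⟧ * f k)) ≈ m * (⟦ + 2 ⟧ * ∑ n f)
        scale f = trans (∑-*ˡ n m _) (*-congˡ (∑-*ˡ n _ f))
        pointwise : ∀ k → m * (⟦ + 2 ⟧ * (ψ k * ∑ k ν * t k)) +
          (⟦ -[1+ 0 ] ⟧ * (m * (⟦ + 2 ⟧ * (∑ k (λ c → (ν k - ν c) * ψ c) * t k))) +
          (⟦ -[1+ 0 ] ⟧ * (m * (⟦ + 2 ⟧ * (ν k * ∑ k ψ * w k))) +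
           ⟦ -[1+ 0 ] ⟧ * (m * (⟦ + 2 ⟧ * (ν k * ψ k * (w k * t k)))))) ≈
          (m * (ψ k * ν k * ν k) - δ k) * t k + - (ν k * ε k * w k)
        pointwise k = begin
          m * (⟦ + 2 ⟧ * (ψ k * ∑ k ν * t k)) +
          (⟦ -[1+ 0 ] ⟧ * (m * (⟦ + 2 ⟧ * (∑ k (λ c → (ν k - ν c) * ψ c) * t k))) +
          (⟦ -[1+ 0 ] ⟧ * (m * (⟦ + 2 ⟧ * (ν k * ∑ k ψ * w k))) +
           ⟦ -[1+ 0 ] ⟧ * (m * (⟦ + 2 ⟧ * (ν k * ψ k * (w k * t k))))))
            ≈⟨ solve 8 (λ m p x y z v w t →
                 m :* (con (+ 2) :* (p :* x :* t)) :+
                 (con -[1+ 0 ] :* (m :* (con (+ 2) :* (y :* t))) :+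
                 (con -[1+ 0 ] :* (m :* (con (+ 2) :* (v :* z :* w))) :+
                  con -[1+ 0 ] :* (m :* (con (+ 2) :* (v :* p :* (w :* t)))))) :=
                 m :* p :* t :* (con (+ 2) :* x) :- m :* (con (+ 2) :* y) :* t :-
                 v :* (m :* (con (+ 2) :* z :+ p)) :* w :+ m :* v :* p :* w :-
                 m :* v :* p :* (con (+ 2) :* (w :* t))) m (ψ k) (∑ k ν) _ (∑ k ψ) (ν k) (w k) (t k) ⟩
          m * ψ k * t k * (⟦ + 2 ⟧ * ∑ k ν) - m * (⟦ + 2 ⟧ * ∑ k (λ c → (ν k - ν c) * ψ c)) * t k -
          ν k * (m * (⟦ + 2 ⟧ * ∑ k ψ + ψ k)) * w k + m * ν k * ψ k * w k -
          m * ν k * ψ k * (⟦ + 2 ⟧ * (w k * t k))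
            ≈⟨ +-cong (+-congʳ (+-cong (+-cong (*-congˡ (∑ν k)) (-‿cong (*-congʳ (∑-tent k))))
                 (-‿cong (*-congʳ (*-congˡ (∑ψ k)))))) (-‿cong (*-congˡ (halving k))) ⟩
          m * ψ k * t k * (ν k * (ν k - ⟦ + 1 ⟧)) - δ k * t k - ν k * ε k * w k + m * ν k * ψ k * w k -
          m * ν k * ψ k * (w k - t k)
            ≈⟨ solve 7 (λ m p t v d e w →
                 m :* p :* t :* (v :* (v :- con (+ 1))) :- d :* t :- v :* e :* w :+ m :* v :* p :* w :-
                 m :* v :* p :* (w :- t) := (m :* (p :* v :* v) :- d) :* t :+ :- (v :* e :* w))
                 m (ψ k) (t k) (ν k) (δ k) (ε k) (w k) ⟩
          (m * (ψ k * ν k * ν k) - δ k) * t k + - (ν k * ε k * w k) ∎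

  -- The derivative of U₁

  module _ {n t w} (L : IsLambert n t w) where

    open IsLambert L
    open Sorted L

    private
      ψ ε δ : ℕ → Carrier
      ψ i = s i * ν i
      ε k = s k - ⟦ + 1 ⟧
      δ k = - (ν k * (⟦ + 1 ⟧ + s k))

      ε-0 : ε 0 ≈ ⟦ + 2 ⟧ * ψ 0
      ε-0 = solve 0 (:- con (+ 1) :- con (+ 1) := con (+ 2) :* (:- con (+ 1) :* con (+ 1)))

      ε-suc : ∀ k → ε k + ⟦ + 2 ⟧ * (ψ k + ψ (suc k)) ≈ ε (suc k)
      ε-suc k = trans (+-congˡ (*-congˡ (+-congˡ (*-congˡ (ν-suc k)))))
        (solve 2 (λ s v → (s :- con (+ 1)) :+ con (+ 2) :* (s :* v :+ :- s :* (v :+ con (+ 1))) := :- s :- con (+ 1)) (s k) (ν k))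

      δ-0 : δ 0 ≈ ⟦ + 0 ⟧
      δ-0 = solve 0 (:- (con (+ 1) :* (con (+ 1) :+ :- con (+ 1))) := con (+ 0))

      δ-suc : ∀ k → δ k + (ε k + ⟦ + 2 ⟧ * ψ k) ≈ δ (suc k)
      δ-suc k = trans
        (solve 2 (λ s v → :- (v :* (con (+ 1) :+ s)) :+ ((s :- con (+ 1)) :+ con (+ 2) :* (s :* v)) :=
           :- ((v :+ con (+ 1)) :* (con (+ 1) :+ :- s))) (s k) (ν k))
        (-‿cong (*-congʳ (sym (ν-suc k))))

    -- The factor 1 + s i selects the even a. Twice the w t relation for `PA` plus the t t relation
    -- for `PC` has the bilinear terms of the left side. This time the squares of t on the diagonal
    -- survive, as they should: q d/dq t(a) = a t(a) (1 - t(a)) contains them.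
    derivative-sorted :
      box n (λ i j → ⟦ + 4 ⟧ * ((⟦ + 1 ⟧ + s i) * ν i * (s j * ν j)) * (w i * t j)) +
      box n (λ i j → ⟦ + 2 ⟧ * ((s i + s j) * (ν i * ν j)) * (t i * t j)) ≈
      (⟦ + 2 ⟧ * tri n (λ c k → (s c + s k) * ν c * ν k * t k) +
       tri n (λ c k → (⟦ + 1 ⟧ + s k) * ((ν k - ν c) * ψ c) * w k)) +
      ∑ n (λ k → ⟦ + 2 ⟧ * (s k * ν k * ν k * (t k * t k)))
    derivative-sorted = begin
      box n (λ i j → P i j * (w i * t j)) + box n (λ i j → R₀ i j * (t i * t j))
        ≈⟨ +-cong (box-split n (λ i j → P i j * (w i * t j))) (box-split n (λ i j → R₀ i j * (t i * t j))) ⟩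
      (tri n (λ c k → P c k * (w c * t k) + P k c * (w k * t c)) + ∑ n (λ k → P k k * (w k * t k))) +
      (tri n (λ c k → R₀ c k * (t c * t k) + R₀ k c * (t k * t c)) + ∑ n (λ k → R₀ k k * (t k * t k)))
        ≈⟨ trans (+-interchange _ _ _ _) (+-congʳ (sym (tri-+ n _ _))) ⟩
      tri n (λ c k → (P c k * (w c * t k) + P k c * (w k * t c)) + (R₀ c k * (t c * t k) + R₀ k c * (t k * t c))) +
      (∑ n (λ k → P k k * (w k * t k)) + ∑ n (λ k → R₀ k k * (t k * t k)))
        ≈⟨ +-congʳ (trans (tri-cong n sorted) (trans (tri-+ n _ _) (+-congʳ (tri-*ˡ n _ _)))) ⟩
      (⟦ + 2 ⟧ * tri n (λ c k → QA′ c k * (t c * t k) + (PA c k - QA c k) * (w c * t k) + PA k c * (w k * t c)) +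
       tri n (λ c k → (PC c k + PC k c) * (t c * t k) + (QC c k + QC c k) * (w k * t c))) +
      (∑ n (λ k → P k k * (w k * t k)) + ∑ n (λ k → R₀ k k * (t k * t k)))
        ≈⟨ +-congʳ (+-cong (*-congˡ (trans (sorted-wt PA QA QA′ QA≈ QA′≈)
                (+-congʳ (reflect n t-vanish QA QA′ (λ i j → trans (QA≈ i j) (sym (QA′≈ i j)))))))
             (sorted-tt PC QC QC QC≈ QC′≈)) ⟩
      (⟦ + 2 ⟧ * (tri n (λ c k → QA′ c k * t k) - ∑ n (λ k → PA k k * (w k * t k))) +
       (tri n (λ c k → QC c k * w k) - ∑ n (λ k → PC k k * (t k * t k)))) +
      (∑ n (λ k → P k k * (w k * t k)) + ∑ n (λ k → R₀ k k * (t k * t k)))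
        ≈⟨ solve 6 (λ a a′ c c′ p r → (con (+ 2) :* (a :- a′) :+ (c :- c′)) :+ (p :+ r) :=
              (con (+ 2) :* a :+ c) :+ ((p :+ r) :+ (con -[1+ 1 ] :* a′ :+ con -[1+ 0 ] :* c′))) _ _ _ _ _ _ ⟩
      (⟦ + 2 ⟧ * tri n (λ c k → QA′ c k * t k) + tri n (λ c k → QC c k * w k)) +
      ((∑ n (λ k → P k k * (w k * t k)) + ∑ n (λ k → R₀ k k * (t k * t k))) +
       (⟦ -[1+ 1 ] ⟧ * ∑ n (λ k → PA k k * (w k * t k)) + ⟦ -[1+ 0 ] ⟧ * ∑ n (λ k → PC k k * (t k * t k))))
        ≈⟨ +-cong (+-congˡ (tri-cong n (λ c k → *-congʳ
               (solve 4 (λ a b x y → (a :+ b :* a) :* x :* (y :- x) := (con (+ 1) :+ b) :* ((y :- x) :* (a :* x))) (s c) (s k) (ν c) (ν k)))))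
             (trans (sym (trans (∑-+ n _ _) (+-cong (∑-+ n _ _) (trans (∑-+ n _ _) (+-cong (∑-*ˡ n _ _) (∑-*ˡ n _ _))))))
               (∑-cong n (λ k → solve 4 (λ s v w t →
                  (con (+ 4) :* ((con (+ 1) :+ s) :* v :* (s :* v)) :* (w :* t) :+
                   con (+ 2) :* ((s :+ s) :* (v :* v)) :* (t :* t)) :+
                  (con -[1+ 1 ] :* ((con (+ 1) :+ s) :* s :* v :* (v :+ v) :* (w :* t)) :+
                   con -[1+ 0 ] :* ((s :+ s) :* v :* v :* (t :* t))) :=
                  con (+ 2) :* (s :* v :* v :* (t :* t))) (s k) (ν k) (w k) (t k)))) ⟩
      (⟦ + 2 ⟧ * tri n (λ c k → QA′ c k * t k) +
       tri n (λ c k → (⟦ + 1 ⟧ + s k) * ((ν k - ν c) * ψ c) * w k)) +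
      ∑ n (λ k → ⟦ + 2 ⟧ * (s k * ν k * ν k * (t k * t k))) ∎
      where
      P R₀ PA PC QA QC QA′ : ℕ → ℕ → Carrier
      P i j = ⟦ + 4 ⟧ * ((⟦ + 1 ⟧ + s i) * ν i * (s j * ν j))
      R₀ i j = ⟦ + 2 ⟧ * ((s i + s j) * (ν i * ν j))
      PA i j = (⟦ + 1 ⟧ + s i) * s j * ν j * (ν i + ν j)
      PC i j = (s i + s j) * ν i * ν j
      QA c k = (⟦ + 1 ⟧ + s c) * s k * (ν k - ν c) * ν k
      QA′ c k = (s c + s k) * ν c * ν k
      QC c k = (s c + s k * s c) * ν c * (ν k - ν c)

      QA≈ : ∀ i j → QA i (suc (i ℕ.+ j)) ≈ PA i j
      QA≈ i j = *-cong (*-cong (trans (*-congˡ (s-+ i j))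
        (trans (solve 2 (λ a b → (con (+ 1) :+ a) :* (a :* b) := (a :+ a :* a) :* b) (s i) (s j))
          (*-congʳ (trans (+-congˡ (s² i)) (+-comm _ _))))) (ν-difference i j)) (ν-+ i j)
      QA′≈ : ∀ i j → QA′ j (suc (i ℕ.+ j)) ≈ PA i j
      QA′≈ i j = *-cong (*-congʳ (trans (+-congˡ (s-+ i j))
        (solve 2 (λ a b → b :+ a :* b := (con (+ 1) :+ a) :* b) (s i) (s j)))) (ν-+ i j)
      QC≈ : ∀ i j → QC i (suc (i ℕ.+ j)) ≈ PC i j
      QC≈ i j = *-cong (*-congʳ (+-congˡ (s-quotient i j))) (ν-difference i j)
      QC′≈ : ∀ i j → QC j (suc (i ℕ.+ j)) ≈ PC i j
      QC′≈ i j = trans (*-cong (*-congʳ (+-congˡ (s-quotient′ i j))) (ν-difference′ i j))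
        (solve 4 (λ a b x y → (b :+ a) :* y :* x := (a :+ b) :* x :* y) (s i) (s j) (ν i) (ν j))

      sorted : ∀ c k →
        (P c k * (w c * t k) + P k c * (w k * t c)) + (R₀ c k * (t c * t k) + R₀ k c * (t k * t c)) ≈
        ⟦ + 2 ⟧ * (QA′ c k * (t c * t k) + (PA c k - QA c k) * (w c * t k) + PA k c * (w k * t c)) +
        ((PC c k + PC k c) * (t c * t k) + (QC c k + QC c k) * (w k * t c))
      sorted c k = trans (+-cong (+-cong
          (solve 6 (λ a b x y p q → con (+ 4) :* ((con (+ 1) :+ a) :* x :* (b :* y)) :* (p :* q) :=
             con (+ 2) :* (((con (+ 1) :+ a) :* b :* y :* (x :+ y) :- (con (+ 1) :+ a) :* b :* (y :- x) :* y) :* (p :* q))) (s c) (s k) (ν c) (ν k) (w c) (t k))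
          (solve 6 (λ a b x y p q → con (+ 4) :* ((con (+ 1) :+ b) :* y :* (a :* x)) :* (p :* q) :=
             con (+ 2) :* ((con (+ 1) :+ b) :* a :* x :* (y :+ x) :* (p :* q)) :+
             ((a :+ b :* a) :* x :* (y :- x) :+ (a :+ b :* a) :* x :* (y :- x)) :* (p :* q)) (s c) (s k) (ν c) (ν k) (w k) (t c)))
          (solve 6 (λ a b x y p q →
             con (+ 2) :* ((a :+ b) :* (x :* y)) :* (p :* q) :+ con (+ 2) :* ((b :+ a) :* (y :* x)) :* (q :* p) :=
             con (+ 2) :* ((a :+ b) :* x :* y :* (p :* q)) :+ ((a :+ b) :* x :* y :+ (b :+ a) :* y :* x) :* (p :* q)) (s c) (s k) (ν c) (ν k) (t c) (t k)))
          (solve 5 (λ a b c d e → (con (+ 2) :* a :+ (con (+ 2) :* b :+ c)) :+ (con (+ 2) :* d :+ e) :=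
             con (+ 2) :* (d :+ a :+ b) :+ (e :+ c)) _ _ _ _ _)

    -- `X m` is - U_m and `Y m` is G_m. Further, L = 1 + 24 `T₁`.
    X Y : ℕ → Carrier
    X m = ∑ n (λ i → s i * ν i ^ m * t i)
    Y m = ∑ n (λ i → s i * ν i ^ m * w i)

    -- X 2 - Z₂ is q d/dq applied to X 1.
    T₁ W₁ Z₂ : Carrier
    T₁ = ∑ n (λ i → ν i * t i)
    W₁ = ∑ n (λ i → ν i * w i)
    Z₂ = ∑ n (λ i → s i * ν i ^ 2 * (t i * t i))

    -- Solved for X 2 - Z₂, this expresses a derivative by products of underived sums. The outer
    -- factor 4 supplies the two factors 2 with which `∑-tent` is stated for m = 2.
    relation-derivative :
      ⟦ + 4 ⟧ * ((⟦ + 4 ⟧ * ((W₁ + Y 1) * X 1)) + ⟦ + 4 ⟧ * (X 1 * T₁)) ≈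
      (⟦ + 4 ⟧ * X 3 + ⟦ -[1+ 7 ] ⟧ * X 2 + ⟦ + 2 ⟧ * X 1) + ⟦ -[1+ 1 ] ⟧ * T₁ + ⟦ -[1+ 1 ] ⟧ * (W₁ + Y 1) + ⟦ + 8 ⟧ * Z₂
    relation-derivative = begin
      ⟦ + 4 ⟧ * ((⟦ + 4 ⟧ * ((W₁ + Y 1) * X 1)) + ⟦ + 4 ⟧ * (X 1 * T₁))
        ≈⟨ *-congˡ (+-cong (sym boxes-wt) (sym boxes-tt)) ⟩
      ⟦ + 4 ⟧ * (box n (λ i j → ⟦ + 4 ⟧ * ((⟦ + 1 ⟧ + s i) * ν i * (s j * ν j)) * (w i * t j)) +
        box n (λ i j → ⟦ + 2 ⟧ * ((s i + s j) * (ν i * ν j)) * (t i * t j)))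
        ≈⟨ *-congˡ derivative-sorted ⟩
      ⟦ + 4 ⟧ * ((⟦ + 2 ⟧ * tri n (λ c k → (s c + s k) * ν c * ν k * t k) +
        tri n (λ c k → (⟦ + 1 ⟧ + s k) * ((ν k - ν c) * ψ c) * w k)) +
        ∑ n (λ k → ⟦ + 2 ⟧ * (s k * ν k * ν k * (t k * t k))))
        ≈⟨ *-congˡ (+-cong (+-cong (sym (∑-*ˡ n _ _)) refl) refl) ⟩
      ⟦ + 4 ⟧ * ((∑ n (λ k → ⟦ + 2 ⟧ * ∑ k (λ c → (s c + s k) * ν c * ν k * t k)) +
        tri n (λ c k → (⟦ + 1 ⟧ + s k) * ((ν k - ν c) * ψ c) * w k)) +
        ∑ n (λ k → ⟦ + 2 ⟧ * (s k * ν k * ν k * (t k * t k))))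
        ≈⟨ trans (*-congˡ (sym (trans (∑-+ n _ _) (+-congʳ (∑-+ n _ _))))) (sym (∑-*ˡ n _ _)) ⟩
      ∑ n (λ k → ⟦ + 4 ⟧ * ((⟦ + 2 ⟧ * ∑ k (λ c → (s c + s k) * ν c * ν k * t k) +
        ∑ k (λ c → (⟦ + 1 ⟧ + s k) * ((ν k - ν c) * ψ c) * w k)) +
        ⟦ + 2 ⟧ * (s k * ν k * ν k * (t k * t k))))
        ≈⟨ ∑-cong n pointwise ⟩
      ∑ n (λ k → (⟦ + 4 ⟧ * (s k * ν k ^ 3 * t k) + ⟦ -[1+ 7 ] ⟧ * (s k * ν k ^ 2 * t k) + ⟦ + 2 ⟧ * (s k * ν k ^ 1 * t k)) +
        ⟦ -[1+ 1 ] ⟧ * (ν k * t k) + ⟦ -[1+ 1 ] ⟧ * (ν k * w k + s k * ν k ^ 1 * w k) + ⟦ + 8 ⟧ * (s k * ν k ^ 2 * (t k * t k)))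
        ≈⟨ trans (∑-+ n _ _) (+-cong (trans (∑-+ n _ _) (+-cong (trans (∑-+ n _ _)
             (+-cong (∑-lin₃ n _ _ _ _ _ _) (∑-*ˡ n _ _))) (trans (∑-*ˡ n _ _) (*-congˡ (∑-+ n _ _))))) (∑-*ˡ n _ _)) ⟩
      (⟦ + 4 ⟧ * X 3 + ⟦ -[1+ 7 ] ⟧ * X 2 + ⟦ + 2 ⟧ * X 1) + ⟦ -[1+ 1 ] ⟧ * T₁ + ⟦ -[1+ 1 ] ⟧ * (W₁ + Y 1) + ⟦ + 8 ⟧ * Z₂ ∎
      where
      open Closed ψ ε δ ⟦ + 2 ⟧ ε-0 ε-suc δ-0 δ-suc

      boxes-wt : box n (λ i j → ⟦ + 4 ⟧ * ((⟦ + 1 ⟧ + s i) * ν i * (s j * ν j)) * (w i * t j)) ≈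
        ⟦ + 4 ⟧ * ((W₁ + Y 1) * X 1)
      boxes-wt = begin
        box n (λ i j → ⟦ + 4 ⟧ * ((⟦ + 1 ⟧ + s i) * ν i * (s j * ν j)) * (w i * t j))
          ≈⟨ box-cong n (λ i j → solve 6 (λ a x b y p q →
               con (+ 4) :* ((con (+ 1) :+ a) :* x :* (b :* y)) :* (p :* q) :=
               (con (+ 4) :* (x :* p :+ a :* x :^ 1 :* p)) :* (b :* y :^ 1 :* q)) (s i) (ν i) (s j) (ν j) (w i) (t j)) ⟩
        box n (λ i j → (⟦ + 4 ⟧ * (ν i * w i + s i * ν i ^ 1 * w i)) * (s j * ν j ^ 1 * t j))
          ≈⟨ trans (box-product n _ _) (*-congʳ (trans (∑-*ˡ n _ _) (*-congˡ (∑-+ n _ _)))) ⟩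
        ⟦ + 4 ⟧ * (W₁ + Y 1) * X 1  ≈⟨ *-assoc _ _ _ ⟩
        ⟦ + 4 ⟧ * ((W₁ + Y 1) * X 1) ∎

      boxes-tt : box n (λ i j → ⟦ + 2 ⟧ * ((s i + s j) * (ν i * ν j)) * (t i * t j)) ≈ ⟦ + 4 ⟧ * (X 1 * T₁)
      boxes-tt = begin
        box n (λ i j → ⟦ + 2 ⟧ * ((s i + s j) * (ν i * ν j)) * (t i * t j))
          ≈⟨ box-cong n (λ i j → solve 6 (λ a x b y p q →
               con (+ 2) :* ((a :+ b) :* (x :* y)) :* (p :* q) :=
               (con (+ 2) :* (a :* x :^ 1 :* p)) :* (y :* q) :+ (con (+ 2) :* (x :* p)) :* (b :* y :^ 1 :* q)) (s i) (ν i) (s j) (ν j) (t i) (t j)) ⟩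
        box n (λ i j → (⟦ + 2 ⟧ * (s i * ν i ^ 1 * t i)) * (ν j * t j) + (⟦ + 2 ⟧ * (ν i * t i)) * (s j * ν j ^ 1 * t j))
          ≈⟨ trans (box-+ n _ _) (+-cong
               (trans (box-product n (λ i → ⟦ + 2 ⟧ * (s i * ν i ^ 1 * t i)) _) (*-congʳ (∑-*ˡ n _ _)))
               (trans (box-product n (λ i → ⟦ + 2 ⟧ * (ν i * t i)) _) (*-congʳ (∑-*ˡ n _ _)))) ⟩
        ⟦ + 2 ⟧ * X 1 * T₁ + ⟦ + 2 ⟧ * T₁ * X 1
          ≈⟨ solve 2 (λ x y → con (+ 2) :* x :* y :+ con (+ 2) :* y :* x := con (+ 4) :* (x :* y)) (X 1) T₁ ⟩
        ⟦ + 4 ⟧ * (X 1 * T₁) ∎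

      pointwise : ∀ k →
        ⟦ + 4 ⟧ * ((⟦ + 2 ⟧ * ∑ k (λ c → (s c + s k) * ν c * ν k * t k) +
          ∑ k (λ c → (⟦ + 1 ⟧ + s k) * ((ν k - ν c) * ψ c) * w k)) + ⟦ + 2 ⟧ * (s k * ν k * ν k * (t k * t k))) ≈
        (⟦ + 4 ⟧ * (s k * ν k ^ 3 * t k) + ⟦ -[1+ 7 ] ⟧ * (s k * ν k ^ 2 * t k) + ⟦ + 2 ⟧ * (s k * ν k ^ 1 * t k)) +
        ⟦ -[1+ 1 ] ⟧ * (ν k * t k) + ⟦ -[1+ 1 ] ⟧ * (ν k * w k + s k * ν k ^ 1 * w k) + ⟦ + 8 ⟧ * (s k * ν k ^ 2 * (t k * t k))
      pointwise k = begin
        ⟦ + 4 ⟧ * ((⟦ + 2 ⟧ * ∑ k (λ c → (s c + s k) * ν c * ν k * t k) +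
          ∑ k (λ c → (⟦ + 1 ⟧ + s k) * ((ν k - ν c) * ψ c) * w k)) + ⟦ + 2 ⟧ * (s k * ν k * ν k * (t k * t k)))
          ≈⟨ *-congˡ (+-congʳ (+-cong (*-congˡ (trans
               (∑-cong k (λ c → solve 5 (λ a b x y t → (a :+ b) :* x :* y :* t := (y :* t) :* (a :* x) :+ (b :* y :* t) :* x) (s c) (s k) (ν c) (ν k) (t k))) (∑-lin₂ k _ _ _ _)))
               (trans (∑-*ʳ k (w k) _) (*-congʳ (∑-*ˡ k _ _))))) ⟩
        ⟦ + 4 ⟧ * ((⟦ + 2 ⟧ * (ν k * t k * ∑ k ψ + s k * ν k * t k * ∑ k ν) +
          (⟦ + 1 ⟧ + s k) * ∑ k (λ c → (ν k - ν c) * ψ c) * w k) + ⟦ + 2 ⟧ * (s k * ν k * ν k * (t k * t k)))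
          ≈⟨ solve 7 (λ v t s a b c w →
               con (+ 4) :* ((con (+ 2) :* (v :* t :* a :+ s :* v :* t :* b) :+
                 (con (+ 1) :+ s) :* c :* w) :+ con (+ 2) :* (s :* v :* v :* (t :* t))) :=
               con (+ 2) :* v :* t :* (con (+ 2) :* (con (+ 2) :* a :+ s :* v)) :- con (+ 4) :* v :* t :* (s :* v) :+
               con (+ 4) :* s :* v :* t :* (con (+ 2) :* b) :+
               (con (+ 1) :+ s) :* (con (+ 2) :* (con (+ 2) :* c)) :* w :+ con (+ 8) :* (s :* v :* v :* (t :* t))) (ν k) (t k) (s k) (∑ k ψ) (∑ k ν) _ (w k) ⟩
        ⟦ + 2 ⟧ * ν k * t k * (⟦ + 2 ⟧ * (⟦ + 2 ⟧ * ∑ k ψ + ψ k)) - ⟦ + 4 ⟧ * ν k * t k * ψ k +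
        ⟦ + 4 ⟧ * s k * ν k * t k * (⟦ + 2 ⟧ * ∑ k ν) +
        (⟦ + 1 ⟧ + s k) * (⟦ + 2 ⟧ * (⟦ + 2 ⟧ * ∑ k (λ c → (ν k - ν c) * ψ c))) * w k +
        ⟦ + 8 ⟧ * (s k * ν k * ν k * (t k * t k))
          ≈⟨ +-congʳ (+-cong (+-cong (+-congʳ (*-congˡ (∑ψ k))) (*-congˡ (∑ν k))) (*-congʳ (*-congˡ (∑-tent k)))) ⟩
        ⟦ + 2 ⟧ * ν k * t k * ε k - ⟦ + 4 ⟧ * ν k * t k * ψ k +
        ⟦ + 4 ⟧ * s k * ν k * t k * (ν k * (ν k - ⟦ + 1 ⟧)) +
        (⟦ + 1 ⟧ + s k) * δ k * w k +
        ⟦ + 8 ⟧ * (s k * ν k * ν k * (t k * t k))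
          ≈⟨ solve 4 (λ v t s w →
               con (+ 2) :* v :* t :* (s :- con (+ 1)) :- con (+ 4) :* v :* t :* (s :* v) :+
               con (+ 4) :* s :* v :* t :* (v :* (v :- con (+ 1))) :+
               (con (+ 1) :+ s) :* :- (v :* (con (+ 1) :+ s)) :* w :+ con (+ 8) :* (s :* v :* v :* (t :* t)) :=
               (con (+ 4) :* (s :* v :^ 3 :* t) :+ con -[1+ 7 ] :* (s :* v :^ 2 :* t) :+ con (+ 2) :* (s :* v :^ 1 :* t)) :+
               con -[1+ 1 ] :* (v :* t) :+ (con -[1+ 0 ] :* v :* w :* (s :* s) :- v :* w :+ con -[1+ 1 ] :* (s :* v :^ 1 :* w)) :+
               con (+ 8) :* (s :* v :^ 2 :* (t :* t))) (ν k) (t k) (s k) (w k) ⟩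
        (⟦ + 4 ⟧ * (s k * ν k ^ 3 * t k) + ⟦ -[1+ 7 ] ⟧ * (s k * ν k ^ 2 * t k) + ⟦ + 2 ⟧ * (s k * ν k ^ 1 * t k)) +
        ⟦ -[1+ 1 ] ⟧ * (ν k * t k) +
        (⟦ -[1+ 0 ] ⟧ * ν k * w k * (s k * s k) - ν k * w k + ⟦ -[1+ 1 ] ⟧ * (s k * ν k ^ 1 * w k)) +
        ⟦ + 8 ⟧ * (s k * ν k ^ 2 * (t k * t k))
          -- One factor 1 + s k comes from the weight and one from `δ`; since s k squares to 1, (1 +
          -- s k)² = 2 (1 + s k).
          ≈⟨ +-congʳ (+-congˡ (trans (+-congʳ (+-congʳ (*-congˡ (s² k))))
               (solve 3 (λ v w s → con -[1+ 0 ] :* v :* w :* con (+ 1) :- v :* w :+ con -[1+ 1 ] :* (s :* v :^ 1 :* w) :=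
                  con -[1+ 1 ] :* (v :* w :+ s :* v :^ 1 :* w)) (ν k) (w k) (s k)))) ⟩
        (⟦ + 4 ⟧ * (s k * ν k ^ 3 * t k) + ⟦ -[1+ 7 ] ⟧ * (s k * ν k ^ 2 * t k) + ⟦ + 2 ⟧ * (s k * ν k ^ 1 * t k)) +
        ⟦ -[1+ 1 ] ⟧ * (ν k * t k) + ⟦ -[1+ 1 ] ⟧ * (ν k * w k + s k * ν k ^ 1 * w k) + ⟦ + 8 ⟧ * (s k * ν k ^ 2 * (t k * t k)) ∎

  -- Relations between the Lambert sums

  module _ {n t w} (L : IsLambert n t w) where

    private
      X′ Y′ : ℕ → Carrier
      X′ = X L
      Y′ = Y L
      x : ℕ → ℕ → Carrier
      x m i = s i * ν i ^ m * t i

    -- `square` with F x = x² and φ x = x, by (x - y)² - (x + y)² = - 4 x y and (x + 1) + x = (x +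
    -- 1)² - x². In terms of A = 1 + 8 X 1 it says A² = 1 + 16 G₃.
    relation-2 : ⟦ -[1+ 3 ] ⟧ * (X′ 1 * X′ 1) ≈ X′ 1 - Y′ 3
    relation-2 = begin
      ⟦ -[1+ 3 ] ⟧ * (X′ 1 * X′ 1)
        ≈⟨ sym (trans (box-product n (λ i → ⟦ -[1+ 3 ] ⟧ * x 1 i) (x 1)) (trans (*-congʳ (∑-*ˡ n _ _)) (*-assoc _ _ _))) ⟩
      box n (λ i j → (⟦ -[1+ 3 ] ⟧ * x 1 i) * x 1 j)
        ≈⟨ box-cong n (λ i j → solve 6 (λ a b x y p q →
             (con -[1+ 3 ] :* (a :* x :^ 1 :* p)) :* (b :* y :^ 1 :* q) :=
             a :* b :* ((x :- y) :^ 2 :- (x :+ y) :^ 2) :* (p :* q)) (s i) (s j) (ν i) (ν j) (t i) (t j)) ⟩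
      box n (λ i j → s i * s j * ((ν i - ν j) ^ 2 - (ν i + ν j) ^ 2) * (t i * t j))
        ≈⟨ square L (_^ 2) (_^ 1) (^-congˡ 2)
             (λ x → solve 1 (λ x → (:- x) :^ 2 := x :^ 2) x)
             (solve 0 (con (+ 0) :^ 2 := con (+ 0)))
             (alternating (_^ 2) (_^ 1) (^-congˡ 2) (^-congˡ 1)
               (solve 0 (con (+ 1) :^ 2 := con (+ 1) :^ 1))
               (λ x → solve 1 (λ x → (x :+ con (+ 1)) :^ 1 :+ x :^ 1 := (x :+ con (+ 1)) :^ 2 :- x :^ 2) x)) ⟩
      X′ 1 - ∑ n (λ k → s k * (ν k * ν k ^ 2) * w k) ∎

    -- The polynomial φ = 2 x³ - x solves φ(x + 1) + φ(x) = (x + 1)⁴ - x⁴. The relation is A (16 U₃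
    -- + 1) = 1 - 8 G₅ multiplied out.
    relation-4 : ⟦ -[1+ 15 ] ⟧ * (X′ 1 * X′ 3) ≈ (⟦ + 2 ⟧ * X′ 3 + ⟦ -[1+ 0 ] ⟧ * X′ 1) - Y′ 5
    relation-4 = begin
      ⟦ -[1+ 15 ] ⟧ * (X′ 1 * X′ 3)
        ≈⟨ solve 2 (λ x y → con -[1+ 15 ] :* (x :* y) := con -[1+ 7 ] :* x :* y :+ con -[1+ 7 ] :* y :* x) _ _ ⟩
      ⟦ -[1+ 7 ] ⟧ * X′ 1 * X′ 3 + ⟦ -[1+ 7 ] ⟧ * X′ 3 * X′ 1
        ≈⟨ sym (trans (box-+ n _ _) (+-cong
             (trans (box-product n (λ i → ⟦ -[1+ 7 ] ⟧ * x 1 i) (x 3)) (*-congʳ (∑-*ˡ n _ _)))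
             (trans (box-product n (λ i → ⟦ -[1+ 7 ] ⟧ * x 3 i) (x 1)) (*-congʳ (∑-*ˡ n _ _))))) ⟩
      box n (λ i j → (⟦ -[1+ 7 ] ⟧ * x 1 i) * x 3 j + (⟦ -[1+ 7 ] ⟧ * x 3 i) * x 1 j)
        ≈⟨ box-cong n (λ i j → solve 6 (λ a b x y p q →
             (con -[1+ 7 ] :* (a :* x :^ 1 :* p)) :* (b :* y :^ 3 :* q) :+
             (con -[1+ 7 ] :* (a :* x :^ 3 :* p)) :* (b :* y :^ 1 :* q) :=
             a :* b :* ((x :- y) :^ 4 :- (x :+ y) :^ 4) :* (p :* q)) (s i) (s j) (ν i) (ν j) (t i) (t j)) ⟩
      box n (λ i j → s i * s j * ((ν i - ν j) ^ 4 - (ν i + ν j) ^ 4) * (t i * t j))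
        ≈⟨ square L (_^ 4) φ (^-congˡ 4)
             (λ x → solve 1 (λ x → (:- x) :^ 4 := x :^ 4) x)
             (solve 0 (con (+ 0) :^ 4 := con (+ 0)))
             (alternating (_^ 4) φ (^-congˡ 4)
               (λ e → +-cong (*-congˡ (^-congˡ 3 e)) (*-congˡ (^-congˡ 1 e)))
               (solve 0 (con (+ 1) :^ 4 := con (+ 2) :* con (+ 1) :^ 3 :+ con -[1+ 0 ] :* con (+ 1) :^ 1))
               (λ x → solve 1 (λ x →
                 (con (+ 2) :* (x :+ con (+ 1)) :^ 3 :+ con -[1+ 0 ] :* (x :+ con (+ 1)) :^ 1) :+
                 (con (+ 2) :* x :^ 3 :+ con -[1+ 0 ] :* x :^ 1) := (x :+ con (+ 1)) :^ 4 :- x :^ 4) x)) ⟩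
      ∑ n (λ k → s k * φ (ν k) * t k) - ∑ n (λ k → s k * (ν k * ν k ^ 4) * w k)
        ≈⟨ +-congʳ (trans (∑-cong n (λ k → solve 3 (λ s v t →
             s :* (con (+ 2) :* v :^ 3 :+ con -[1+ 0 ] :* v :^ 1) :* t :=
             con (+ 2) :* (s :* v :^ 3 :* t) :+ con -[1+ 0 ] :* (s :* v :^ 1 :* t)) (s k) (ν k) (t k)))
             (∑-lin₂ n _ _ _ _)) ⟩
      (⟦ + 2 ⟧ * X′ 3 + ⟦ -[1+ 0 ] ⟧ * X′ 1) - Y′ 5 ∎
      where
      φ : Carrier → Carrier
      φ x = ⟦ + 2 ⟧ * x ^ 3 + ⟦ -[1+ 0 ] ⟧ * x ^ 1

    -- Now φ = 3 x⁵ - 5 x³ + 3 x belongs to F x = x⁶; the coefficients 24 and 40 are twice 2 · 6 and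
    -- 2 · 20, with the middle product occurring once instead of twice.
    relation-6 : ⟦ -[1+ 23 ] ⟧ * (X′ 1 * X′ 5) + ⟦ -[1+ 39 ] ⟧ * (X′ 3 * X′ 3) ≈
      (⟦ + 3 ⟧ * X′ 5 + ⟦ -[1+ 4 ] ⟧ * X′ 3 + ⟦ + 3 ⟧ * X′ 1) - Y′ 7
    relation-6 = begin
      ⟦ -[1+ 23 ] ⟧ * (X′ 1 * X′ 5) + ⟦ -[1+ 39 ] ⟧ * (X′ 3 * X′ 3)
        ≈⟨ solve 3 (λ x y z → con -[1+ 23 ] :* (x :* z) :+ con -[1+ 39 ] :* (y :* y) :=
             con -[1+ 11 ] :* x :* z :+ (con -[1+ 39 ] :* y :* y :+ con -[1+ 11 ] :* z :* x)) _ _ _ ⟩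
      ⟦ -[1+ 11 ] ⟧ * X′ 1 * X′ 5 + (⟦ -[1+ 39 ] ⟧ * X′ 3 * X′ 3 + ⟦ -[1+ 11 ] ⟧ * X′ 5 * X′ 1)
        ≈⟨ sym (trans (box-+ n _ _) (+-cong
             (trans (box-product n (λ i → ⟦ -[1+ 11 ] ⟧ * x 1 i) (x 5)) (*-congʳ (∑-*ˡ n _ _)))
             (trans (box-+ n _ _) (+-cong
               (trans (box-product n (λ i → ⟦ -[1+ 39 ] ⟧ * x 3 i) (x 3)) (*-congʳ (∑-*ˡ n _ _)))
               (trans (box-product n (λ i → ⟦ -[1+ 11 ] ⟧ * x 5 i) (x 1)) (*-congʳ (∑-*ˡ n _ _))))))) ⟩
      box n (λ i j → (⟦ -[1+ 11 ] ⟧ * x 1 i) * x 5 j +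
        ((⟦ -[1+ 39 ] ⟧ * x 3 i) * x 3 j + (⟦ -[1+ 11 ] ⟧ * x 5 i) * x 1 j))
        ≈⟨ box-cong n (λ i j → solve 6 (λ a b x y p q →
             (con -[1+ 11 ] :* (a :* x :^ 1 :* p)) :* (b :* y :^ 5 :* q) :+
             ((con -[1+ 39 ] :* (a :* x :^ 3 :* p)) :* (b :* y :^ 3 :* q) :+
             (con -[1+ 11 ] :* (a :* x :^ 5 :* p)) :* (b :* y :^ 1 :* q)) :=
             a :* b :* ((x :- y) :^ 6 :- (x :+ y) :^ 6) :* (p :* q)) (s i) (s j) (ν i) (ν j) (t i) (t j)) ⟩
      box n (λ i j → s i * s j * ((ν i - ν j) ^ 6 - (ν i + ν j) ^ 6) * (t i * t j))
        ≈⟨ square L (_^ 6) φ (^-congˡ 6)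
             (λ x → solve 1 (λ x → (:- x) :^ 6 := x :^ 6) x)
             (solve 0 (con (+ 0) :^ 6 := con (+ 0)))
             (alternating (_^ 6) φ (^-congˡ 6)
               (λ e → +-cong (+-cong (*-congˡ (^-congˡ 5 e)) (*-congˡ (^-congˡ 3 e))) (*-congˡ (^-congˡ 1 e)))
               (solve 0 (con (+ 1) :^ 6 := con (+ 3) :* con (+ 1) :^ 5 :+ con -[1+ 4 ] :* con (+ 1) :^ 3 :+ con (+ 3) :* con (+ 1) :^ 1))
               (λ x → solve 1 (λ x →
                 (con (+ 3) :* (x :+ con (+ 1)) :^ 5 :+ con -[1+ 4 ] :* (x :+ con (+ 1)) :^ 3 :+ con (+ 3) :* (x :+ con (+ 1)) :^ 1) :+
                 (con (+ 3) :* x :^ 5 :+ con -[1+ 4 ] :* x :^ 3 :+ con (+ 3) :* x :^ 1) := (x :+ con (+ 1)) :^ 6 :- x :^ 6) x)) ⟩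
      ∑ n (λ k → s k * φ (ν k) * t k) - ∑ n (λ k → s k * (ν k * ν k ^ 6) * w k)
        ≈⟨ +-congʳ (trans (∑-cong n (λ k → solve 3 (λ s v t →
             s :* (con (+ 3) :* v :^ 5 :+ con -[1+ 4 ] :* v :^ 3 :+ con (+ 3) :* v :^ 1) :* t :=
             con (+ 3) :* (s :* v :^ 5 :* t) :+ con -[1+ 4 ] :* (s :* v :^ 3 :* t) :+ con (+ 3) :* (s :* v :^ 1 :* t)) (s k) (ν k) (t k)))
             (∑-lin₃ n _ _ _ _ _ _)) ⟩
      (⟦ + 3 ⟧ * X′ 5 + ⟦ -[1+ 4 ] ⟧ * X′ 3 + ⟦ + 3 ⟧ * X′ 1) - Y′ 7 ∎
      where
      φ : Carrier → Carrier
      φ x = ⟦ + 3 ⟧ * x ^ 5 + ⟦ -[1+ 4 ] ⟧ * x ^ 3 + ⟦ + 3 ⟧ * x ^ 1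

    private
      y : ℕ → ℕ → Carrier
      y m i = s i * ν i ^ m * w i

    -- `mixed-closed` for Ψ x = x, with `ε` and `δ` summing (-1)ᵃ a once and twice. `relation-A` is
    -- what `parity` makes of it.
    relation-mixed-1 :
      ⟦ + 2 ⟧ * (⟦ + 2 ⟧ * ((⟦ + 2 ⟧ * (Y′ 1 * X′ 1) + ⟦ -[1+ 1 ] ⟧ * (W₁ L * X′ 1)) + ⟦ -[1+ 1 ] ⟧ * (T₁ L * X′ 1))) ≈
      (⟦ + 2 ⟧ * X′ 3 + ⟦ + 1 ⟧ * X′ 1 + ⟦ + 1 ⟧ * T₁ L) - (⟦ + 1 ⟧ * Y′ 1 + ⟦ -[1+ 0 ] ⟧ * W₁ L)
    relation-mixed-1 = begin
      ⟦ + 2 ⟧ * (⟦ + 2 ⟧ * ((⟦ + 2 ⟧ * (Y′ 1 * X′ 1) + ⟦ -[1+ 1 ] ⟧ * (W₁ L * X′ 1)) + ⟦ -[1+ 1 ] ⟧ * (T₁ L * X′ 1)))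
        ≈⟨ *-congˡ (*-congˡ (sym (+-cong
             (trans (box-+ n _ _) (+-cong
               (trans (box-product n (λ i → ⟦ + 2 ⟧ * y 1 i) (x 1)) (trans (*-congʳ (∑-*ˡ n _ _)) (*-assoc _ _ _)))
               (trans (box-product n (λ i → ⟦ -[1+ 1 ] ⟧ * (ν i * w i)) (x 1)) (trans (*-congʳ (∑-*ˡ n _ _)) (*-assoc _ _ _)))))
             (trans (box-product n (λ i → ⟦ -[1+ 1 ] ⟧ * (ν i * t i)) (x 1)) (trans (*-congʳ (∑-*ˡ n _ _)) (*-assoc _ _ _)))))) ⟩
      ⟦ + 2 ⟧ * (⟦ + 2 ⟧ *
        (box n (λ i j → (⟦ + 2 ⟧ * y 1 i) * x 1 j + (⟦ -[1+ 1 ] ⟧ * (ν i * w i)) * x 1 j) +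
         box n (λ i j → (⟦ -[1+ 1 ] ⟧ * (ν i * t i)) * x 1 j)))
        ≈⟨ *-congˡ (*-congˡ (+-cong
             (box-cong n (λ i j → solve 6 (λ a b x y p q →
               (con (+ 2) :* (a :* x :^ 1 :* p)) :* (b :* y :^ 1 :* q) :+ (con -[1+ 1 ] :* (x :* p)) :* (b :* y :^ 1 :* q) :=
               (a :* b :* x :* ((y :+ x) :^ 1 :+ (y :- x) :^ 1) :- con (+ 2) :* (x :* (b :* y :^ 1))) :* (p :* q)) (s i) (s j) (ν i) (ν j) (w i) (t j)))
             (box-cong n (λ i j → solve 5 (λ b x y p q →
               (con -[1+ 1 ] :* (x :* p)) :* (b :* y :^ 1 :* q) := :- (con (+ 2) :* (x :* (b :* y :^ 1))) :* (p :* q)) (s j) (ν i) (ν j) (t i) (t j))))) ⟩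
      ⟦ + 2 ⟧ * (⟦ + 2 ⟧ *
        (box n (λ i j → (s i * s j * ν i * ((ν j + ν i) ^ 1 + (ν j - ν i) ^ 1) - ⟦ + 2 ⟧ * (ν i * (s j * ν j ^ 1))) * (w i * t j)) +
         box n (λ i j → - (⟦ + 2 ⟧ * (ν i * (s j * ν j ^ 1))) * (t i * t j))))
        ≈⟨ mixed-closed L (_^ 1) (^-congˡ 1) (λ x → solve 1 (λ x → (:- x) :^ 1 := :- (x :^ 1)) x)
             (solve 0 (con (+ 0) :^ 1 := con (+ 0))) ε δ ⟦ + 2 ⟧
             (solve 0 (:- con (+ 1) :- con (+ 1) := con (+ 2) :* (:- con (+ 1) :* con (+ 1) :^ 1)))
             (λ k → trans (+-congˡ (*-congˡ (+-congˡ (*-congˡ (^-congˡ 1 (ν-suc k))))))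
               (solve 2 (λ s v → (s :- con (+ 1)) :+ con (+ 2) :* (s :* v :^ 1 :+ :- s :* (v :+ con (+ 1)) :^ 1) :=
                  :- s :- con (+ 1)) (s k) (ν k)))
             (solve 0 (:- (con (+ 1) :* (con (+ 1) :+ :- con (+ 1))) := con (+ 0)))
             (λ k → trans (solve 2 (λ s v → :- (v :* (con (+ 1) :+ s)) :+ ((s :- con (+ 1)) :+ con (+ 2) :* (s :* v :^ 1)) :=
                :- ((v :+ con (+ 1)) :* (con (+ 1) :+ :- s))) (s k) (ν k)) (-‿cong (*-congʳ (sym (ν-suc k))))) ⟩
      ∑ n (λ k → (⟦ + 2 ⟧ * (s k * ν k ^ 1 * ν k * ν k) - δ k) * t k) - ∑ n (λ k → ν k * ε k * w k)
        ≈⟨ +-cong (trans (∑-cong n (λ k → solve 3 (λ s v t →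
               (con (+ 2) :* (s :* v :^ 1 :* v :* v) :- :- (v :* (con (+ 1) :+ s))) :* t :=
               con (+ 2) :* (s :* v :^ 3 :* t) :+ con (+ 1) :* (s :* v :^ 1 :* t) :+ con (+ 1) :* (v :* t)) (s k) (ν k) (t k))) (∑-lin₃ n _ _ _ _ _ _))
             (-‿cong (trans (∑-cong n (λ k → solve 3 (λ s v w → v :* (s :- con (+ 1)) :* w :=
               con (+ 1) :* (s :* v :^ 1 :* w) :+ con -[1+ 0 ] :* (v :* w)) (s k) (ν k) (w k))) (∑-lin₂ n _ _ _ _))) ⟩
      (⟦ + 2 ⟧ * X′ 3 + ⟦ + 1 ⟧ * X′ 1 + ⟦ + 1 ⟧ * T₁ L) - (⟦ + 1 ⟧ * Y′ 1 + ⟦ -[1+ 0 ] ⟧ * W₁ L) ∎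
      where
      ε δ : ℕ → Carrier
      ε k = s k - ⟦ + 1 ⟧
      δ k = - (ν k * (⟦ + 1 ⟧ + s k))

    -- `mixed-closed` for Ψ x = x³: here `ε` and `δ` sum (-1)ᵃ a³, which explains the factor 4.
    -- `relation-D` follows on eliminating W₁ by `parity` and Y 3 by `relation-2`.
    relation-mixed-3 :
      ⟦ + 4 ⟧ * (⟦ + 2 ⟧ * (((⟦ + 2 ⟧ * (Y′ 1 * X′ 3) + ⟦ + 6 ⟧ * (Y′ 3 * X′ 1)) + ⟦ -[1+ 1 ] ⟧ * (W₁ L * X′ 3)) +
        ⟦ -[1+ 1 ] ⟧ * (T₁ L * X′ 3))) ≈
      ((⟦ + 4 ⟧ * X′ 5 + ⟦ + 2 ⟧ * X′ 3 + ⟦ -[1+ 2 ] ⟧ * X′ 1) + ⟦ -[1+ 0 ] ⟧ * T₁ L) -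
      (⟦ + 1 ⟧ * W₁ L + ⟦ + 6 ⟧ * Y′ 3 + ⟦ -[1+ 0 ] ⟧ * Y′ 1)
    relation-mixed-3 = begin
      ⟦ + 4 ⟧ * (⟦ + 2 ⟧ * (((⟦ + 2 ⟧ * (Y′ 1 * X′ 3) + ⟦ + 6 ⟧ * (Y′ 3 * X′ 1)) + ⟦ -[1+ 1 ] ⟧ * (W₁ L * X′ 3)) +
        ⟦ -[1+ 1 ] ⟧ * (T₁ L * X′ 3)))
        ≈⟨ *-congˡ (*-congˡ (sym (+-cong
             (trans (box-+ n _ _) (+-cong (trans (box-+ n _ _) (+-cong
               (trans (box-product n (λ i → ⟦ + 2 ⟧ * y 1 i) (x 3)) (trans (*-congʳ (∑-*ˡ n _ _)) (*-assoc _ _ _)))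
               (trans (box-product n (λ i → ⟦ + 6 ⟧ * y 3 i) (x 1)) (trans (*-congʳ (∑-*ˡ n _ _)) (*-assoc _ _ _)))))
               (trans (box-product n (λ i → ⟦ -[1+ 1 ] ⟧ * (ν i * w i)) (x 3)) (trans (*-congʳ (∑-*ˡ n _ _)) (*-assoc _ _ _)))))
             (trans (box-product n (λ i → ⟦ -[1+ 1 ] ⟧ * (ν i * t i)) (x 3)) (trans (*-congʳ (∑-*ˡ n _ _)) (*-assoc _ _ _)))))) ⟩
      ⟦ + 4 ⟧ * (⟦ + 2 ⟧ *
        (box n (λ i j → ((⟦ + 2 ⟧ * y 1 i) * x 3 j + (⟦ + 6 ⟧ * y 3 i) * x 1 j) + (⟦ -[1+ 1 ] ⟧ * (ν i * w i)) * x 3 j) +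
         box n (λ i j → (⟦ -[1+ 1 ] ⟧ * (ν i * t i)) * x 3 j)))
        ≈⟨ *-congˡ (*-congˡ (+-cong
             (box-cong n (λ i j → solve 6 (λ a b x y p q →
               ((con (+ 2) :* (a :* x :^ 1 :* p)) :* (b :* y :^ 3 :* q) :+ (con (+ 6) :* (a :* x :^ 3 :* p)) :* (b :* y :^ 1 :* q)) :+
               (con -[1+ 1 ] :* (x :* p)) :* (b :* y :^ 3 :* q) :=
               (a :* b :* x :* ((y :+ x) :^ 3 :+ (y :- x) :^ 3) :- con (+ 2) :* (x :* (b :* y :^ 3))) :* (p :* q)) (s i) (s j) (ν i) (ν j) (w i) (t j)))
             (box-cong n (λ i j → solve 5 (λ b x y p q →
               (con -[1+ 1 ] :* (x :* p)) :* (b :* y :^ 3 :* q) := :- (con (+ 2) :* (x :* (b :* y :^ 3))) :* (p :* q)) (s j) (ν i) (ν j) (t i) (t j))))) ⟩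
      ⟦ + 4 ⟧ * (⟦ + 2 ⟧ *
        (box n (λ i j → (s i * s j * ν i * ((ν j + ν i) ^ 3 + (ν j - ν i) ^ 3) - ⟦ + 2 ⟧ * (ν i * (s j * ν j ^ 3))) * (w i * t j)) +
         box n (λ i j → - (⟦ + 2 ⟧ * (ν i * (s j * ν j ^ 3))) * (t i * t j))))
        ≈⟨ mixed-closed L (_^ 3) (^-congˡ 3) (λ x → solve 1 (λ x → (:- x) :^ 3 := :- (x :^ 3)) x)
             (solve 0 (con (+ 0) :^ 3 := con (+ 0))) ε δ ⟦ + 4 ⟧
             (solve 0 (con (+ 1) :+ :- con (+ 1) :* (con (+ 6) :* con (+ 1) :^ 2 :- con (+ 1)) := con (+ 4) :* (:- con (+ 1) :* con (+ 1) :^ 3)))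
             (λ k → trans (+-congˡ (*-congˡ (+-congˡ (*-congˡ (^-congˡ 3 (ν-suc k))))))
               (trans (solve 2 (λ s v → (con (+ 1) :+ s :* (con (+ 6) :* v :^ 2 :- con (+ 1))) :+
                  con (+ 4) :* (s :* v :^ 3 :+ :- s :* (v :+ con (+ 1)) :^ 3) :=
                  con (+ 1) :+ :- s :* (con (+ 6) :* (v :+ con (+ 1)) :^ 2 :- con (+ 1))) (s k) (ν k))
                 (+-congˡ (*-congˡ (+-congʳ (*-congˡ (^-congˡ 2 (sym (ν-suc k)))))))))
             (solve 0 (con (+ 1) :+ :- con (+ 1) :* (con (+ 3) :* con (+ 1) :- con (+ 2) :* con (+ 1) :^ 3) := con (+ 0)))
             (λ k → trans (solve 2 (λ s v → (v :+ s :* (con (+ 3) :* v :- con (+ 2) :* v :^ 3)) :+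
                ((con (+ 1) :+ s :* (con (+ 6) :* v :^ 2 :- con (+ 1))) :+ con (+ 4) :* (s :* v :^ 3)) :=
                (v :+ con (+ 1)) :+ :- s :* (con (+ 3) :* (v :+ con (+ 1)) :- con (+ 2) :* (v :+ con (+ 1)) :^ 3)) (s k) (ν k))
                (+-cong (sym (ν-suc k)) (*-congˡ (+-cong (*-congˡ (sym (ν-suc k))) (-‿cong (*-congˡ (^-congˡ 3 (sym (ν-suc k)))))))))
             ⟩
      ∑ n (λ k → (⟦ + 4 ⟧ * (s k * ν k ^ 3 * ν k * ν k) - δ k) * t k) - ∑ n (λ k → ν k * ε k * w k)
        ≈⟨ +-cong (trans (∑-cong n (λ k → solve 3 (λ s v t →
               (con (+ 4) :* (s :* v :^ 3 :* v :* v) :- (v :+ s :* (con (+ 3) :* v :- con (+ 2) :* v :^ 3))) :* t :=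
               (con (+ 4) :* (s :* v :^ 5 :* t) :+ con (+ 2) :* (s :* v :^ 3 :* t) :+ con -[1+ 2 ] :* (s :* v :^ 1 :* t)) :+
               con -[1+ 0 ] :* (v :* t)) (s k) (ν k) (t k))) (trans (∑-+ n _ _) (+-cong (∑-lin₃ n _ _ _ _ _ _) (∑-*ˡ n _ _))))
             (-‿cong (trans (∑-cong n (λ k → solve 3 (λ s v w → v :* (con (+ 1) :+ s :* (con (+ 6) :* v :^ 2 :- con (+ 1))) :* w :=
               con (+ 1) :* (v :* w) :+ con (+ 6) :* (s :* v :^ 3 :* w) :+ con -[1+ 0 ] :* (s :* v :^ 1 :* w)) (s k) (ν k) (w k))) (∑-lin₃ n _ _ _ _ _ _))) ⟩
      ((⟦ + 4 ⟧ * X′ 5 + ⟦ + 2 ⟧ * X′ 3 + ⟦ -[1+ 2 ] ⟧ * X′ 1) + ⟦ -[1+ 0 ] ⟧ * T₁ L) -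
      (⟦ + 1 ⟧ * W₁ L + ⟦ + 6 ⟧ * Y′ 3 + ⟦ -[1+ 0 ] ⟧ * Y′ 1) ∎
      where
      ε δ : ℕ → Carrier
      ε k = ⟦ + 1 ⟧ + s k * (⟦ + 6 ⟧ * ν k ^ 2 - ⟦ + 1 ⟧)
      δ k = ν k + s k * (⟦ + 3 ⟧ * ν k - ⟦ + 2 ⟧ * ν k ^ 3)

    -- Elimination: the determinants and the derivative of A

    module Determinants (parity : ⟦ + 2 ⟧ * T₁ L ≈ W₁ L - Y′ 1) where

      W-parity : W₁ L ≈ ⟦ + 2 ⟧ * T₁ L + Y′ 1
      W-parity = trans (solve 2 (λ w y → w := (w :- y) :+ y) (W₁ L) (Y′ 1)) (+-congʳ (sym parity))

      Y₃ : Y′ 3 ≈ X′ 1 + ⟦ + 4 ⟧ * (X′ 1 * X′ 1)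
      Y₃ = trans (solve 2 (λ x y → y := x :- (x :- y)) (X′ 1) (Y′ 3))
        (trans (+-congˡ (-‿cong (sym relation-2)))
          (solve 1 (λ x → x :- con -[1+ 3 ] :* (x :* x) := x :+ con (+ 4) :* (x :* x)) (X′ 1)))

      Y₅ : Y′ 5 ≈ ⟦ + 2 ⟧ * X′ 3 - X′ 1 + ⟦ + 16 ⟧ * (X′ 1 * X′ 3)
      Y₅ = trans (solve 3 (λ x z y → y := (con (+ 2) :* z :- x) :- ((con (+ 2) :* z :+ con -[1+ 0 ] :* x) :- y)) (X′ 1) (X′ 3) (Y′ 5))
        (trans (+-congˡ (-‿cong (sym relation-4)))
          (solve 2 (λ x z → (con (+ 2) :* z :- x) :- con -[1+ 15 ] :* (x :* z) := con (+ 2) :* z :- x :+ con (+ 16) :* (x :* z)) (X′ 1) (X′ 3)))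

      Y₇ : Y′ 7 ≈ ⟦ + 3 ⟧ * X′ 5 - ⟦ + 5 ⟧ * X′ 3 + ⟦ + 3 ⟧ * X′ 1 + ⟦ + 24 ⟧ * (X′ 1 * X′ 5) + ⟦ + 40 ⟧ * (X′ 3 * X′ 3)
      Y₇ = trans (solve 4 (λ x z u y → y := (con (+ 3) :* u :- con (+ 5) :* z :+ con (+ 3) :* x) :-
             ((con (+ 3) :* u :+ con -[1+ 4 ] :* z :+ con (+ 3) :* x) :- y)) (X′ 1) (X′ 3) (X′ 5) (Y′ 7))
        (trans (+-congˡ (-‿cong (sym relation-6)))
          (solve 3 (λ x z u → (con (+ 3) :* u :- con (+ 5) :* z :+ con (+ 3) :* x) :-
               (con -[1+ 23 ] :* (x :* u) :+ con -[1+ 39 ] :* (z :* z)) :=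
             con (+ 3) :* u :- con (+ 5) :* z :+ con (+ 3) :* x :+ con (+ 24) :* (x :* u) :+ con (+ 40) :* (z :* z)) (X′ 1) (X′ 3) (X′ 5)))

      -- Eight times the left side is A L - (16 U₃ + 1). Once `parity` replaces W₁ in
      -- `relation-mixed-1`, all terms in Y 1 cancel.
      relation-A : ⟦ + 24 ⟧ * (X′ 1 * T₁ L) + ⟦ + 2 ⟧ * X′ 3 + X′ 1 + ⟦ + 3 ⟧ * T₁ L ≈ ⟦ + 0 ⟧
      relation-A = begin
        ⟦ + 24 ⟧ * (X′ 1 * T₁ L) + ⟦ + 2 ⟧ * X′ 3 + X′ 1 + ⟦ + 3 ⟧ * T₁ L
          ≈⟨ solve 4 (λ x z t y → con (+ 24) :* (x :* t) :+ con (+ 2) :* z :+ x :+ con (+ 3) :* t :=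
               ((con (+ 2) :* z :+ con (+ 1) :* x :+ con (+ 1) :* t) :- (con (+ 1) :* y :+ con -[1+ 0 ] :* (con (+ 2) :* t :+ y))) :-
               con (+ 2) :* (con (+ 2) :* ((con (+ 2) :* (y :* x) :+ con -[1+ 1 ] :* ((con (+ 2) :* t :+ y) :* x)) :+ con -[1+ 1 ] :* (t :* x)))) (X′ 1) (X′ 3) (T₁ L) (Y′ 1) ⟩
        ((⟦ + 2 ⟧ * X′ 3 + ⟦ + 1 ⟧ * X′ 1 + ⟦ + 1 ⟧ * T₁ L) - (⟦ + 1 ⟧ * Y′ 1 + ⟦ -[1+ 0 ] ⟧ * (⟦ + 2 ⟧ * T₁ L + Y′ 1))) -
        ⟦ + 2 ⟧ * (⟦ + 2 ⟧ * ((⟦ + 2 ⟧ * (Y′ 1 * X′ 1) + ⟦ -[1+ 1 ] ⟧ * ((⟦ + 2 ⟧ * T₁ L + Y′ 1) * X′ 1)) + ⟦ -[1+ 1 ] ⟧ * (T₁ L * X′ 1)))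
          ≈⟨ +-cong (+-congˡ (-‿cong (+-congˡ (*-congˡ (sym W-parity)))))
               (-‿cong (*-congˡ (*-congˡ (+-congʳ (+-congˡ (*-congˡ (*-congʳ (sym W-parity)))))))) ⟩
        _ - _  ≈⟨ +-congˡ (-‿cong relation-mixed-1) ⟩
        _ - _  ≈⟨ solve 1 (λ x → x :- x := con (+ 0)) _ ⟩
        ⟦ + 0 ⟧ ∎

      -- Eight times the left side is - 2 (16 U₅ - 2) - 3 A³ - (16 U₃ + 1) L. The product A L is
      -- already replaced by 16 U₃ + 1, which keeps the degree low.
      relation-D : ⟦ + 4 ⟧ * X′ 5 + ⟦ + 2 ⟧ * X′ 3 - ⟦ + 9 ⟧ * X′ 1 - ⟦ + 3 ⟧ * T₁ L - ⟦ + 72 ⟧ * (X′ 1 * X′ 1)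
        + ⟦ + 48 ⟧ * (X′ 3 * T₁ L) - ⟦ + 192 ⟧ * (X′ 1 * X′ 1 * X′ 1) ≈ ⟦ + 0 ⟧
      relation-D = begin
        ⟦ + 4 ⟧ * X′ 5 + ⟦ + 2 ⟧ * X′ 3 - ⟦ + 9 ⟧ * X′ 1 - ⟦ + 3 ⟧ * T₁ L - ⟦ + 72 ⟧ * (X′ 1 * X′ 1)
          + ⟦ + 48 ⟧ * (X′ 3 * T₁ L) - ⟦ + 192 ⟧ * (X′ 1 * X′ 1 * X′ 1)
          ≈⟨ solve 5 (λ x z u t y →
               con (+ 4) :* u :+ con (+ 2) :* z :- con (+ 9) :* x :- con (+ 3) :* t :- con (+ 72) :* (x :* x)
               :+ con (+ 48) :* (z :* t) :- con (+ 192) :* (x :* x :* x) :=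
               (((con (+ 4) :* u :+ con (+ 2) :* z :+ con -[1+ 2 ] :* x) :+ con -[1+ 0 ] :* t) :-
               (con (+ 1) :* (con (+ 2) :* t :+ y) :+ con (+ 6) :* (x :+ con (+ 4) :* (x :* x)) :+ con -[1+ 0 ] :* y)) :-
               con (+ 4) :* (con (+ 2) :* (((con (+ 2) :* (y :* z) :+ con (+ 6) :* ((x :+ con (+ 4) :* (x :* x)) :* x)) :+
                 con -[1+ 1 ] :* ((con (+ 2) :* t :+ y) :* z)) :+ con -[1+ 1 ] :* (t :* z)))) (X′ 1) (X′ 3) (X′ 5) (T₁ L) (Y′ 1) ⟩
        (((⟦ + 4 ⟧ * X′ 5 + ⟦ + 2 ⟧ * X′ 3 + ⟦ -[1+ 2 ] ⟧ * X′ 1) + ⟦ -[1+ 0 ] ⟧ * T₁ L) -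
          (⟦ + 1 ⟧ * (⟦ + 2 ⟧ * T₁ L + Y′ 1) + ⟦ + 6 ⟧ * (X′ 1 + ⟦ + 4 ⟧ * (X′ 1 * X′ 1)) + ⟦ -[1+ 0 ] ⟧ * Y′ 1)) -
        ⟦ + 4 ⟧ * (⟦ + 2 ⟧ * (((⟦ + 2 ⟧ * (Y′ 1 * X′ 3) + ⟦ + 6 ⟧ * ((X′ 1 + ⟦ + 4 ⟧ * (X′ 1 * X′ 1)) * X′ 1)) +
          ⟦ -[1+ 1 ] ⟧ * ((⟦ + 2 ⟧ * T₁ L + Y′ 1) * X′ 3)) + ⟦ -[1+ 1 ] ⟧ * (T₁ L * X′ 3)))
          ≈⟨ +-cong (+-congˡ (-‿cong (+-congʳ (+-cong (*-congˡ (sym W-parity)) (*-congˡ (sym Y₃))))))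
               (-‿cong (*-congˡ (*-congˡ (+-congʳ (+-cong (+-congˡ (*-congˡ (*-congʳ (sym Y₃)))) (*-congˡ (*-congʳ (sym W-parity)))))))) ⟩
        _ - _  ≈⟨ +-congˡ (-‿cong relation-mixed-3) ⟩
        _ - _  ≈⟨ solve 1 (λ x → x :- x := con (+ 0)) _ ⟩
        ⟦ + 0 ⟧ ∎

      U : ℕ → Carrier
      U m = - X′ m

      A₀ : Carrier
      A₀ = ⟦ + 1 ⟧ + ⟦ + 8 ⟧ * X′ 1

      -- Let B = 16 U₃ + 1, and note 16 U₁ - 2 = - 2 A. The determinant exceeds 3 A⁴ by 8 A times
      -- the left side of `relation-D` plus 8 B times that of `relation-A`.
      determinant-U : ⟦ + 3 ⟧ * A₀ ^ 4 ≈
        (⟦ + 16 ⟧ * U 1 - ⟦ + 2 ⟧) * (⟦ + 16 ⟧ * U 5 - ⟦ + 2 ⟧) -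
        (⟦ + 16 ⟧ * U 3 + ⟦ + 1 ⟧) * (⟦ + 16 ⟧ * U 3 + ⟦ + 1 ⟧)
      determinant-U = begin
        ⟦ + 3 ⟧ * A₀ ^ 4
          ≈⟨ solve 4 (λ x z u t → con (+ 3) :* (con (+ 1) :+ con (+ 8) :* x) :^ 4 :=
               ((con (+ 16) :* :- x :- con (+ 2)) :* (con (+ 16) :* :- u :- con (+ 2)) :-
                (con (+ 16) :* :- z :+ con (+ 1)) :* (con (+ 16) :* :- z :+ con (+ 1))) :-
               (con (+ 8) :* (con (+ 1) :+ con (+ 8) :* x) :*
                 (con (+ 4) :* u :+ con (+ 2) :* z :- con (+ 9) :* x :- con (+ 3) :* t :- con (+ 72) :* (x :* x)
                 :+ con (+ 48) :* (z :* t) :- con (+ 192) :* (x :* x :* x)) :+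
                con (+ 8) :* (con (+ 1) :- con (+ 16) :* z) :*
                 (con (+ 24) :* (x :* t) :+ con (+ 2) :* z :+ x :+ con (+ 3) :* t))) (X′ 1) (X′ 3) (X′ 5) (T₁ L) ⟩
        _ - (⟦ + 8 ⟧ * (⟦ + 1 ⟧ + ⟦ + 8 ⟧ * X′ 1) * _ + ⟦ + 8 ⟧ * (⟦ + 1 ⟧ - ⟦ + 16 ⟧ * X′ 3) * _)
          ≈⟨ +-congˡ (-‿cong (+-cong (*-congˡ relation-D) (*-congˡ relation-A))) ⟩
        _  ≈⟨ solve 3 (λ a b c → a :- (b :* con (+ 0) :+ c :* con (+ 0)) := a) _ _ _ ⟩
        (⟦ + 16 ⟧ * U 1 - ⟦ + 2 ⟧) * (⟦ + 16 ⟧ * U 5 - ⟦ + 2 ⟧) -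
        (⟦ + 16 ⟧ * U 3 + ⟦ + 1 ⟧) * (⟦ + 16 ⟧ * U 3 + ⟦ + 1 ⟧) ∎

      -- With B = 16 U₃ + 1 and M = (16 U₁ - 2) (16 U₅ - 2), the entries are A², - 2 A B, - 4 A B
      -- and 3 M + 5 B². The determinant is A² (3 M + 5 B²) - 8 A² B² = 3 A² (M - B²), that is, 3 A²
      -- times the first determinant.
      determinant-G : ⟦ + 9 ⟧ * A₀ ^ 6 ≈
        (⟦ + 16 ⟧ * Y′ 3 + ⟦ + 1 ⟧) * (⟦ + 32 ⟧ * Y′ 7 + ⟦ + 17 ⟧) -
        (⟦ + 16 ⟧ * Y′ 5 - ⟦ + 2 ⟧) * (⟦ + 32 ⟧ * Y′ 5 - ⟦ + 4 ⟧)
      determinant-G = begin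
        ⟦ + 9 ⟧ * A₀ ^ 6
          ≈⟨ solve 1 (λ a → con (+ 9) :* a :^ 6 := con (+ 3) :* a :^ 2 :* (con (+ 3) :* a :^ 4)) A₀ ⟩
        ⟦ + 3 ⟧ * A₀ ^ 2 * (⟦ + 3 ⟧ * A₀ ^ 4)
          ≈⟨ *-congˡ determinant-U ⟩
        ⟦ + 3 ⟧ * A₀ ^ 2 * ((⟦ + 16 ⟧ * U 1 - ⟦ + 2 ⟧) * (⟦ + 16 ⟧ * U 5 - ⟦ + 2 ⟧) -
          (⟦ + 16 ⟧ * U 3 + ⟦ + 1 ⟧) * (⟦ + 16 ⟧ * U 3 + ⟦ + 1 ⟧))
          ≈⟨ solve 3 (λ x z u →
               con (+ 3) :* (con (+ 1) :+ con (+ 8) :* x) :^ 2 :*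
               ((con (+ 16) :* :- x :- con (+ 2)) :* (con (+ 16) :* :- u :- con (+ 2)) :-
                (con (+ 16) :* :- z :+ con (+ 1)) :* (con (+ 16) :* :- z :+ con (+ 1))) :=
               (con (+ 16) :* (x :+ con (+ 4) :* (x :* x)) :+ con (+ 1)) :*
               (con (+ 32) :* (con (+ 3) :* u :- con (+ 5) :* z :+ con (+ 3) :* x :+ con (+ 24) :* (x :* u) :+ con (+ 40) :* (z :* z)) :+ con (+ 17)) :-
               (con (+ 16) :* (con (+ 2) :* z :- x :+ con (+ 16) :* (x :* z)) :- con (+ 2)) :*
               (con (+ 32) :* (con (+ 2) :* z :- x :+ con (+ 16) :* (x :* z)) :- con (+ 4))) (X′ 1) (X′ 3) (X′ 5) ⟩
        _  ≈⟨ sym (+-cong (*-cong (+-congʳ (*-congˡ Y₃)) (+-congʳ (*-congˡ Y₇)))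
                (-‿cong (*-cong (+-congʳ (*-congˡ Y₅)) (+-congʳ (*-congˡ Y₅))))) ⟩
        (⟦ + 16 ⟧ * Y′ 3 + ⟦ + 1 ⟧) * (⟦ + 32 ⟧ * Y′ 7 + ⟦ + 17 ⟧) -
        (⟦ + 16 ⟧ * Y′ 5 - ⟦ + 2 ⟧) * (⟦ + 32 ⟧ * Y′ 5 - ⟦ + 4 ⟧) ∎

      -- The left side is q d/dq A. After W₁ has been eliminated, `relation-derivative` differs from
      -- the claim by twice the left side of `relation-A`.
      derivative-A₀ : ⟦ + 8 ⟧ * (X′ 2 - Z₂ L) ≈ ⟦ -[1+ 3 ] ⟧ * (W₁ L + T₁ L) * A₀
      derivative-A₀ = begin
        ⟦ + 8 ⟧ * (X′ 2 - Z₂ L)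
          ≈⟨ solve 7 (λ x z a b t y w →
               con (+ 8) :* (a :- b) :=
               (con (+ 4) :* z :+ con (+ 2) :* x :- con (+ 2) :* t :- con (+ 2) :* (w :+ y) :-
                 con (+ 4) :* ((con (+ 4) :* ((w :+ y) :* x)) :+ con (+ 4) :* (x :* t))) :+
               (con (+ 4) :* ((con (+ 4) :* ((w :+ y) :* x)) :+ con (+ 4) :* (x :* t)) :-
               ((con (+ 4) :* z :+ con -[1+ 7 ] :* a :+ con (+ 2) :* x) :+ con -[1+ 1 ] :* t :+ con -[1+ 1 ] :* (w :+ y) :+ con (+ 8) :* b))) (X′ 1) (X′ 3) (X′ 2) (Z₂ L) (T₁ L) (Y′ 1) (W₁ L) ⟩
        _  ≈⟨ +-congˡ (trans (+-congʳ (relation-derivative L)) (solve 1 (λ x → x :- x := con (+ 0)) _)) ⟩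
        _  ≈⟨ +-congʳ (+-cong (+-congˡ (-‿cong (*-congˡ (+-congʳ W-parity)))) (-‿cong (*-congˡ (+-congʳ (*-congˡ (*-congʳ (+-congʳ W-parity))))))) ⟩
        _  ≈⟨ solve 4 (λ x z t y →
               (con (+ 4) :* z :+ con (+ 2) :* x :- con (+ 2) :* t :- con (+ 2) :* ((con (+ 2) :* t :+ y) :+ y) :-
                 con (+ 4) :* ((con (+ 4) :* (((con (+ 2) :* t :+ y) :+ y) :* x)) :+ con (+ 4) :* (x :* t))) :+ con (+ 0) :=
               con -[1+ 3 ] :* ((con (+ 2) :* t :+ y) :+ t) :* (con (+ 1) :+ con (+ 8) :* x) :+
               con (+ 2) :* (con (+ 24) :* (x :* t) :+ con (+ 2) :* z :+ x :+ con (+ 3) :* t)) (X′ 1) (X′ 3) (T₁ L) (Y′ 1) ⟩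
        _  ≈⟨ +-cong (*-congʳ (*-congˡ (+-congʳ (sym W-parity)))) (*-congˡ relation-A) ⟩
        _  ≈⟨ solve 1 (λ a → a :+ con (+ 2) :* con (+ 0) := a) _ ⟩
        ⟦ -[1+ 3 ] ⟧ * (W₁ L + T₁ L) * A₀ ∎

  -- Gauss' product and the Euler operator

  -- Q m stands for qᵐ, and qᴺ = 0.
  record IsNome (N : ℕ) (Q t w : ℕ → Carrier) : Set where
    field
      Q-0      : Q 0 ≈ ⟦ + 1 ⟧
      Q-+      : ∀ m k → Q (m ℕ.+ k) ≈ Q m * Q k
      Q-vanish : ∀ m → N ℕ.≤ m → Q m ≈ 0#
      t-eq     : ∀ i → t i ≈ Q (suc i) * (⟦ + 1 ⟧ - t i)
      w-eq     : ∀ i → w i ≈ Q (suc i) * (⟦ + 1 ⟧ + w i)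

  module _ {N Q t w} (nome : IsNome N Q t w) where

    open IsNome nome

    -- Thus 1 - t(a) inverts 1 + qᵃ, and likewise 1 + w(a) inverts 1 - qᵃ. Multiplying by such pairs
    -- stands in for division from here on.
    1-t : ∀ i → (⟦ + 1 ⟧ + Q (suc i)) * (⟦ + 1 ⟧ - t i) ≈ ⟦ + 1 ⟧
    1-t i = begin
      (⟦ + 1 ⟧ + Q (suc i)) * (⟦ + 1 ⟧ - t i)
        ≈⟨ solve 2 (λ x t → (con (+ 1) :+ x) :* (con (+ 1) :- t) := con (+ 1) :- t :+ x :* (con (+ 1) :- t)) _ _ ⟩
      ⟦ + 1 ⟧ - t i + Q (suc i) * (⟦ + 1 ⟧ - t i)  ≈⟨ +-congˡ (sym (t-eq i)) ⟩
      ⟦ + 1 ⟧ - t i + t i  ≈⟨ solve 1 (λ t → con (+ 1) :- t :+ t := con (+ 1)) _ ⟩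
      ⟦ + 1 ⟧ ∎

    1+w : ∀ i → (⟦ + 1 ⟧ - Q (suc i)) * (⟦ + 1 ⟧ + w i) ≈ ⟦ + 1 ⟧
    1+w i = begin
      (⟦ + 1 ⟧ - Q (suc i)) * (⟦ + 1 ⟧ + w i)
        ≈⟨ solve 2 (λ x t → (con (+ 1) :- x) :* (con (+ 1) :+ t) := con (+ 1) :+ t :- x :* (con (+ 1) :+ t)) _ _ ⟩
      ⟦ + 1 ⟧ + w i - Q (suc i) * (⟦ + 1 ⟧ + w i)  ≈⟨ +-congˡ (-‿cong (sym (w-eq i))) ⟩
      ⟦ + 1 ⟧ + w i - w i  ≈⟨ solve 1 (λ t → con (+ 1) :+ t :- t := con (+ 1)) _ ⟩
      ⟦ + 1 ⟧ ∎

    Q-index : ∀ i j → Q (suc (suc (i ℕ.+ j))) ≈ Q (suc i) * Q (suc j)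
    Q-index i j = trans (reflexive (≡.cong (Q ∘ suc) (≡.sym (ℕ.+-suc i j)))) (Q-+ (suc i) (suc j))

    -- Both partial fractions come from factorisations: 1 - t(a) - t(b) = (1 - t(a)) (1 - t(b)) (1 -
    -- qᵃ⁺ᵇ) and 1 + w(a) - t(b) = (1 + w(a)) (1 - t(b)) (1 + qᵃ⁺ᵇ). The last factor cancels against
    -- w(a+b), respectively t(a+b).
    isLambert : IsLambert N t w
    isLambert = record
      { t-vanish = λ k N≤k → trans (t-eq k) (trans (*-congʳ (Q-vanish (suc k) (ℕ.m≤n⇒m≤1+n N≤k))) (zeroˡ _))
      ; w-vanish = λ k N≤k → trans (w-eq k) (trans (*-congʳ (Q-vanish (suc k) (ℕ.m≤n⇒m≤1+n N≤k))) (zeroˡ _))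
      ; tt = tt
      ; wt = wt
      ; halving = λ i → begin
          ⟦ + 2 ⟧ * (w i * t i)
            ≈⟨ solve 2 (λ w t → con (+ 2) :* (w :* t) := w :+ (w :* t :- w :* (con (+ 1) :- t))) (w i) (t i) ⟩
          w i + (w i * t i - w i * (⟦ + 1 ⟧ - t i))
            ≈⟨ +-congˡ (+-congˡ (-‿cong (*-congʳ (w-eq i)))) ⟩
          w i + (w i * t i - Q (suc i) * (⟦ + 1 ⟧ + w i) * (⟦ + 1 ⟧ - t i))
            ≈⟨ solve 3 (λ w t x → w :+ (w :* t :- x :* (con (+ 1) :+ w) :* (con (+ 1) :- t)) :=
                 w :+ (w :* t :- (con (+ 1) :+ w) :* (x :* (con (+ 1) :- t)))) (w i) (t i) _ ⟩
          w i + (w i * t i - (⟦ + 1 ⟧ + w i) * (Q (suc i) * (⟦ + 1 ⟧ - t i)))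
            ≈⟨ +-congˡ (+-congˡ (-‿cong (*-congˡ (sym (t-eq i))))) ⟩
          w i + (w i * t i - (⟦ + 1 ⟧ + w i) * t i)
            ≈⟨ solve 2 (λ w t → w :+ (w :* t :- (con (+ 1) :+ w) :* t) := w :- t) (w i) (t i) ⟩
          w i - t i ∎
      }
      where
      tt : ∀ i j → t i * t j ≈ w (suc (i ℕ.+ j)) * (⟦ + 1 ⟧ - t i - t j)
      tt i j = sym (begin
        w k * (⟦ + 1 ⟧ - t i - t j)
          ≈⟨ *-cong (trans (w-eq k) (*-congʳ (Q-index i j)))
               (trans (solve 2 (λ t u → con (+ 1) :- t :- u := (con (+ 1) :- t) :* (con (+ 1) :- u) :- t :* u) (t i) (t j))
                 (+-congˡ (-‿cong (*-cong (t-eq i) (t-eq j))))) ⟩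
        x * y * (⟦ + 1 ⟧ + w k) * ((⟦ + 1 ⟧ - t i) * (⟦ + 1 ⟧ - t j) - x * (⟦ + 1 ⟧ - t i) * (y * (⟦ + 1 ⟧ - t j)))
          ≈⟨ solve 5 (λ x y w a b → x :* y :* w :* (a :* b :- x :* a :* (y :* b)) :=
               x :* a :* (y :* b) :* ((con (+ 1) :- x :* y) :* w)) x y (⟦ + 1 ⟧ + w k) (⟦ + 1 ⟧ - t i) (⟦ + 1 ⟧ - t j) ⟩
        x * (⟦ + 1 ⟧ - t i) * (y * (⟦ + 1 ⟧ - t j)) * ((⟦ + 1 ⟧ - x * y) * (⟦ + 1 ⟧ + w k))
          ≈⟨ *-cong (sym (*-cong (t-eq i) (t-eq j)))
               (trans (*-congʳ (+-congˡ (-‿cong (sym (Q-index i j))))) (1+w k)) ⟩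
        t i * t j * ⟦ + 1 ⟧  ≈⟨ solve 1 (λ a → a :* con (+ 1) := a) _ ⟩
        t i * t j ∎)
        where
        k = suc (i ℕ.+ j)
        x = Q (suc i)
        y = Q (suc j)
      wt : ∀ i j → w i * t j ≈ t (suc (i ℕ.+ j)) * (⟦ + 1 ⟧ + w i - t j)
      wt i j = sym (begin
        t k * (⟦ + 1 ⟧ + w i - t j)
          ≈⟨ *-cong (trans (t-eq k) (*-congʳ (Q-index i j)))
               (trans (solve 2 (λ t u → con (+ 1) :+ t :- u := (con (+ 1) :+ t) :* (con (+ 1) :- u) :+ t :* u) (w i) (t j))
                 (+-congˡ (*-cong (w-eq i) (t-eq j)))) ⟩
        x * y * (⟦ + 1 ⟧ - t k) * ((⟦ + 1 ⟧ + w i) * (⟦ + 1 ⟧ - t j) + x * (⟦ + 1 ⟧ + w i) * (y * (⟦ + 1 ⟧ - t j)))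
          ≈⟨ solve 5 (λ x y w a b → x :* y :* w :* (a :* b :+ x :* a :* (y :* b)) :=
               x :* a :* (y :* b) :* ((con (+ 1) :+ x :* y) :* w)) x y (⟦ + 1 ⟧ - t k) (⟦ + 1 ⟧ + w i) (⟦ + 1 ⟧ - t j) ⟩
        x * (⟦ + 1 ⟧ + w i) * (y * (⟦ + 1 ⟧ - t j)) * ((⟦ + 1 ⟧ + x * y) * (⟦ + 1 ⟧ - t k))
          ≈⟨ *-cong (sym (*-cong (w-eq i) (t-eq j)))
               (trans (*-congʳ (+-congˡ (sym (Q-index i j)))) (1-t k)) ⟩
        w i * t j * ⟦ + 1 ⟧  ≈⟨ solve 1 (λ a → a :* con (+ 1) := a) _ ⟩
        w i * t j ∎)
        where
        k = suc (i ℕ.+ j)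
        x = Q (suc i)
        y = Q (suc j)

    open IsLambert isLambert using (t-vanish; w-vanish; halving)

    -- This is w(2a) = w(a) t(a), from 1 - q²ᵃ = (1 - qᵃ) (1 + qᵃ).
    doubling : ∀ i → w (suc (i ℕ.+ i)) ≈ w i * t i
    doubling i = begin
      w k  ≈⟨ trans (w-eq k) (*-congʳ (Q-index i i)) ⟩
      x * x * (⟦ + 1 ⟧ + w k)
        ≈⟨ solve 2 (λ x v → x :* x :* v := x :* x :* v :* con (+ 1) :* con (+ 1)) x _ ⟩
      x * x * (⟦ + 1 ⟧ + w k) * ⟦ + 1 ⟧ * ⟦ + 1 ⟧
        ≈⟨ *-cong (*-congˡ (sym (1+w i))) (sym (1-t i)) ⟩
      x * x * (⟦ + 1 ⟧ + w k) * ((⟦ + 1 ⟧ - x) * (⟦ + 1 ⟧ + w i)) * ((⟦ + 1 ⟧ + x) * (⟦ + 1 ⟧ - t i))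
        ≈⟨ solve 4 (λ x v a b → x :* x :* v :* ((con (+ 1) :- x) :* a) :* ((con (+ 1) :+ x) :* b) :=
             (x :* a) :* (x :* b) :* ((con (+ 1) :- x :* x) :* v)) x _ _ _ ⟩
      (x * (⟦ + 1 ⟧ + w i)) * (x * (⟦ + 1 ⟧ - t i)) * ((⟦ + 1 ⟧ - x * x) * (⟦ + 1 ⟧ + w k))
        ≈⟨ *-cong (sym (*-cong (w-eq i) (t-eq i)))
             (trans (*-congʳ (+-congˡ (-‿cong (sym (Q-index i i))))) (1+w k)) ⟩
      w i * t i * ⟦ + 1 ⟧  ≈⟨ solve 1 (λ a → a :* con (+ 1) := a) _ ⟩
      w i * t i ∎
      where
      k = suc (i ℕ.+ i)
      x = Q (suc i)

    ∑-pairs : ∀ n f → ∑ (n ℕ.+ n) f ≈ ∑ n (λ i → f (i ℕ.+ i) + f (suc (i ℕ.+ i)))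
    ∑-pairs zero    f = refl
    ∑-pairs (suc n) f = begin
      f 0 + ∑ (n ℕ.+ suc n) (f ∘ suc)
        ≈⟨ +-congˡ (reflexive (≡.cong (λ m → ∑ m (f ∘ suc)) (ℕ.+-suc n n))) ⟩
      f 0 + (f 1 + ∑ (n ℕ.+ n) (f ∘ suc ∘ suc))
        ≈⟨ sym (+-assoc _ _ _) ⟩
      f 0 + f 1 + ∑ (n ℕ.+ n) (f ∘ suc ∘ suc)
        ≈⟨ +-congˡ (trans (∑-pairs n (f ∘ suc ∘ suc)) (∑-cong n (λ i →
             reflexive (≡.cong (λ m → f (suc m) + f (suc (suc m))) (≡.sym (ℕ.+-suc i i)))))) ⟩
      f 0 + f 1 + ∑ n (λ i → f (suc (i ℕ.+ suc i)) + f (suc (suc (i ℕ.+ suc i)))) ∎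

    ∑-extend : ∀ n m f → (∀ k → n ℕ.≤ k → f k ≈ 0#) → ∑ (n ℕ.+ m) f ≈ ∑ n f
    ∑-extend zero    m f van = ∑-0 m (λ i → van i ℕ.z≤n)
    ∑-extend (suc n) m f van = +-congˡ (∑-extend n m (f ∘ suc) (λ k n≤k → van (suc k) (ℕ.s≤s n≤k)))

    -- In W₁ + Y 1 the odd a cancel and the even ones double, leaving 4 Σ a w(2a). By `doubling` and
    -- `halving`, 2 w(2a) = w(a) - t(a), so W₁ + Y 1 = 2 W₁ - 2 T₁. Because of the index shift the
    -- even a sit at the odd indices; the range is extended to N + N, where the new terms vanish.
    parity : ⟦ + 2 ⟧ * T₁ isLambert ≈ W₁ isLambert - Y isLambert 1
    parity = begin
      ⟦ + 2 ⟧ * T₁ isLambert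
        ≈⟨ sym (∑-*ˡ N _ _) ⟩
      ∑ N (λ i → ⟦ + 2 ⟧ * (ν i * t i))
        ≈⟨ ∑-cong N (λ i → trans (solve 3 (λ v w t → con (+ 2) :* (v :* t) := con (+ 2) :* (v :* w) :+ con -[1+ 1 ] :* (v :* (w :- t))) (ν i) (w i) (t i))
             (+-congˡ (*-congˡ (*-congˡ (trans (sym (halving i)) (*-congˡ (sym (doubling i)))))))) ⟩
      ∑ N (λ i → ⟦ + 2 ⟧ * (ν i * w i) + ⟦ -[1+ 1 ] ⟧ * (ν i * (⟦ + 2 ⟧ * w (suc (i ℕ.+ i)))))
        ≈⟨ trans (∑-+ N _ _) (+-cong (∑-*ˡ N _ _) even-part) ⟩
      ⟦ + 2 ⟧ * W₁ isLambert + - (W₁ isLambert + Y isLambert 1)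
        ≈⟨ solve 2 (λ x y → con (+ 2) :* x :+ :- (x :+ y) := x :- y) _ _ ⟩
      W₁ isLambert - Y isLambert 1 ∎
      where
      f : ℕ → Carrier
      f i = ν i * w i + s i * ν i ^ 1 * w i
      s-odd : ∀ i → s (i ℕ.+ i) ≈ ⟦ -[1+ 0 ] ⟧
      s-odd i = begin
        s (i ℕ.+ i)  ≈⟨ solve 1 (λ x → x := :- :- x) _ ⟩
        - s (suc (i ℕ.+ i))  ≈⟨ -‿cong (trans (s-+ i i) (s² i)) ⟩
        - ⟦ + 1 ⟧  ≈⟨ solve 0 (:- con (+ 1) := con -[1+ 0 ]) ⟩
        ⟦ -[1+ 0 ] ⟧ ∎
      odd-term : ∀ i → f (i ℕ.+ i) ≈ ⟦ + 0 ⟧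
      odd-term i = trans (+-congˡ (*-congʳ (*-congʳ (s-odd i))))
        (solve 2 (λ v w → v :* w :+ con -[1+ 0 ] :* v :^ 1 :* w := con (+ 0)) _ _)
      even-term : ∀ i → f (suc (i ℕ.+ i)) ≈ ⟦ + 2 ⟧ * (ν i * (⟦ + 2 ⟧ * w (suc (i ℕ.+ i))))
      even-term i = trans (+-cong (*-congʳ (ν-+ i i)) (*-congʳ (*-cong (trans (s-+ i i) (s² i)) (^-congˡ 1 (ν-+ i i)))))
        (solve 2 (λ v w → (v :+ v) :* w :+ con (+ 1) :* (v :+ v) :^ 1 :* w := con (+ 2) :* (v :* (con (+ 2) :* w))) (ν i) _)
      even-part : ∑ N (λ i → ⟦ -[1+ 1 ] ⟧ * (ν i * (⟦ + 2 ⟧ * w (suc (i ℕ.+ i))))) ≈ - (W₁ isLambert + Y isLambert 1)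
      even-part = begin
        ∑ N (λ i → ⟦ -[1+ 1 ] ⟧ * (ν i * (⟦ + 2 ⟧ * w (suc (i ℕ.+ i)))))
          ≈⟨ ∑-cong N (λ i → trans
               (solve 1 (λ x → con -[1+ 1 ] :* x := :- (con (+ 0) :+ con (+ 2) :* x)) _)
               (-‿cong (sym (+-cong (odd-term i) (even-term i))))) ⟩
        ∑ N (λ i → - (f (i ℕ.+ i) + f (suc (i ℕ.+ i))))
          ≈⟨ ∑-neg N _ ⟩
        - ∑ N (λ i → f (i ℕ.+ i) + f (suc (i ℕ.+ i)))
          ≈⟨ -‿cong (sym (∑-pairs N f)) ⟩
        - ∑ (N ℕ.+ N) f
          ≈⟨ -‿cong (∑-extend N N f (λ k N≤k → trans (+-cong (trans (*-congˡ (w-vanish k N≤k)) (zeroʳ _))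
               (trans (*-congˡ (w-vanish k N≤k)) (zeroʳ _))) (+-identityʳ 0#))) ⟩
        - ∑ N f  ≈⟨ -‿cong (∑-+ N _ _) ⟩
        - (W₁ isLambert + Y isLambert 1) ∎

    p : ℕ → Carrier
    p k = ⟦ + 1 ⟧ - ⟦ + 2 ⟧ * t k

    -- As 1 - 2 t(a) = (1 - qᵃ)/(1 + qᵃ), `P n` is the partial product of these quotients over a ≤
    -- n, and `V n` is its inverse. `σ m` is (-1)ᵐ, without the index shift of `s`.
    P V σ : ℕ → Carrier
    P zero    = ⟦ + 1 ⟧
    P (suc n) = P n * p n
    V zero    = ⟦ + 1 ⟧
    V (suc n) = V n * (⟦ + 1 ⟧ + ⟦ + 2 ⟧ * w n)
    σ zero    = ⟦ + 1 ⟧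
    σ (suc i) = s i

    σ-suc : ∀ m → s m ≈ - σ m
    σ-suc zero    = refl
    σ-suc (suc m) = refl

    p-inverse : ∀ n → p n * (⟦ + 1 ⟧ + ⟦ + 2 ⟧ * w n) ≈ ⟦ + 1 ⟧
    p-inverse n = begin
      p n * (⟦ + 1 ⟧ + ⟦ + 2 ⟧ * w n)
        ≈⟨ solve 2 (λ t w → (con (+ 1) :- con (+ 2) :* t) :* (con (+ 1) :+ con (+ 2) :* w) :=
             con (+ 1) :+ con (+ 2) :* (w :- t) :- con (+ 2) :* (con (+ 2) :* (w :* t))) (t n) (w n) ⟩
      ⟦ + 1 ⟧ + ⟦ + 2 ⟧ * (w n - t n) - ⟦ + 2 ⟧ * (⟦ + 2 ⟧ * (w n * t n))
        ≈⟨ +-congˡ (-‿cong (*-congˡ (halving n))) ⟩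
      ⟦ + 1 ⟧ + ⟦ + 2 ⟧ * (w n - t n) - ⟦ + 2 ⟧ * (w n - t n)
        ≈⟨ solve 1 (λ x → con (+ 1) :+ con (+ 2) :* x :- con (+ 2) :* x := con (+ 1)) _ ⟩
      ⟦ + 1 ⟧ ∎

    PV : ∀ n → P n * V n ≈ ⟦ + 1 ⟧
    PV zero    = solve 0 (con (+ 1) :* con (+ 1) := con (+ 1))
    PV (suc n) = begin
      P n * p n * (V n * (⟦ + 1 ⟧ + ⟦ + 2 ⟧ * w n))
        ≈⟨ solve 4 (λ a b c d → a :* b :* (c :* d) := a :* c :* (b :* d)) _ _ _ _ ⟩
      P n * V n * (p n * (⟦ + 1 ⟧ + ⟦ + 2 ⟧ * w n))
        ≈⟨ *-cong (PV n) (p-inverse n) ⟩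
      ⟦ + 1 ⟧ * ⟦ + 1 ⟧  ≈⟨ solve 0 (con (+ 1) :* con (+ 1) := con (+ 1)) ⟩
      ⟦ + 1 ⟧ ∎

    -- This is 2 (-1)ᵐ / ((1 + qᵐ) P m), the value 1 at m = 0 being consistent since 1 + q⁰ = 2.
    c : ℕ → Carrier
    c zero    = ⟦ + 1 ⟧
    c (suc i) = ⟦ + 2 ⟧ * s i * (⟦ + 1 ⟧ - t i) * V (suc i)

    c-times-1+Q : ∀ m → c m * (⟦ + 1 ⟧ + Q m) ≈ ⟦ + 2 ⟧ * σ m * V m
    c-times-1+Q zero = trans (*-congˡ (+-congˡ Q-0))
      (solve 0 (con (+ 1) :* (con (+ 1) :+ con (+ 1)) := con (+ 2) :* con (+ 1) :* con (+ 1)))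
    c-times-1+Q (suc i) = begin
      ⟦ + 2 ⟧ * s i * (⟦ + 1 ⟧ - t i) * V (suc i) * (⟦ + 1 ⟧ + Q (suc i))
        ≈⟨ solve 4 (λ s u v x → con (+ 2) :* s :* u :* v :* x := con (+ 2) :* s :* v :* (x :* u)) (s i) _ _ _ ⟩
      ⟦ + 2 ⟧ * s i * V (suc i) * ((⟦ + 1 ⟧ + Q (suc i)) * (⟦ + 1 ⟧ - t i))
        ≈⟨ *-congˡ (1-t i) ⟩
      ⟦ + 2 ⟧ * s i * V (suc i) * ⟦ + 1 ⟧  ≈⟨ solve 1 (λ a → a :* con (+ 1) := a) _ ⟩
      ⟦ + 2 ⟧ * s i * V (suc i) ∎

    c-times-1-Q : ∀ i → c (suc i) * (⟦ + 1 ⟧ - Q (suc i)) ≈ - (⟦ + 2 ⟧ * σ i * V i)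
    c-times-1-Q i = begin
      ⟦ + 2 ⟧ * s i * (⟦ + 1 ⟧ - t i) * (V i * (⟦ + 1 ⟧ + ⟦ + 2 ⟧ * w i)) * (⟦ + 1 ⟧ - Q (suc i))
        ≈⟨ solve 5 (λ s t v w x → con (+ 2) :* s :* (con (+ 1) :- t) :* (v :* w) :* (con (+ 1) :- x) :=
             con (+ 2) :* s :* v :* ((con (+ 1) :- t :- x :* (con (+ 1) :- t)) :* w)) (s i) (t i) (V i) _ _ ⟩
      ⟦ + 2 ⟧ * s i * V i * ((⟦ + 1 ⟧ - t i - Q (suc i) * (⟦ + 1 ⟧ - t i)) * (⟦ + 1 ⟧ + ⟦ + 2 ⟧ * w i))
        ≈⟨ *-congˡ (trans (*-congʳ (trans (+-congˡ (-‿cong (sym (t-eq i))))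
             (solve 1 (λ t → con (+ 1) :- t :- t := con (+ 1) :- con (+ 2) :* t) (t i)))) (p-inverse i)) ⟩
      ⟦ + 2 ⟧ * s i * V i * ⟦ + 1 ⟧
        ≈⟨ *-congʳ (*-congʳ (*-congˡ (σ-suc i))) ⟩
      ⟦ + 2 ⟧ * - σ i * V i * ⟦ + 1 ⟧
        ≈⟨ solve 2 (λ s v → con (+ 2) :* :- s :* v :* con (+ 1) := :- (con (+ 2) :* s :* v)) _ _ ⟩
      - (⟦ + 2 ⟧ * σ i * V i) ∎

    -- Each summand with r > 0 is a difference of consecutive right sides. The factor 1 + qʳ turns c
    -- r into 2 σ r V r, the new right side, while 1 - qʳ turns it into - 2 σ (r - 1) V (r - 1),
    -- which removes the old one.
    telescope : ∀ n m →
      ∑ (suc m) (λ r → c r * (p n * Q (r ℕ.* suc (suc n)) - Q (r ℕ.* suc n))) ≈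
      - ((⟦ + 1 ⟧ - t n) * (⟦ + 2 ⟧ * σ m * V m * Q (suc m ℕ.* suc n)))
    telescope n zero = begin
      ⟦ + 1 ⟧ * (p n * Q 0 - Q 0) + 0#
        ≈⟨ trans (+-identityʳ _) (*-congˡ (+-cong (*-congˡ Q-0) (-‿cong Q-0))) ⟩
      ⟦ + 1 ⟧ * (p n * ⟦ + 1 ⟧ - ⟦ + 1 ⟧)
        ≈⟨ solve 1 (λ t → con (+ 1) :* ((con (+ 1) :- con (+ 2) :* t) :* con (+ 1) :- con (+ 1)) := :- (con (+ 2) :* t)) (t n) ⟩
      - (⟦ + 2 ⟧ * t n)
        ≈⟨ -‿cong (*-congˡ (t-eq n)) ⟩
      - (⟦ + 2 ⟧ * (Q (suc n) * (⟦ + 1 ⟧ - t n)))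
        ≈⟨ solve 2 (λ x u → :- (con (+ 2) :* (x :* u)) := :- (u :* (con (+ 2) :* con (+ 1) :* con (+ 1) :* x))) _ _ ⟩
      - ((⟦ + 1 ⟧ - t n) * (⟦ + 2 ⟧ * ⟦ + 1 ⟧ * ⟦ + 1 ⟧ * Q (suc n)))
        ≈⟨ -‿cong (*-congˡ (*-congˡ (reflexive (≡.cong (Q ∘ suc) (≡.sym (ℕ.+-identityʳ n)))))) ⟩
      - ((⟦ + 1 ⟧ - t n) * (⟦ + 2 ⟧ * ⟦ + 1 ⟧ * ⟦ + 1 ⟧ * Q (suc n ℕ.+ 0))) ∎
    telescope n (suc m) = begin
      ∑ (suc (suc m)) f  ≈⟨ ∑-snoc (suc m) f ⟩
      ∑ (suc m) f + f (suc m)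
        ≈⟨ +-cong (telescope n m) term ⟩
      - (u * (⟦ + 2 ⟧ * σ m * V m * y)) +
      - (u * (c (suc m) * (⟦ + 1 ⟧ - Q (suc m)) * y + c (suc m) * (⟦ + 1 ⟧ + Q (suc m)) * Q (suc (suc m) ℕ.* suc n)))
        ≈⟨ +-congˡ (-‿cong (*-congˡ (+-cong (*-congʳ (c-times-1-Q m)) (*-congʳ (c-times-1+Q (suc m)))))) ⟩
      - (u * (⟦ + 2 ⟧ * σ m * V m * y)) +
      - (u * (- (⟦ + 2 ⟧ * σ m * V m) * y + ⟦ + 2 ⟧ * σ (suc m) * V (suc m) * Q (suc (suc m) ℕ.* suc n)))
        ≈⟨ solve 4 (λ u a y b → :- (u :* (a :* y)) :+ :- (u :* (:- a :* y :+ b)) := :- (u :* b)) u _ y _ ⟩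
      - (u * (⟦ + 2 ⟧ * σ (suc m) * V (suc m) * Q (suc (suc m) ℕ.* suc n))) ∎
      where
      f : ℕ → Carrier
      f r = c r * (p n * Q (r ℕ.* suc (suc n)) - Q (r ℕ.* suc n))
      u = ⟦ + 1 ⟧ - t n
      y = Q (suc m ℕ.* suc n)
      x = Q (suc n)
      z = Q (suc m)
      shift : Q (suc m ℕ.* suc (suc n)) ≈ z * y
      shift = trans (reflexive (≡.cong Q (ℕ.*-suc (suc m) (suc n)))) (Q-+ (suc m) (suc m ℕ.* suc n))
      p≈ : p n ≈ u * (⟦ + 1 ⟧ - x)
      p≈ = begin
        ⟦ + 1 ⟧ - ⟦ + 2 ⟧ * t n  ≈⟨ solve 1 (λ t → con (+ 1) :- con (+ 2) :* t := con (+ 1) :- t :- t) (t n) ⟩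
        u - t n  ≈⟨ +-congˡ (-‿cong (t-eq n)) ⟩
        u - x * u  ≈⟨ solve 2 (λ u x → u :- x :* u := u :* (con (+ 1) :- x)) u x ⟩
        u * (⟦ + 1 ⟧ - x) ∎
      term : f (suc m) ≈ - (u * (c (suc m) * (⟦ + 1 ⟧ - z) * y + c (suc m) * (⟦ + 1 ⟧ + z) * Q (suc (suc m) ℕ.* suc n)))
      term = begin
        c (suc m) * (p n * Q (suc m ℕ.* suc (suc n)) - y)
          ≈⟨ *-congˡ (+-cong (*-cong p≈ shift)
               (-‿cong (trans (solve 1 (λ y → y := con (+ 1) :* y) y) (*-congʳ (sym (1-t n)))))) ⟩
        c (suc m) * (u * (⟦ + 1 ⟧ - x) * (z * y) - (⟦ + 1 ⟧ + x) * u * y)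
          ≈⟨ solve 5 (λ c u x y z → c :* (u :* (con (+ 1) :- x) :* (z :* y) :- (con (+ 1) :+ x) :* u :* y) :=
               :- (u :* (c :* (con (+ 1) :- z) :* y :+ c :* (con (+ 1) :+ z) :* (x :* y)))) (c (suc m)) u x y z ⟩
        - (u * (c (suc m) * (⟦ + 1 ⟧ - z) * y + c (suc m) * (⟦ + 1 ⟧ + z) * (x * y)))
          ≈⟨ -‿cong (*-congˡ (+-congˡ (*-congˡ (sym (Q-+ (suc n) (suc m ℕ.* suc n)))))) ⟩
        - (u * (c (suc m) * (⟦ + 1 ⟧ - z) * y + c (suc m) * (⟦ + 1 ⟧ + z) * Q (suc (suc m) ℕ.* suc n))) ∎

    -- Shanks' finite form of Gauss' product for ϑ₃(0,-q).
    shanks : ∀ n → P n * ∑ (suc n) (λ r → c r * Q (r ℕ.* suc n)) ≈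
      ⟦ + 1 ⟧ + ⟦ + 2 ⟧ * ∑ n (λ i → s i * Q (suc i ℕ.* suc i))
    shanks zero = trans (*-congˡ (trans (+-identityʳ _) (*-congˡ Q-0)))
      (trans (solve 0 (con (+ 1) :* (con (+ 1) :* con (+ 1)) := con (+ 1) :+ con (+ 2) :* con (+ 0))) (+-congˡ (*-congˡ 0-homo)))
    shanks (suc n) = begin
      P n * p n * ∑ (suc (suc n)) (λ r → c r * Q (r ℕ.* suc (suc n)))
        ≈⟨ *-congˡ (∑-snoc (suc n) h) ⟩
      P n * p n * (∑ (suc n) (λ r → c r * Q (r ℕ.* suc (suc n))) + c (suc n) * Q (suc n ℕ.* suc (suc n)))
        -- P n * S, with S the sum for n, is added and subtracted. The difference of the two sums is
        -- evaluated by `telescope`; together with the new summand r = n + 1 it gives the next term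
        -- of theta, because (1 + qⁿ⁺¹) u = 1.
        ≈⟨ solve 5 (λ a b x y z → a :* b :* (x :+ y) := a :* z :+ a :* (b :* x :+ con -[1+ 0 ] :* z) :+ a :* b :* y) (P n) (p n) (∑ (suc n) h) _ S ⟩
      P n * S + P n * (p n * ∑ (suc n) (λ r → c r * Q (r ℕ.* suc (suc n))) + ⟦ -[1+ 0 ] ⟧ * S) +
        P n * p n * (c (suc n) * Q (suc n ℕ.* suc (suc n)))
        ≈⟨ +-cong (+-cong (shanks n) (*-congˡ (trans (sym (∑-lin₂ (suc n) (p n) h ⟦ -[1+ 0 ] ⟧ h′))
             (trans (∑-cong (suc n) (λ r → solve 4 (λ p c x y → p :* (c :* x) :+ con -[1+ 0 ] :* (c :* y) := c :* (p :* x :- y)) (p n) (c r) (Q (r ℕ.* suc (suc n))) (Q (r ℕ.* suc n))))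
               (telescope n n))))) last ⟩
      (⟦ + 1 ⟧ + ⟦ + 2 ⟧ * ∑ n g) + P n * - (u * (⟦ + 2 ⟧ * σ n * V n * y)) + ⟦ + 2 ⟧ * s n * u * (Q (suc n) * y)
        ≈⟨ +-congʳ (+-congˡ (trans (solve 5 (λ a u s v y → a :* :- (u :* (con (+ 2) :* s :* v :* y)) := con (+ 2) :* :- s :* (u :* y) :* (a :* v)) (P n) u (σ n) (V n) y)
             (*-cong (*-congʳ (*-congˡ (sym (σ-suc n)))) (PV n)))) ⟩
      (⟦ + 1 ⟧ + ⟦ + 2 ⟧ * ∑ n g) + ⟦ + 2 ⟧ * s n * (u * y) * ⟦ + 1 ⟧ + ⟦ + 2 ⟧ * s n * u * (Q (suc n) * y)
        ≈⟨ solve 5 (λ a s u y x → (con (+ 1) :+ con (+ 2) :* a) :+ con (+ 2) :* s :* (u :* y) :* con (+ 1) :+ con (+ 2) :* s :* u :* (x :* y) :=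
             con (+ 1) :+ con (+ 2) :* (a :+ s :* y :* ((con (+ 1) :+ x) :* u))) (∑ n g) (s n) u y (Q (suc n)) ⟩
      ⟦ + 1 ⟧ + ⟦ + 2 ⟧ * (∑ n g + s n * y * ((⟦ + 1 ⟧ + Q (suc n)) * u))
        ≈⟨ +-congˡ (*-congˡ (+-congˡ (trans (*-congˡ (1-t n)) (solve 1 (λ a → a :* con (+ 1) := a) _)))) ⟩
      ⟦ + 1 ⟧ + ⟦ + 2 ⟧ * (∑ n g + g n)
        ≈⟨ +-congˡ (*-congˡ (sym (∑-snoc n g))) ⟩
      ⟦ + 1 ⟧ + ⟦ + 2 ⟧ * ∑ (suc n) g ∎
      where
      g : ℕ → Carrier
      g i = s i * Q (suc i ℕ.* suc i)
      h h′ : ℕ → Carrier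
      h r = c r * Q (r ℕ.* suc (suc n))
      h′ r = c r * Q (r ℕ.* suc n)
      S = ∑ (suc n) h′
      u = ⟦ + 1 ⟧ - t n
      y = Q (suc n ℕ.* suc n)
      last : P n * p n * (c (suc n) * Q (suc n ℕ.* suc (suc n))) ≈ ⟦ + 2 ⟧ * s n * u * (Q (suc n) * y)
      last = begin
        P n * p n * (⟦ + 2 ⟧ * s n * u * V (suc n) * Q (suc n ℕ.* suc (suc n)))
          ≈⟨ solve 5 (λ a s u v x → a :* (con (+ 2) :* s :* u :* v :* x) := con (+ 2) :* s :* u :* x :* (a :* v)) (P (suc n)) (s n) u (V (suc n)) _ ⟩
        ⟦ + 2 ⟧ * s n * u * Q (suc n ℕ.* suc (suc n)) * (P (suc n) * V (suc n))
          ≈⟨ *-cong (*-congˡ (trans (reflexive (≡.cong Q (ℕ.*-suc (suc n) (suc n)))) (Q-+ (suc n) (suc n ℕ.* suc n)))) (PV (suc n)) ⟩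
        ⟦ + 2 ⟧ * s n * u * (Q (suc n) * y) * ⟦ + 1 ⟧  ≈⟨ solve 1 (λ a → a :* con (+ 1) := a) _ ⟩
        ⟦ + 2 ⟧ * s n * u * (Q (suc n) * y) ∎

    -- Every summand of `shanks` with r > 0 is divisible by qᴺ⁺¹, so only r = 0 survives modulo qᴺ.
    gauss : P N ≈ ⟦ + 1 ⟧ + ⟦ + 2 ⟧ * ∑ N (λ i → s i * Q (suc i ℕ.* suc i))
    gauss = trans (sym (begin
      P N * (⟦ + 1 ⟧ * Q 0 + ∑ N (λ r → c (suc r) * Q (suc r ℕ.* suc N)))
        ≈⟨ *-congˡ (+-cong (*-congˡ Q-0) (trans (∑-0 N (λ r → trans (*-congˡ (Q-vanish _
             (ℕ.≤-trans (ℕ.n≤1+n N) (ℕ.m≤m+n (suc N) (r ℕ.* suc N))))) (zeroʳ _))) (sym 0-homo))) ⟩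
      P N * (⟦ + 1 ⟧ * ⟦ + 1 ⟧ + ⟦ + 0 ⟧)
        ≈⟨ solve 1 (λ a → a :* (con (+ 1) :* con (+ 1) :+ con (+ 0)) := a) _ ⟩
      P N ∎)) (shanks N)

    -- `D` is the Euler operator q d/dq.
    record IsEuler (D : Carrier → Carrier) : Set where
      field
        D-cong  : ∀ {a b} → a ≈ b → D a ≈ D b
        D-+     : ∀ a b → D (a + b) ≈ D a + D b
        leibniz : ∀ a b → D (a * b) ≈ D a * b + a * D b
        D-const : ∀ z → D ⟦ z ⟧ ≈ ⟦ + 0 ⟧
        D-Q     : ∀ m → D (Q m) ≈ ⟦ + m ⟧ * Q m

    module Euler {D : Carrier → Carrier} (euler : IsEuler D) where

      open IsEuler euler

      D-scale : ∀ z a → D (⟦ z ⟧ * a) ≈ ⟦ z ⟧ * D a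
      D-scale z a = trans (leibniz _ _) (trans (+-congʳ (*-congʳ (D-const z)))
        (solve 3 (λ z a d → con (+ 0) :* a :+ z :* d := z :* d) ⟦ z ⟧ a (D a)))

      D-neg : ∀ a → D (- a) ≈ - D a
      D-neg a = trans (D-cong (solve 1 (λ a → :- a := con -[1+ 0 ] :* a) a))
        (trans (D-scale -[1+ 0 ] a) (solve 1 (λ a → con -[1+ 0 ] :* a := :- a) _))

      D-∑ : ∀ n f → D (∑ n f) ≈ ∑ n (D ∘ f)
      D-∑ zero    f = trans (D-cong (sym 0-homo)) (trans (D-const (+ 0)) 0-homo)
      D-∑ (suc n) f = trans (D-+ _ _) (+-congˡ (D-∑ n (f ∘ suc)))

      D-s : ∀ i a → D (s i * a) ≈ s i * D a
      D-s zero    a = trans (D-cong (solve 1 (λ a → :- con (+ 1) :* a := con -[1+ 0 ] :* a) a))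
        (trans (D-scale _ _) (solve 1 (λ a → con -[1+ 0 ] :* a := :- con (+ 1) :* a) _))
      D-s (suc i) a = trans (D-cong (solve 2 (λ s a → :- s :* a := :- (s :* a)) (s i) a))
        (trans (D-neg _) (trans (-‿cong (D-s i a)) (solve 2 (λ s a → :- (s :* a) := :- s :* a) (s i) _)))

      -- With x = qᵃ this is the derivative a x/(1 + x)² of x/(1 + x). It is obtained by
      -- differentiating `t-eq` and multiplying by the inverse 1 - t(a) of 1 + x.
      D-t : ∀ i → D (t i) ≈ ν i * (t i * (⟦ + 1 ⟧ - t i))
      D-t i = begin
        D (t i)
          ≈⟨ solve 2 (λ d t → d := d :* con (+ 1)) (D (t i)) (t i) ⟩
        D (t i) * ⟦ + 1 ⟧  ≈⟨ *-congˡ (sym (1-t i)) ⟩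
        D (t i) * ((⟦ + 1 ⟧ + x) * u)
          ≈⟨ solve 3 (λ d x u → d :* ((con (+ 1) :+ x) :* u) := (d :+ x :* d) :* u) (D (t i)) x u ⟩
        (D (t i) + x * D (t i)) * u
          ≈⟨ *-congʳ (+-congʳ (trans (D-cong (t-eq i)) (leibniz x u))) ⟩
        (D x * u + x * D u + x * D (t i)) * u
          ≈⟨ *-congʳ (+-congʳ (+-cong (*-congʳ (D-Q (suc i))) (*-congˡ (trans (D-+ _ _) (+-cong (D-const (+ 1)) (D-neg _)))))) ⟩
        (ν i * x * u + x * (⟦ + 0 ⟧ + - D (t i)) + x * D (t i)) * u
          ≈⟨ solve 4 (λ v x u d → (v :* x :* u :+ x :* (con (+ 0) :+ :- d) :+ x :* d) :* u := v :* (x :* u :* u)) (ν i) x u (D (t i)) ⟩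
        ν i * (x * u * u)  ≈⟨ *-congˡ (*-congʳ (sym (t-eq i))) ⟩
        ν i * (t i * u) ∎
        where
        x = Q (suc i)
        u = ⟦ + 1 ⟧ - t i

      -- The logarithmic derivative of (1 - x)/(1 + x) at x = qᵃ: numerator and denominator
      -- contribute - a w(a) and - a t(a).
      D-p : ∀ k → D (p k) ≈ - (ν k * w k + ν k * t k) * p k
      D-p k = begin
        D (⟦ + 1 ⟧ - ⟦ + 2 ⟧ * t k)
          ≈⟨ trans (D-+ _ _) (+-cong (D-const (+ 1)) (trans (D-neg _) (-‿cong (trans (D-scale (+ 2) (t k)) (*-congˡ (D-t k)))))) ⟩
        ⟦ + 0 ⟧ + - (⟦ + 2 ⟧ * (ν k * (t k * (⟦ + 1 ⟧ - t k))))
          ≈⟨ solve 3 (λ v t w → con (+ 0) :+ :- (con (+ 2) :* (v :* (t :* (con (+ 1) :- t)))) :=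
               :- (v :* w :+ v :* t) :* (con (+ 1) :- con (+ 2) :* t) :- v :* (con (+ 2) :* (w :* t) :- (w :- t))) (ν k) (t k) (w k) ⟩
        - (ν k * w k + ν k * t k) * p k - ν k * (⟦ + 2 ⟧ * (w k * t k) - (w k - t k))
          ≈⟨ +-congˡ (-‿cong (*-congˡ (+-congʳ (halving k)))) ⟩
        - (ν k * w k + ν k * t k) * p k - ν k * ((w k - t k) - (w k - t k))
          ≈⟨ solve 3 (λ a v b → a :- v :* (b :- b) := a) _ (ν k) _ ⟩
        - (ν k * w k + ν k * t k) * p k ∎

      D-P : ∀ n → D (P n) ≈ - ∑ n (λ k → ν k * w k + ν k * t k) * P n
      D-P zero    = trans (D-const (+ 1)) (trans (solve 0 (con (+ 0) := :- con (+ 0) :* con (+ 1))) (*-congʳ (-‿cong 0-homo)))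
      D-P (suc n) = begin
        D (P n * p n)
          ≈⟨ trans (leibniz _ _) (+-cong (*-congʳ (D-P n)) (*-congˡ (D-p n))) ⟩
        - ∑ n e * P n * p n + P n * (- e n * p n)
          ≈⟨ solve 4 (λ a b x y → :- a :* x :* y :+ x :* (:- b :* y) := :- (a :+ b) :* (x :* y)) (∑ n e) (e n) (P n) (p n) ⟩
        - (∑ n e + e n) * (P n * p n)  ≈⟨ *-congʳ (-‿cong (sym (∑-snoc n e))) ⟩
        - ∑ (suc n) e * (P n * p n) ∎
        where
        e : ℕ → Carrier
        e k = ν k * w k + ν k * t k

      private
        open Determinants isLambert parity using (derivative-A₀) renaming (A₀ to A)
        E₂ : Carrier
        E₂ = ⟦ -[1+ 3 ] ⟧ * (W₁ isLambert + T₁ isLambert)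

      D-A : D A ≈ E₂ * A
      D-A = begin
        D (⟦ + 1 ⟧ + ⟦ + 8 ⟧ * X isLambert 1)
          ≈⟨ trans (D-+ _ _) (+-cong (D-const (+ 1)) (trans (D-scale (+ 8) _) (*-congˡ (D-∑ N _)))) ⟩
        ⟦ + 0 ⟧ + ⟦ + 8 ⟧ * ∑ N (λ i → D (s i * ν i ^ 1 * t i))
          ≈⟨ +-congˡ (*-congˡ (∑-cong N (λ i → trans (D-cong (solve 3 (λ s v t → s :* v :^ 1 :* t := s :* (v :* t)) (s i) (ν i) (t i)))
               (trans (D-s i _) (trans (*-congˡ (trans (D-scale (+ suc i) (t i)) (*-congˡ (D-t i))))
                 (solve 3 (λ s v t → s :* (v :* (v :* (t :* (con (+ 1) :- t)))) := s :* v :^ 2 :* t :+ :- (s :* v :^ 2 :* (t :* t))) (s i) (ν i) (t i))))))) ⟩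
        ⟦ + 0 ⟧ + ⟦ + 8 ⟧ * ∑ N (λ i → s i * ν i ^ 2 * t i + - (s i * ν i ^ 2 * (t i * t i)))
          ≈⟨ trans (solve 1 (λ a → con (+ 0) :+ a := a) _) (*-congˡ (trans (∑-+ N _ _) (+-congˡ (∑-neg N _)))) ⟩
        ⟦ + 8 ⟧ * (X isLambert 2 - Z₂ isLambert)
          ≈⟨ derivative-A₀ ⟩
        E₂ * A ∎

      D-P⁴ : D (P N ^ 4) ≈ E₂ * P N ^ 4
      D-P⁴ = begin
        D (P N ^ 4)
          ≈⟨ D-cong (solve 1 (λ x → x :^ 4 := (x :* x) :* (x :* x)) (P N)) ⟩
        D ((P N * P N) * (P N * P N))
          ≈⟨ trans (leibniz _ _) (+-cong (*-congʳ (leibniz _ _)) (*-congˡ (leibniz _ _))) ⟩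
        (D (P N) * P N + P N * D (P N)) * (P N * P N) + (P N * P N) * (D (P N) * P N + P N * D (P N))
          ≈⟨ solve 2 (λ x d → (d :* x :+ x :* d) :* (x :* x) :+ (x :* x) :* (d :* x :+ x :* d) :=
               con (+ 4) :* x :* x :* x :* d) (P N) (D (P N)) ⟩
        ⟦ + 4 ⟧ * P N * P N * P N * D (P N)
          ≈⟨ *-congˡ (trans (D-P N) (*-congʳ (-‿cong (∑-+ N _ _)))) ⟩
        ⟦ + 4 ⟧ * P N * P N * P N * (- (W₁ isLambert + T₁ isLambert) * P N)
          ≈⟨ solve 2 (λ x e → con (+ 4) :* x :* x :* x :* (:- e :* x) := con -[1+ 3 ] :* e :* x :^ 4) (P N) _ ⟩
        E₂ * P N ^ 4 ∎

-- Integer power series modulo a power of q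

module PowerSeries where

  open ≡
  open ≡-Reasoning
  open ℤ-Solver

  Series : Set
  Series = ℕ → ℤ

  infixl 6 _⊕_
  infixl 7 _⊗_

  tail : Series → Series
  tail a n = a (suc n)

  const : ℤ → Series
  const z zero    = z
  const z (suc n) = + 0

  _⊕_ _⊗_ : Series → Series → Series
  (a ⊕ b) n = a n ℤ.+ b n
  (a ⊗ b) zero    = a 0 ℤ.* b 0
  (a ⊗ b) (suc n) = a 0 ℤ.* b (suc n) ℤ.+ (tail a ⊗ b) n

  ⊖_ : Series → Series
  (⊖ a) n = ℤ.- a n

  ⊗-cong : ∀ {a a′ b b′} n → (∀ m → m ℕ.≤ n → a m ≡ a′ m) → (∀ m → m ℕ.≤ n → b m ≡ b′ m) →
    (a ⊗ b) n ≡ (a′ ⊗ b′) n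
  ⊗-cong zero    p q = cong₂ ℤ._*_ (p 0 ℕ.z≤n) (q 0 ℕ.z≤n)
  ⊗-cong (suc n) p q = cong₂ ℤ._+_ (cong₂ ℤ._*_ (p 0 ℕ.z≤n) (q (suc n) ℕ.≤-refl))
    (⊗-cong n (λ m m≤n → p (suc m) (ℕ.s≤s m≤n)) (λ m m≤n → q m (ℕ.m≤n⇒m≤1+n m≤n)))

  ⊗-distribʳ : ∀ a b c n → ((a ⊕ b) ⊗ c) n ≡ (a ⊗ c ⊕ b ⊗ c) n
  ⊗-distribʳ a b c zero    = ℤ.*-distribʳ-+ (c 0) (a 0) (b 0)
  ⊗-distribʳ a b c (suc n) = trans (cong (λ u → (a 0 ℤ.+ b 0) ℤ.* c (suc n) ℤ.+ u) (⊗-distribʳ (tail a) (tail b) c n))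
    (solve 5 (λ a b c x y → (a :+ b) :* c :+ (x :+ y) := (a :* c :+ x) :+ (b :* c :+ y)) refl
      (a 0) (b 0) (c (suc n)) ((tail a ⊗ c) n) ((tail b ⊗ c) n))

  ⊗-scaleˡ : ∀ x a b n → ((λ m → x ℤ.* a m) ⊗ b) n ≡ x ℤ.* (a ⊗ b) n
  ⊗-scaleˡ x a b zero    = ℤ.*-assoc x (a 0) (b 0)
  ⊗-scaleˡ x a b (suc n) = trans (cong (λ u → x ℤ.* a 0 ℤ.* b (suc n) ℤ.+ u) (⊗-scaleˡ x (tail a) b n))
    (solve 4 (λ x a b y → x :* a :* b :+ x :* y := x :* (a :* b :+ y)) refl x (a 0) (b (suc n)) ((tail a ⊗ b) n))

  -- The product peeled from the right factor, whereas its definition peels the left one;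
  -- commutativity is the agreement of the two.
  ⊗-suc′ : ∀ a b n → (a ⊗ b) (suc n) ≡ a (suc n) ℤ.* b 0 ℤ.+ (a ⊗ tail b) n
  ⊗-suc′ a b zero    = ℤ.+-comm (a 0 ℤ.* b 1) (a 1 ℤ.* b 0)
  ⊗-suc′ a b (suc n) = trans (cong (λ u → a 0 ℤ.* b (suc (suc n)) ℤ.+ u) (⊗-suc′ (tail a) b n))
    (solve 3 (λ x y z → x :+ (y :+ z) := y :+ (x :+ z)) refl (a 0 ℤ.* b (suc (suc n)))
      (a (suc (suc n)) ℤ.* b 0) ((tail a ⊗ tail b) n))

  ⊗-comm : ∀ a b n → (a ⊗ b) n ≡ (b ⊗ a) n
  ⊗-comm a b zero    = ℤ.*-comm (a 0) (b 0)
  ⊗-comm a b (suc n) = trans (cong₂ ℤ._+_ (ℤ.*-comm (a 0) (b (suc n))) (⊗-comm (tail a) b n))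
    (sym (⊗-suc′ b a n))

  ⊗-assoc : ∀ a b c n → ((a ⊗ b) ⊗ c) n ≡ (a ⊗ (b ⊗ c)) n
  ⊗-assoc a b c zero    = ℤ.*-assoc (a 0) (b 0) (c 0)
  ⊗-assoc a b c (suc n) = begin
    a 0 ℤ.* b 0 ℤ.* c (suc n) ℤ.+ (tail (a ⊗ b) ⊗ c) n
      ≡⟨ cong (λ u → a 0 ℤ.* b 0 ℤ.* c (suc n) ℤ.+ u) (trans (⊗-distribʳ (λ m → a 0 ℤ.* b (suc m)) (tail a ⊗ b) c n)
           (cong₂ ℤ._+_ (⊗-scaleˡ (a 0) (tail b) c n) (⊗-assoc (tail a) b c n))) ⟩
    a 0 ℤ.* b 0 ℤ.* c (suc n) ℤ.+ (a 0 ℤ.* (tail b ⊗ c) n ℤ.+ (tail a ⊗ (b ⊗ c)) n)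
      ≡⟨ solve 5 (λ a b c x y → a :* b :* c :+ (a :* x :+ y) := a :* (b :* c :+ x) :+ y) refl
           (a 0) (b 0) (c (suc n)) ((tail b ⊗ c) n) ((tail a ⊗ (b ⊗ c)) n) ⟩
    a 0 ℤ.* (b ⊗ c) (suc n) ℤ.+ (tail a ⊗ (b ⊗ c)) n ∎

  ⊗-zeroˡ : ∀ a b n → (∀ m → m ℕ.≤ n → a m ≡ + 0) → (a ⊗ b) n ≡ + 0
  ⊗-zeroˡ a b zero    p = trans (cong (ℤ._* b 0) (p 0 ℕ.z≤n)) (ℤ.*-zeroˡ (b 0))
  ⊗-zeroˡ a b (suc n) p = cong₂ ℤ._+_ (trans (cong (ℤ._* b (suc n)) (p 0 ℕ.z≤n)) (ℤ.*-zeroˡ (b (suc n))))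
    (⊗-zeroˡ (tail a) b n (λ m m≤n → p (suc m) (ℕ.s≤s m≤n)))

  ⊗-const : ∀ z b n → (const z ⊗ b) n ≡ z ℤ.* b n
  ⊗-const z b zero    = refl
  ⊗-const z b (suc n) = trans (cong (λ u → z ℤ.* b (suc n) ℤ.+ u) (⊗-zeroˡ (tail (const z)) b n (λ _ _ → refl)))
    (ℤ.+-identityʳ _)

  infix 4 _≈[_]_
  -- Only equality is truncated, not the series, so one and the same series can be used modulo every
  -- power of q.
  record _≈[_]_ (a : Series) (N : ℕ) (b : Series) : Set where
    constructor agree
    field coefficient : ∀ n → n ℕ.< N → a n ≡ b n
  open _≈[_]_ public

  pointwise : ∀ {N a b} → (∀ n → a n ≡ b n) → a ≈[ N ] b
  pointwise p = agree (λ n _ → p n)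

  truncated : ℕ → CommutativeRing 0ℓ 0ℓ
  truncated N = record
    { Carrier = Series
    ; _≈_ = _≈[ N ]_
    ; _+_ = _⊕_
    ; _*_ = _⊗_
    ; -_ = ⊖_
    ; 0# = const (+ 0)
    ; 1# = const (+ 1)
    ; isCommutativeRing = record
      { isRing = record
        { +-isAbelianGroup = record
          { isGroup = record
            { isMonoid = record
              { isSemigroup = record
                { isMagma = record
                  { isEquivalence = record
                    { refl = pointwise (λ _ → refl)
                    ; sym = λ p → agree (λ n n<N → sym (coefficient p n n<N))
                    ; trans = λ p q → agree (λ n n<N → trans (coefficient p n n<N) (coefficient q n n<N))
                    }
                  ; ∙-cong = λ p q → agree (λ n n<N → cong₂ ℤ._+_ (coefficient p n n<N) (coefficient q n n<N))
                  }
                ; assoc = λ a b c → pointwise (λ n → ℤ.+-assoc (a n) (b n) (c n))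
                }
              ; identity = (λ a → pointwise (zeroˡ a)) , (λ a → pointwise (λ n → trans (ℤ.+-comm (a n) _) (zeroˡ a n)))
              }
            ; inverse = (λ a → pointwise (λ n → trans (ℤ.+-inverseˡ (a n)) (sym (const-0 n)))) ,
                        (λ a → pointwise (λ n → trans (ℤ.+-inverseʳ (a n)) (sym (const-0 n))))
            ; ⁻¹-cong = λ p → agree (λ n n<N → cong ℤ.-_ (coefficient p n n<N))
            }
          ; comm = λ a b → pointwise (λ n → ℤ.+-comm (a n) (b n))
          }
        ; *-cong = λ p q → agree (λ n n<N → ⊗-cong n
            (λ m m≤n → coefficient p m (ℕ.≤-<-trans m≤n n<N)) (λ m m≤n → coefficient q m (ℕ.≤-<-trans m≤n n<N)))
        ; *-assoc = λ a b c → pointwise (⊗-assoc a b c)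
        ; *-identity = (λ a → pointwise (oneˡ a)) , (λ a → pointwise (λ n → trans (⊗-comm a _ n) (oneˡ a n)))
        ; distrib = (λ a b c → pointwise (λ n → trans (⊗-comm a (b ⊕ c) n)
                       (trans (⊗-distribʳ b c a n) (cong₂ ℤ._+_ (⊗-comm b a n) (⊗-comm c a n))))) ,
                    (λ a b c → pointwise (⊗-distribʳ b c a))
        }
      ; *-comm = λ a b → pointwise (⊗-comm a b)
      }
    }
    where
    const-0 : ∀ n → const (+ 0) n ≡ + 0
    const-0 zero    = refl
    const-0 (suc n) = refl
    zeroˡ : ∀ a n → const (+ 0) n ℤ.+ a n ≡ a n
    zeroˡ a n = trans (cong (ℤ._+ a n) (const-0 n)) (ℤ.+-identityˡ (a n))
    oneˡ : ∀ a n → (const (+ 1) ⊗ a) n ≡ a n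
    oneˡ a n = trans (⊗-const (+ 1) a n) (ℤ.*-identityˡ (a n))

  constants : ∀ N → CommutativeRing.rawRing ℤ.+-*-commutativeRing
                    -Raw-AlmostCommutative⟶ fromCommutativeRing (truncated N)
  constants N = record
    { ⟦_⟧ = const
    ; +-homo = λ x y → pointwise λ { zero → refl ; (suc n) → refl }
    ; *-homo = λ x y → pointwise λ n → sym (trans (⊗-const x (const y) n) (lemma x y n))
    ; -‿homo = λ x → pointwise λ { zero → refl ; (suc n) → refl }
    ; 0-homo = pointwise (λ _ → refl)
    ; 1-homo = pointwise (λ _ → refl)
    }
    where
    lemma : ∀ x y n → x ℤ.* const y n ≡ const (x ℤ.* y) n
    lemma x y zero    = refl
    lemma x y (suc n) = ℤ.*-zeroʳ x

-- The theta series and the Lambert series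

module ThetaSeries where

  open PowerSeries

  monomial : ℕ → Series
  monomial zero            = const (+ 1)
  monomial (suc m) zero    = + 0
  monomial (suc m) (suc n) = monomial m n

  scale : ℤ → Series → Series
  scale z a n = z ℤ.* a n

  -- x qᶜ + ε x qᶜ⁺ⁱ⁺¹ + ε² x qᶜ⁺²ⁱ⁺² + …
  progression : ℤ → ℕ → ℤ → ℕ → Series
  progression ε i x zero    zero    = x
  progression ε i x zero    (suc n) = progression ε i (ε ℤ.* x) i n
  progression ε i x (suc c) zero    = + 0
  progression ε i x (suc c) (suc n) = progression ε i x c n

  -- q^(i+1) / (1 - ε q^(i+1))
  lambert : ℤ → ℕ → Series
  lambert ε i = progression ε i (+ 1) (suc i)

  sgn : ℕ → ℤ
  sgn zero    = + 1
  sgn (suc i) = ℤ.- sgn i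

  sumℤ : ℕ → (ℕ → ℤ) → ℤ
  sumℤ zero    f = + 0
  sumℤ (suc n) f = f 0 ℤ.+ sumℤ n (f ∘ suc)

  -- The sum of all x i, provided that x i = O(qⁱ).
  series : (ℕ → Series) → Series
  series x n = sumℤ (suc n) (λ i → x i n)

  uTerm gTerm : ℕ → ℕ → Series
  uTerm s i = scale (+ (suc i ℕ.^ s)) (lambert -[1+ 0 ] i)
  gTerm s i = scale (+ (suc i ℕ.^ s)) (lambert (+ 1) i)

  -- The sign is that of (-q) raised to n², as in the definition of theta at -q; `sgn-square`
  -- reduces it to (-1)ⁿ.
  θTerm : ℕ → Series
  θTerm n = scale (sgn (n ℕ.^ 2)) (monomial (n ℕ.^ 2))

  Uˢ Gˢ : ℕ → Series
  Uˢ s = series (λ i → scale (sgn i) (uTerm s i))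
  Gˢ s = series (λ i → scale (sgn (suc i)) (gTerm s i))

  θ₊ θ₋ θˢ : Series
  θ₊ = series θTerm
  θ₋ = series (θTerm ∘ suc)
  θˢ = θ₊ ⊕ θ₋

  monomial-vanish : ∀ m n → n ℕ.< m → monomial m n ≡ + 0
  monomial-vanish (suc m) zero    _ = ≡.refl
  monomial-vanish (suc m) (suc n) (ℕ.s≤s n<m) = monomial-vanish m n n<m

  monomial-+ : ∀ m k n → monomial (m ℕ.+ k) n ≡ (monomial m ⊗ monomial k) n
  monomial-+ zero    k n = ≡.sym (≡.trans (⊗-const (+ 1) (monomial k) n) (ℤ.*-identityˡ _))
  monomial-+ (suc m) k zero    = ≡.sym (ℤ.*-zeroˡ (monomial k 0))
  monomial-+ (suc m) k (suc n) = ≡.trans (monomial-+ m k n)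
    (≡.sym (≡.trans (≡.cong (ℤ._+ (monomial m ⊗ monomial k) n) (ℤ.*-zeroˡ (monomial k (suc n)))) (ℤ.+-identityˡ _)))

  progression-shift : ∀ ε i x c n → progression ε i x c n ≡ (monomial c ⊗ progression ε i x 0) n
  progression-shift ε i x zero    n = ≡.sym (≡.trans (⊗-const (+ 1) (progression ε i x 0) n) (ℤ.*-identityˡ _))
  progression-shift ε i x (suc c) zero    = ≡.sym (ℤ.*-zeroˡ x)
  progression-shift ε i x (suc c) (suc n) = ≡.trans (progression-shift ε i x c n)
    (≡.sym (≡.trans (≡.cong (ℤ._+ (monomial c ⊗ progression ε i x 0) n) (ℤ.*-zeroˡ (progression ε i x 0 (suc n)))) (ℤ.+-identityˡ _)))

  progression-head : ∀ ε i x n → progression ε i x 0 n ≡ (const x ⊕ progression ε i (ε ℤ.* x) (suc i)) n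
  progression-head ε i x zero    = ≡.sym (ℤ.+-identityʳ x)
  progression-head ε i x (suc n) = ≡.sym (ℤ.+-identityˡ _)

  progression-scale : ∀ ε i y x c n → progression ε i (y ℤ.* x) c n ≡ y ℤ.* progression ε i x c n
  progression-scale ε i y x zero    zero    = ≡.refl
  progression-scale ε i y x zero    (suc n) = ≡.trans
    (≡.cong (λ z → progression ε i z i n) (solve 3 (λ e y x → e :* (y :* x) := y :* (e :* x)) ≡.refl ε y x))
    (progression-scale ε i y (ε ℤ.* x) i n)
    where open ℤ-Solver
  progression-scale ε i y x (suc c) zero    = ≡.sym (ℤ.*-zeroʳ y)
  progression-scale ε i y x (suc c) (suc n) = progression-scale ε i y x c n

  lambert-eq : ∀ ε i n → lambert ε i n ≡ (monomial (suc i) ⊗ (const (+ 1) ⊕ scale ε (lambert ε i))) n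
  lambert-eq ε i n = ≡.trans (progression-shift ε i (+ 1) (suc i) n)
    (⊗-cong n (λ _ _ → ≡.refl) (λ m _ → ≡.trans (progression-head ε i (+ 1) m)
      (≡.cong (λ u → const (+ 1) m ℤ.+ u) (progression-scale ε i ε (+ 1) (suc i) m))))

  lambert-vanish : ∀ ε i n → n ℕ.≤ i → lambert ε i n ≡ + 0
  lambert-vanish ε i n n≤i = ≡.trans (lambert-eq ε i n)
    (⊗-zeroˡ (monomial (suc i)) _ n (λ m m≤n → monomial-vanish (suc i) m (ℕ.s≤s (ℕ.≤-trans m≤n n≤i))))

  sumℤ-extend : ∀ n m f → (∀ k → n ℕ.≤ k → f k ≡ + 0) → sumℤ (n ℕ.+ m) f ≡ sumℤ n f
  sumℤ-extend zero    zero    f van = ≡.refl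
  sumℤ-extend zero    (suc m) f van = ≡.cong₂ ℤ._+_ (van 0 ℕ.z≤n) (sumℤ-extend zero m (f ∘ suc) (λ k _ → van (suc k) ℕ.z≤n))
  sumℤ-extend (suc n) m f van = ≡.cong (λ u → f 0 ℤ.+ u) (sumℤ-extend n m (f ∘ suc) (λ k n≤k → van (suc k) (ℕ.s≤s n≤k)))

  scale-vanish : ∀ z a n → a n ≡ + 0 → scale z a n ≡ + 0
  scale-vanish z a n eq = ≡.trans (≡.cong (z ℤ.*_) eq) (ℤ.*-zeroʳ z)

  θTerm-vanish : ∀ i n → n ℕ.< i → θTerm i n ≡ + 0
  θTerm-vanish (suc i) n n<i = scale-vanish (sgn (suc i ℕ.^ 2)) (monomial (suc i ℕ.^ 2)) n
    (monomial-vanish (suc i ℕ.^ 2) n (ℕ.<-≤-trans n<i (ℕ.m≤m*n (suc i) (suc i ℕ.* 1))))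

  uTerm-vanish : ∀ s i n → n ℕ.< i → uTerm s i n ≡ + 0
  uTerm-vanish s i n n<i = scale-vanish (+ (suc i ℕ.^ s)) (lambert -[1+ 0 ] i) n (lambert-vanish -[1+ 0 ] i n (ℕ.<⇒≤ n<i))

  gTerm-vanish : ∀ s i n → n ℕ.< i → gTerm s i n ≡ + 0
  gTerm-vanish s i n n<i = scale-vanish (+ (suc i ℕ.^ s)) (lambert (+ 1) i) n (lambert-vanish (+ 1) i n (ℕ.<⇒≤ n<i))

  euler : Series → Series
  euler a n = + n ℤ.* a n

  euler-leibniz : ∀ a b n → euler (a ⊗ b) n ≡ (euler a ⊗ b ⊕ a ⊗ euler b) n
  euler-leibniz a b zero = solve 2 (λ a b → con (+ 0) :* (a :* b) := con (+ 0) :* a :* b :+ a :* (con (+ 0) :* b)) ≡.refl (a 0) (b 0)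
    where open ℤ-Solver
  euler-leibniz a b (suc n) = begin
    + suc n ℤ.* (a 0 ℤ.* b (suc n) ℤ.+ (tail a ⊗ b) n)
      ≡⟨ solve 4 (λ n a b x → (con (+ 1) :+ n) :* (a :* b :+ x) :=
           a :* ((con (+ 1) :+ n) :* b) :+ (n :* x :+ x)) ≡.refl (+ n) (a 0) (b (suc n)) ((tail a ⊗ b) n) ⟩
    a 0 ℤ.* (+ suc n ℤ.* b (suc n)) ℤ.+ (+ n ℤ.* (tail a ⊗ b) n ℤ.+ (tail a ⊗ b) n)
      ≡⟨ ≡.cong (λ u → a 0 ℤ.* (+ suc n ℤ.* b (suc n)) ℤ.+ (u ℤ.+ (tail a ⊗ b) n)) (euler-leibniz (tail a) b n) ⟩
    a 0 ℤ.* (+ suc n ℤ.* b (suc n)) ℤ.+ (((euler (tail a) ⊗ b) n ℤ.+ (tail a ⊗ euler b) n) ℤ.+ (tail a ⊗ b) n)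
      ≡⟨ solve 6 (λ x y z w a b → x :+ ((y :+ z) :+ w) := (con (+ 0) :* a :* b :+ (y :+ w)) :+ (x :+ z)) ≡.refl
           (a 0 ℤ.* (+ suc n ℤ.* b (suc n))) ((euler (tail a) ⊗ b) n) ((tail a ⊗ euler b) n) ((tail a ⊗ b) n) (a 0) (b (suc n)) ⟩
    (+ 0 ℤ.* a 0 ℤ.* b (suc n) ℤ.+ ((euler (tail a) ⊗ b) n ℤ.+ (tail a ⊗ b) n)) ℤ.+
    (a 0 ℤ.* (+ suc n ℤ.* b (suc n)) ℤ.+ (tail a ⊗ euler b) n)
      ≡⟨ ≡.cong (λ u → (+ 0 ℤ.* a 0 ℤ.* b (suc n) ℤ.+ u) ℤ.+ (a ⊗ euler b) (suc n))
           (≡.trans (≡.sym (⊗-distribʳ (euler (tail a)) (tail a) b n))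
             (⊗-cong n (λ m _ → solve 2 (λ m x → m :* x :+ x := (con (+ 1) :+ m) :* x) ≡.refl (+ m) (a (suc m))) (λ _ _ → ≡.refl))) ⟩
    (euler a ⊗ b ⊕ a ⊗ euler b) (suc n) ∎
    where
    open ℤ-Solver
    open ≡.≡-Reasoning

  euler-monomial : ∀ m n → euler (monomial m) n ≡ + m ℤ.* monomial m n
  euler-monomial zero    zero    = ≡.refl
  euler-monomial zero    (suc n) = ℤ.*-zeroʳ (+ suc n)
  euler-monomial (suc m) zero    = ≡.sym (ℤ.*-zeroʳ (+ suc m))
  euler-monomial (suc m) (suc n) = ≡.trans (lemma n (monomial m n))
    (≡.trans (≡.cong (ℤ._+ monomial m n) (euler-monomial m n)) (≡.sym (lemma m (monomial m n))))
    where
    open ℤ-Solver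
    lemma : ∀ k x → + suc k ℤ.* x ≡ + k ℤ.* x ℤ.+ x
    lemma k x = solve 2 (λ k x → (con (+ 1) :+ k) :* x := k :* x :+ x) ≡.refl (+ k) x

  -- Comparing coefficients of qⁿ gives n Z n as a sum of products Y k * Z (n - k), and Y 0 = 0
  -- leaves only k > 0. So Z n vanishes by strong induction, ℤ being free of zero divisors.
  linear-ode : ∀ N Y Z → Y 0 ≡ + 0 → Z 0 ≡ + 0 → euler Z ≈[ N ] Y ⊗ Z → Z ≈[ N ] const (+ 0)
  linear-ode N Y Z Y0 Z0 ode = agree λ n n<N → ≡.trans (vanish n n n<N ℕ.≤-refl) (≡.sym (const-0 n))
    where
    const-0 : ∀ n → const (+ 0) n ≡ + 0
    const-0 zero    = ≡.refl
    const-0 (suc n) = ≡.refl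
    vanish : ∀ n m → n ℕ.< N → m ℕ.≤ n → Z m ≡ + 0
    vanish zero    zero _ _ = Z0
    vanish (suc n) m n<N m≤n with ℕ.m≤n⇒m<n∨m≡n m≤n
    ... | inj₁ (ℕ.s≤s m≤n′) = vanish n m (ℕ.<-trans (ℕ.n<1+n n) n<N) m≤n′
    ... | inj₂ ≡.refl = cancel (ℤ.i*j≡0⇒i≡0∨j≡0 (+ suc n) (≡.trans (coefficient ode (suc n) n<N)
        (≡.cong₂ ℤ._+_ (≡.trans (≡.cong (ℤ._* Z (suc n)) Y0) (ℤ.*-zeroˡ (Z (suc n))))
          (≡.trans (⊗-comm (tail Y) Z n) (⊗-zeroˡ Z (tail Y) n (λ k k≤n → vanish n k (ℕ.<-trans (ℕ.n<1+n n) n<N) k≤n))))))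
      where
      cancel : ∀ {x} → (+ suc n ≡ + 0) ⊎ (x ≡ + 0) → x ≡ + 0
      cancel (inj₁ ())
      cancel (inj₂ eq) = eq

  -- The identities modulo qᴺ

  module At (N : ℕ) where

    open Nome (truncated N) (constants N) hiding (zero)

    t w : ℕ → Series
    t = lambert -[1+ 0 ]
    w = lambert (+ 1)

    const⊗ : ∀ z a → ⟦ z ⟧ * a ≈ scale z a
    const⊗ z a = pointwise (⊗-const z a)

    vanish≈0 : ∀ a → (∀ n → n ℕ.< N → a n ≡ + 0) → a ≈ 0#
    vanish≈0 a van = agree λ { zero n<N → van zero n<N ; (suc n) n<N → van (suc n) n<N }

    isNome : IsNome N monomial t w
    isNome = record
      { Q-0 = refl
      ; Q-+ = λ m k → pointwise (monomial-+ m k)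
      ; Q-vanish = λ m N≤m → vanish≈0 _ (λ n n<N → monomial-vanish m n (ℕ.<-≤-trans n<N N≤m))
      ; t-eq = λ i → trans (pointwise (lambert-eq -[1+ 0 ] i)) (*-congˡ {x = monomial (suc i)} (+-congˡ {x = const (+ 1)}
          (trans (sym (const⊗ -[1+ 0 ] (t i))) (solve 1 (λ t → con -[1+ 0 ] :* t := :- t) (t i)))))
      ; w-eq = λ i → trans (pointwise (lambert-eq (+ 1) i)) (*-congˡ {x = monomial (suc i)} (+-congˡ {x = const (+ 1)}
          (trans (sym (const⊗ (+ 1) (w i))) (solve 1 (λ t → con (+ 1) :* t := t) (w i)))))
      }

    t-quotient : ∀ i → t i * (⟦ + 1 ⟧ + monomial (suc i)) ≈ monomial (suc i)
    t-quotient i = begin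
      t i * (⟦ + 1 ⟧ + x)  ≈⟨ solve 2 (λ t x → t :* (con (+ 1) :+ x) := t :+ t :* x) (t i) x ⟩
      t i + t i * x  ≈⟨ +-congʳ (IsNome.t-eq isNome i) ⟩
      x * (⟦ + 1 ⟧ - t i) + t i * x  ≈⟨ solve 2 (λ t x → x :* (con (+ 1) :- t) :+ t :* x := x) (t i) x ⟩
      x ∎
      where x = monomial (suc i)

    w-quotient : ∀ i → w i * (⟦ + 1 ⟧ - monomial (suc i)) ≈ monomial (suc i)
    w-quotient i = begin
      w i * (⟦ + 1 ⟧ - x)  ≈⟨ solve 2 (λ w x → w :* (con (+ 1) :- x) := w :- w :* x) (w i) x ⟩
      w i - w i * x  ≈⟨ +-congʳ (IsNome.w-eq isNome i) ⟩
      x * (⟦ + 1 ⟧ + w i) - w i * x  ≈⟨ solve 2 (λ w x → x :* (con (+ 1) :+ w) :- w :* x := x) (w i) x ⟩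
      x ∎
      where x = monomial (suc i)

    L : IsLambert N t w
    L = isLambert isNome

    open Determinants L (parity isNome)

    ∑-coefficient : ∀ m f n → ∑ m f n ≡ sumℤ m (λ i → f i n)
    ∑-coefficient zero    f zero    = ≡.refl
    ∑-coefficient zero    f (suc n) = ≡.refl
    ∑-coefficient (suc m) f n       = ≡.cong (λ u → f 0 n ℤ.+ u) (∑-coefficient m (f ∘ suc) n)

    -- `series` stops the sum at i = n in the coefficient of qⁿ, whereas `∑` has a fixed length;
    -- below qᴺ the excess terms vanish.
    series≈∑ : ∀ m x → N ℕ.≤ m → (∀ i n → n ℕ.< i → x i n ≡ + 0) → series x ≈ ∑ m x
    series≈∑ m x N≤m van = agree λ n n<N → ≡.sym (≡.trans (∑-coefficient m x n)
      (≡.trans (≡.cong (λ k → sumℤ k (λ i → x i n)) (≡.sym (ℕ.m+[n∸m]≡n (ℕ.≤-trans n<N N≤m))))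
        (sumℤ-extend (suc n) (m ℕ.∸ suc n) (λ i → x i n) (λ k n<k → van k n n<k))))

    s≈sgn : ∀ i → s i ≈ ⟦ sgn (suc i) ⟧
    s≈sgn zero    = solve 0 (:- con (+ 1) := con -[1+ 0 ])
    s≈sgn (suc i) = trans (-‿cong (s≈sgn i)) (sym (-‿homo (sgn (suc i))))

    ν-^ : ∀ i m → ν i ^ m ≈ ⟦ + (suc i ℕ.^ m) ⟧
    ν-^ i zero    = sym 1-homo
    ν-^ i (suc m) = trans (*-congˡ (ν-^ i m)) (trans (sym (*-homo (+ suc i) (+ (suc i ℕ.^ m))))
      (reflexive (≡.cong ⟦_⟧ (≡.sym (ℤ.pos-* (suc i) (suc i ℕ.^ m))))))

    U≈ : ∀ m → Uˢ m ≈ U m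
    U≈ m = trans (series≈∑ N _ ℕ.≤-refl (λ i n n<i → scale-vanish (sgn i) (uTerm m i) n (uTerm-vanish m i n n<i)))
      (trans (∑-cong N (λ i → begin
        scale (sgn i) (uTerm m i)
          ≈⟨ trans (sym (const⊗ (sgn i) _)) (*-congˡ (sym (const⊗ (+ (suc i ℕ.^ m)) (t i)))) ⟩
        ⟦ sgn i ⟧ * (⟦ + (suc i ℕ.^ m) ⟧ * t i)
          ≈⟨ solve 3 (λ s v t → s :* (v :* t) := :- (:- s :* v :* t)) ⟦ sgn i ⟧ ⟦ + (suc i ℕ.^ m) ⟧ (t i) ⟩
        - (- ⟦ sgn i ⟧ * ⟦ + (suc i ℕ.^ m) ⟧ * t i)
          ≈⟨ -‿cong (*-congʳ (*-cong (trans (sym (-‿homo (sgn i))) (sym (s≈sgn i))) (sym (ν-^ i m)))) ⟩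
        - (s i * ν i ^ m * t i) ∎)) (∑-neg N _))

    G≈ : ∀ m → Gˢ m ≈ Y L m
    G≈ m = trans (series≈∑ N _ ℕ.≤-refl (λ i n n<i → scale-vanish (sgn (suc i)) (gTerm m i) n (gTerm-vanish m i n n<i)))
      (∑-cong N (λ i → begin
        scale (sgn (suc i)) (gTerm m i)
          ≈⟨ trans (sym (const⊗ (sgn (suc i)) _)) (*-congˡ (sym (const⊗ (+ (suc i ℕ.^ m)) (w i)))) ⟩
        ⟦ sgn (suc i) ⟧ * (⟦ + (suc i ℕ.^ m) ⟧ * w i)
          ≈⟨ sym (*-assoc _ _ _) ⟩
        ⟦ sgn (suc i) ⟧ * ⟦ + (suc i ℕ.^ m) ⟧ * w i
          ≈⟨ *-congʳ (*-cong (sym (s≈sgn i)) (sym (ν-^ i m))) ⟩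
        s i * ν i ^ m * w i ∎))

    sgn-+ : ∀ m k → sgn (m ℕ.+ k) ≡ sgn m ℤ.* sgn k
    sgn-+ zero    k = ≡.sym (ℤ.*-identityˡ (sgn k))
    sgn-+ (suc m) k = ≡.trans (≡.cong ℤ.-_ (sgn-+ m k)) (ℤ.neg-distribˡ-* (sgn m) (sgn k))

    sgn² : ∀ m → sgn (m ℕ.+ m) ≡ + 1
    sgn² zero    = ≡.refl
    sgn² (suc m) = ≡.trans (≡.cong (ℤ.-_ ∘ sgn) (ℕ.+-suc m m)) (≡.trans (ℤ.neg-involutive _) (sgn² m))

    -- n² ≡ n mod 2, by (m + 1)² = m² + 2m + 1.
    sgn-square : ∀ m → sgn (m ℕ.* m) ≡ sgn m
    sgn-square zero    = ≡.refl
    sgn-square (suc m) = ≡.cong ℤ.-_ (≡.trans (≡.cong (λ k → sgn (m ℕ.+ k)) (ℕ.*-suc m m))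
      (≡.trans (≡.cong sgn (≡.sym (ℕ.+-assoc m m (m ℕ.* m))))
      (≡.trans (sgn-+ (m ℕ.+ m) (m ℕ.* m)) (≡.trans (≡.cong₂ ℤ._*_ (sgn² m) (sgn-square m)) (ℤ.*-identityˡ (sgn m))))))

    θ≈P : θˢ ≈ P isNome N
    θ≈P = trans (+-cong (series≈∑ (suc N) θTerm (ℕ.n≤1+n N) θTerm-vanish)
        (series≈∑ N (θTerm ∘ suc) ℕ.≤-refl (λ i n n<i → θTerm-vanish (suc i) n (ℕ.m≤n⇒m≤1+n n<i))))
      (trans (+-cong (+-cong (trans (sym (const⊗ (+ 1) (monomial 0))) (solve 0 (con (+ 1) :* con (+ 1) := con (+ 1)))) tail-sum) tail-sum)
      (trans (solve 1 (λ x → con (+ 1) :+ x :+ x := con (+ 1) :+ con (+ 2) :* x) _) (sym (gauss isNome))))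
      where
      tail-sum : ∑ N (θTerm ∘ suc) ≈ ∑ N (λ i → s i * monomial (suc i ℕ.* suc i))
      tail-sum = ∑-cong N (λ i → trans
        (reflexive (≡.cong (λ m → scale (sgn m) (monomial m)) (≡.cong (suc i ℕ.*_) (ℕ.*-identityʳ (suc i)))))
        (trans (sym (const⊗ _ _)) (*-congʳ (trans (reflexive (≡.cong ⟦_⟧ (sgn-square (suc i)))) (sym (s≈sgn i))))))

    isEuler : IsEuler isNome euler
    isEuler = record
      { D-cong = λ p → agree (λ n n<N → ≡.cong (+ n ℤ.*_) (coefficient p n n<N))
      ; D-+ = λ a b → pointwise (λ n → ℤ.*-distribˡ-+ (+ n) (a n) (b n))
      ; leibniz = λ a b → pointwise (euler-leibniz a b)
      ; D-const = λ z → pointwise λ { zero → ℤ.*-zeroˡ z ; (suc n) → ℤ.*-zeroʳ (+ suc n) }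
      ; D-Q = λ m → trans (pointwise (euler-monomial m)) (sym (const⊗ (+ m) (monomial m)))
      }

    -- Both sides solve the same linear equation, whose factor `Y₀` has no constant term, and both
    -- have constant term 1. Hence `linear-ode` applies to their difference.
    P⁴≈A₀ : P isNome N ^ 4 ≈ A₀
    P⁴≈A₀ = trans (solve 2 (λ p a → p := (p :- a) :+ a) _ A₀)
      (trans (+-congʳ (linear-ode N Y₀ (P isNome N ^ 4 - A₀) Y₀-0 Z-0 ode)) (+-identityˡ A₀))
      where
      open Euler isNome isEuler
      open IsEuler isEuler
      Y₀ : Series
      Y₀ = ⟦ -[1+ 3 ] ⟧ * (W₁ L + T₁ L)

      ode : euler (P isNome N ^ 4 - A₀) ≈ Y₀ * (P isNome N ^ 4 - A₀)
      ode = trans (D-+ _ _) (trans (+-cong D-P⁴ (trans (D-neg A₀) (-‿cong D-A)))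
        (solve 3 (λ y p a → y :* p :- y :* a := y :* (p :- a)) Y₀ _ A₀))

      ∑-0-coefficient : ∀ m f → (∀ i → f i 0 ≡ + 0) → ∑ m f 0 ≡ + 0
      ∑-0-coefficient zero    f van = ≡.refl
      ∑-0-coefficient (suc m) f van = ≡.cong₂ ℤ._+_ (van 0) (∑-0-coefficient m (f ∘ suc) (van ∘ suc))

      P-0 : ∀ m → P isNome m 0 ≡ + 1
      P-0 zero    = ≡.refl
      P-0 (suc m) = ≡.trans (≡.cong (ℤ._* (p isNome m 0)) (P-0 m)) ≡.refl

      Y₀-0 : Y₀ 0 ≡ + 0
      Y₀-0 = ≡.cong (-[1+ 3 ] ℤ.*_) (≡.cong₂ ℤ._+_
        (∑-0-coefficient N (λ i → ν i * w i) (λ i → ℤ.*-zeroʳ (+ suc i)))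
        (∑-0-coefficient N (λ i → ν i * t i) (λ i → ℤ.*-zeroʳ (+ suc i))))

      Z-0 : (P isNome N ^ 4 - A₀) 0 ≡ + 0
      Z-0 = ≡.cong₂ (λ x y → x ℤ.* (x ℤ.* (x ℤ.* (x ℤ.* + 1))) ℤ.+ ℤ.- (+ 1 ℤ.+ + 8 ℤ.* y)) (P-0 N)
        (∑-0-coefficient N (λ i → s i * ν i ^ 1 * t i) (λ i → ℤ.*-zeroʳ ((s i * ν i ^ 1) 0)))

    θ⁴≈A₀ : θˢ ^ 4 ≈ A₀
    θ⁴≈A₀ = trans (^-congˡ 4 θ≈P) P⁴≈A₀

    determinant-Uˢ : ⟦ + 3 ⟧ * θˢ ^ 16 ≈
      (⟦ + 16 ⟧ * Uˢ 1 - ⟦ + 2 ⟧) * (⟦ + 16 ⟧ * Uˢ 5 - ⟦ + 2 ⟧) -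
      (⟦ + 16 ⟧ * Uˢ 3 + ⟦ + 1 ⟧) * (⟦ + 16 ⟧ * Uˢ 3 + ⟦ + 1 ⟧)
    determinant-Uˢ = begin
      ⟦ + 3 ⟧ * θˢ ^ 16  ≈⟨ *-congˡ (solve 1 (λ x → x :^ 16 := (x :^ 4) :^ 4) θˢ) ⟩
      ⟦ + 3 ⟧ * (θˢ ^ 4) ^ 4  ≈⟨ *-congˡ (^-congˡ 4 θ⁴≈A₀) ⟩
      ⟦ + 3 ⟧ * A₀ ^ 4  ≈⟨ determinant-U ⟩
      _  ≈⟨ sym (+-cong (*-cong (+-congʳ (*-congˡ (U≈ 1))) (+-congʳ (*-congˡ (U≈ 5))))
              (-‿cong (*-cong (+-congʳ (*-congˡ (U≈ 3))) (+-congʳ (*-congˡ (U≈ 3)))))) ⟩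
      (⟦ + 16 ⟧ * Uˢ 1 - ⟦ + 2 ⟧) * (⟦ + 16 ⟧ * Uˢ 5 - ⟦ + 2 ⟧) -
      (⟦ + 16 ⟧ * Uˢ 3 + ⟦ + 1 ⟧) * (⟦ + 16 ⟧ * Uˢ 3 + ⟦ + 1 ⟧) ∎

    determinant-Gˢ : ⟦ + 9 ⟧ * θˢ ^ 24 ≈
      (⟦ + 16 ⟧ * Gˢ 3 + ⟦ + 1 ⟧) * (⟦ + 32 ⟧ * Gˢ 7 + ⟦ + 17 ⟧) -
      (⟦ + 16 ⟧ * Gˢ 5 - ⟦ + 2 ⟧) * (⟦ + 32 ⟧ * Gˢ 5 - ⟦ + 4 ⟧)
    determinant-Gˢ = begin
      ⟦ + 9 ⟧ * θˢ ^ 24  ≈⟨ *-congˡ (solve 1 (λ x → x :^ 24 := (x :^ 4) :^ 6) θˢ) ⟩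
      ⟦ + 9 ⟧ * (θˢ ^ 4) ^ 6  ≈⟨ *-congˡ (^-congˡ 6 θ⁴≈A₀) ⟩
      ⟦ + 9 ⟧ * A₀ ^ 6  ≈⟨ determinant-G ⟩
      _  ≈⟨ sym (+-cong (*-cong (+-congʳ (*-congˡ (G≈ 3))) (+-congʳ (*-congˡ (G≈ 7))))
              (-‿cong (*-cong (+-congʳ (*-congˡ (G≈ 5))) (+-congʳ (*-congˡ (G≈ 5)))))) ⟩
      (⟦ + 16 ⟧ * Gˢ 3 + ⟦ + 1 ⟧) * (⟦ + 32 ⟧ * Gˢ 7 + ⟦ + 17 ⟧) -
      (⟦ + 16 ⟧ * Gˢ 5 - ⟦ + 2 ⟧) * (⟦ + 32 ⟧ * Gˢ 5 - ⟦ + 4 ⟧) ∎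

-- Integers among the rationals, and order

module Numerals where

  open import Data.Rational.Base
  open import Data.Rational.Properties
  import Data.Rational.Unnormalised.Base as ℚᵘ
  import Data.Rational.Unnormalised.Properties as ℚᵘ
  open import Relation.Binary.PropositionalEquality

  abstract
    -- Abstract, to keep the normalisation in z / 1 from unfolding.
    toℚ : ℤ → ℚ
    toℚ z = z / 1

    toℚ-/ : ∀ z → toℚ z ≡ z / 1
    toℚ-/ z = refl

    toℚᵘ-toℚ : ∀ z → toℚᵘ (toℚ z) ℚᵘ.≃ ℚᵘ.mkℚᵘ z 0
    toℚᵘ-toℚ z = toℚᵘ-fromℚᵘ (ℚᵘ.mkℚᵘ z 0)

    toℚ-+ : ∀ x y → toℚ (x ℤ.+ y) ≡ toℚ x + toℚ y
    toℚ-+ x y = toℚᵘ-injective (ℚᵘ.≃-trans (toℚᵘ-toℚ (x ℤ.+ y)) (ℚᵘ.≃-sym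
      (ℚᵘ.≃-trans (toℚᵘ-homo-+ (toℚ x) (toℚ y)) (ℚᵘ.≃-trans (ℚᵘ.+-cong (toℚᵘ-toℚ x) (toℚᵘ-toℚ y))
        (ℚᵘ.*≡* (cong (ℤ._* + 1) (cong₂ ℤ._+_ (ℤ.*-identityʳ x) (ℤ.*-identityʳ y))))))))

    toℚ-* : ∀ x y → toℚ (x ℤ.* y) ≡ toℚ x * toℚ y
    toℚ-* x y = toℚᵘ-injective (ℚᵘ.≃-trans (toℚᵘ-toℚ (x ℤ.* y)) (ℚᵘ.≃-sym
      (ℚᵘ.≃-trans (toℚᵘ-homo-* (toℚ x) (toℚ y)) (ℚᵘ.*-cong (toℚᵘ-toℚ x) (toℚᵘ-toℚ y)))))

    toℚ-neg : ∀ x → toℚ (ℤ.- x) ≡ - toℚ x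
    toℚ-neg x = toℚᵘ-injective (ℚᵘ.≃-trans (toℚᵘ-toℚ (ℤ.- x)) (ℚᵘ.≃-sym
      (ℚᵘ.≃-trans (toℚᵘ-homo‿- (toℚ x)) (ℚᵘ.-‿cong (toℚᵘ-toℚ x)))))

  -- Equal to toℚ, but computing to 0ℚ and 1ℚ.
  literal : ℤ → ℚ
  literal (+ 0) = 0ℚ
  literal (+ 1) = 1ℚ
  literal z     = toℚ z

  abstract
    literal-toℚ : ∀ z → literal z ≡ toℚ z
    literal-toℚ (+ 0)           = refl
    literal-toℚ (+ 1)           = refl
    literal-toℚ (+ suc (suc n)) = refl
    literal-toℚ -[1+ n ]        = refl

    literal-+ : ∀ x y → literal (x ℤ.+ y) ≡ literal x + literal y
    literal-+ x y = trans (literal-toℚ (x ℤ.+ y)) (trans (toℚ-+ x y) (sym (cong₂ _+_ (literal-toℚ x) (literal-toℚ y))))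

    literal-* : ∀ x y → literal (x ℤ.* y) ≡ literal x * literal y
    literal-* x y = trans (literal-toℚ (x ℤ.* y)) (trans (toℚ-* x y) (sym (cong₂ _*_ (literal-toℚ x) (literal-toℚ y))))

    literal-neg : ∀ x → literal (ℤ.- x) ≡ - literal x
    literal-neg x = trans (literal-toℚ (ℤ.- x)) (trans (toℚ-neg x) (cong -_ (sym (literal-toℚ x))))

  integers : CommutativeRing.rawRing ℤ.+-*-commutativeRing
             -Raw-AlmostCommutative⟶ fromCommutativeRing +-*-commutativeRing
  integers = record { ⟦_⟧ = literal ; +-homo = literal-+ ; *-homo = literal-* ; -‿homo = literal-neg
                    ; 0-homo = refl ; 1-homo = refl }

  module Solver = PolynomialSolver +-*-commutativeRing integers
  open Solver using (solve; _:=_; _:+_; _:*_; _:-_; :-_; con)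

  abstract
    difference-≥0 : ∀ {a b} → a ≤ b → 0ℚ ≤ b - a
    difference-≥0 {a} {b} a≤b = subst (_≤ b - a) (+-inverseʳ a) (+-monoˡ-≤ (- a) a≤b)

    from-difference : ∀ {a b} → 0ℚ ≤ b - a → a ≤ b
    from-difference {a} {b} p = subst₂ _≤_ (+-identityˡ a)
      (solve 2 (λ a b → (b :- a) :+ a := b) a b) (+-monoˡ-≤ a p)

    *-≥0 : ∀ {a b} → 0ℚ ≤ a → 0ℚ ≤ b → 0ℚ ≤ a * b
    *-≥0 {a} {b} p q = subst (_≤ a * b) (*-zeroʳ a) (*-monoˡ-≤-nonNeg a {{nonNegative p}} q)

    +-≥0 : ∀ {a b} → 0ℚ ≤ a → 0ℚ ≤ b → 0ℚ ≤ a + b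
    +-≥0 {a} {b} p q = subst (_≤ a + b) (+-identityˡ 0ℚ) (+-mono-≤ p q)

    *-mono-≥0 : ∀ {a b c d} → 0ℚ ≤ a → 0ℚ ≤ d → a ≤ b → c ≤ d → a * c ≤ b * d
    *-mono-≥0 {a} {b} {c} {d} 0≤a 0≤d a≤b c≤d =
      ≤-trans (*-monoˡ-≤-nonNeg a {{nonNegative 0≤a}} c≤d) (*-monoʳ-≤-nonNeg d {{nonNegative 0≤d}} a≤b)

    square-≥0 : ∀ x → 0ℚ ≤ x * x
    square-≥0 x with ≤-total 0ℚ x
    ... | inj₁ 0≤x = *-≥0 0≤x 0≤x
    ... | inj₂ x≤0 = subst (0ℚ ≤_) (solve 1 (λ x → :- x :* :- x := x :* x) x) (*-≥0 0≤-x 0≤-x)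
      where
      0≤-x : 0ℚ ≤ - x
      0≤-x = subst (0ℚ ≤_) (+-identityˡ (- x)) (difference-≥0 x≤0)

    ≤∣∣ : ∀ x → x ≤ ∣ x ∣
    ≤∣∣ x with ≤-total 0ℚ x
    ... | inj₁ 0≤x = ≤-reflexive (sym (0≤p⇒∣p∣≡p 0≤x))
    ... | inj₂ x≤0 = ≤-trans x≤0 (0≤∣p∣ x)

    -≤∣∣ : ∀ x → - x ≤ ∣ x ∣
    -≤∣∣ x = subst (- x ≤_) (∣-p∣≡∣p∣ x) (≤∣∣ (- x))

    ∣∣-square : ∀ x → ∣ x ∣ * ∣ x ∣ ≡ x * x
    ∣∣-square x = trans (sym (∣p*q∣≡∣p∣*∣q∣ x x)) (0≤p⇒∣p∣≡p (square-≥0 x))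

    ∣∣-from-square : ∀ {x r} → 0ℚ ≤ r → x * x ≤ r * r → ∣ x ∣ ≤ r
    ∣∣-from-square {x} {r} 0≤r x²≤r² with ∣ x ∣ ≤? r
    ... | yes p = p
    ... | no ¬p = contradiction x²≤r² (λ x²≤r² → <-irrefl refl (<-≤-trans (begin-strict
        r * r          ≤⟨ *-monoˡ-≤-nonNeg r {{nonNegative 0≤r}} (<⇒≤ r<x) ⟩
        r * ∣ x ∣      <⟨ *-monoˡ-<-pos ∣ x ∣ {{positive (≤-<-trans 0≤r r<x)}} r<x ⟩
        ∣ x ∣ * ∣ x ∣  ≡⟨ ∣∣-square x ⟩
        x * x ∎) x²≤r²))
      where
      open ≤-Reasoning
      r<x : r < ∣ x ∣
      r<x = ≰⇒> ¬p

    0≤½ : 0ℚ ≤ ½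
    0≤½ = <⇒≤ (positive⁻¹ ½)

    0≤1 : 0ℚ ≤ 1ℚ
    0≤1 = <⇒≤ (positive⁻¹ 1ℚ)

    num : ℕ → ℚ
    num zero    = 0ℚ
    num (suc n) = 1ℚ + num n

    num-zero : num 0 ≡ 0ℚ
    num-zero = refl

    num-suc : ∀ n → num (suc n) ≡ 1ℚ + num n
    num-suc n = refl

    num-≥0 : ∀ n → 0ℚ ≤ num n
    num-≥0 zero    = ≤-refl
    num-≥0 (suc n) = +-≥0 0≤1 (num-≥0 n)

    num-+ : ∀ m n → num (m ℕ.+ n) ≡ num m + num n
    num-+ zero    n = sym (+-identityˡ _)
    num-+ (suc m) n = trans (cong (λ u → 1ℚ + u) (num-+ m n)) (sym (+-assoc 1ℚ (num m) (num n)))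

    num-* : ∀ m n → num (m ℕ.* n) ≡ num m * num n
    num-* zero    n = sym (*-zeroˡ (num n))
    num-* (suc m) n = trans (num-+ n (m ℕ.* n)) (trans (cong (λ u → num n + u) (num-* m n))
      (solve 2 (λ m n → n :+ m :* n := (con (+ 1) :+ m) :* n) (num m) (num n)))

    num-mono : ∀ {m n} → m ℕ.≤ n → num m ≤ num n
    num-mono {n = n} ℕ.z≤n = num-≥0 n
    num-mono (ℕ.s≤s p)     = +-monoʳ-≤ 1ℚ (num-mono p)

    num-toℚ : ∀ n → num n ≡ toℚ (+ n)
    num-toℚ zero    = refl
    num-toℚ (suc n) = trans (cong (λ u → 1ℚ + u) (num-toℚ n)) (sym (toℚ-+ (+ 1) (+ n)))

    ∣toℚ∣ : ∀ z → ∣ toℚ z ∣ ≡ num ℤ.∣ z ∣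
    ∣toℚ∣ (+ n)    = trans (cong ∣_∣ (sym (num-toℚ n))) (trans (0≤p⇒∣p∣≡p (num-≥0 n)) refl)
    ∣toℚ∣ -[1+ n ] = trans (cong ∣_∣ (toℚ-neg (+ suc n))) (trans (∣-p∣≡∣p∣ (toℚ (+ suc n))) (∣toℚ∣ (+ suc n)))

-- Geometric decay against polynomial growth

module Rationals where

  open Numerals public
  open Solver using (solve; _:=_; _:+_; _:*_; _:-_; :-_; con)
  open import Data.Rational.Base
  open import Data.Rational.Properties
  import Data.Rational.Unnormalised.Base as ℚᵘ
  import Data.Rational.Unnormalised.Properties as ℚᵘ
  open import Relation.Binary.PropositionalEquality

  infixr 9 _^ᵠ_
  _^ᵠ_ : ℚ → ℕ → ℚ
  r ^ᵠ zero  = 1ℚ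
  r ^ᵠ suc n = r * r ^ᵠ n

  abstract
    ^ᵠ-≥0 : ∀ {r} n → 0ℚ ≤ r → 0ℚ ≤ r ^ᵠ n
    ^ᵠ-≥0 zero    0≤r = 0≤1
    ^ᵠ-≥0 (suc n) 0≤r = *-≥0 0≤r (^ᵠ-≥0 n 0≤r)

    ^ᵠ-mono : ∀ {r s} n → 0ℚ ≤ r → r ≤ s → r ^ᵠ n ≤ s ^ᵠ n
    ^ᵠ-mono zero    0≤r r≤s = ≤-refl
    ^ᵠ-mono (suc n) 0≤r r≤s = *-mono-≥0 0≤r (^ᵠ-≥0 n (≤-trans 0≤r r≤s)) r≤s (^ᵠ-mono n 0≤r r≤s)

    ^ᵠ-* : ∀ r s n → (r * s) ^ᵠ n ≡ r ^ᵠ n * s ^ᵠ n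
    ^ᵠ-* r s zero    = refl
    ^ᵠ-* r s (suc n) = trans (cong (λ u → r * s * u) (^ᵠ-* r s n))
      (solve 4 (λ r s x y → r :* s :* (x :* y) := r :* x :* (s :* y)) r s (r ^ᵠ n) (s ^ᵠ n))

    ^ᵠ-≤1 : ∀ {r} n → 0ℚ ≤ r → r ≤ 1ℚ → r ^ᵠ n ≤ 1ℚ
    ^ᵠ-≤1 {r} n 0≤r r≤1 = ≤-trans (^ᵠ-mono n 0≤r r≤1) (≤-reflexive (one n))
      where
      one : ∀ n → 1ℚ ^ᵠ n ≡ 1ℚ
      one zero    = refl
      one (suc n) = trans (*-identityˡ _) (one n)

    inverse : ∀ {a} → 0ℚ < a → ∃[ b ] (0ℚ < b × b * a ≡ 1ℚ)
    inverse {a} 0<a = 1/ a , positive⁻¹ (1/ a) {{1/pos⇒pos a}} , *-inverseˡ a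
      where
      instance
        a-pos : Positive a
        a-pos = positive 0<a
        a-nonZero : NonZero a
        a-nonZero = pos⇒nonZero a

    -- A rational substitute for the square root of r: for 0 ≤ r < 1 it stays below 1, and its
    -- square is at least r. So rʲ splits into two factors that both decay.
    mean : ℚ → ℚ
    mean r = (1ℚ + r) * ½

    mean-≥0 : ∀ {r} → 0ℚ ≤ r → 0ℚ ≤ mean r
    mean-≥0 0≤r = *-≥0 (+-≥0 0≤1 0≤r) 0≤½

    mean-<1 : ∀ {r} → r < 1ℚ → mean r < 1ℚ
    mean-<1 {r} r<1 = *-monoˡ-<-pos ½ {{_}} (+-monoʳ-< 1ℚ r<1)

    mean-square : ∀ r → r ≤ mean r * mean r
    mean-square r = from-difference (subst (0ℚ ≤_) (begin
      ((1ℚ - r) * ½) * ((1ℚ - r) * ½)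
        ≡⟨ solve 2 (λ r h → ((con (+ 1) :- r) :* h) :* ((con (+ 1) :- r) :* h) :=
             ((con (+ 1) :+ r) :* h) :* ((con (+ 1) :+ r) :* h) :- r :* ((h :+ h) :* (h :+ h))) r ½ ⟩
      mean r * mean r - r * 1ℚ  ≡⟨ cong (λ u → mean r * mean r - u) (*-identityʳ r) ⟩
      mean r * mean r - r ∎) (square-≥0 ((1ℚ - r) * ½)))
      where open ≡-Reasoning

    -- Behind the induction is 1 - rʲ⁺¹ = (1 - r) (1 + r + ... + rʲ), where each of the j + 1
    -- summands is at least rʲ.
    linear-geometric : ∀ {r} → 0ℚ ≤ r → r ≤ 1ℚ → ∀ j → num (suc j) * r ^ᵠ j * (1ℚ - r) ≤ 1ℚ - r ^ᵠ suc j
    linear-geometric {r} 0≤r r≤1 zero = ≤-reflexive (trans (cong (λ u → u * 1ℚ * (1ℚ - r)) (num-suc 0))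
      (trans (cong (λ u → (1ℚ + u) * 1ℚ * (1ℚ - r)) num-zero)
      (solve 1 (λ r → (con (+ 1) :+ con (+ 0)) :* con (+ 1) :* (con (+ 1) :- r) := con (+ 1) :- r :* con (+ 1)) r)))
    linear-geometric {r} 0≤r r≤1 (suc j) = begin
      num (suc (suc j)) * (r * r ^ᵠ j) * (1ℚ - r)
        ≡⟨ cong (λ u → u * (r * r ^ᵠ j) * (1ℚ - r)) (num-suc (suc j)) ⟩
      (1ℚ + num (suc j)) * (r * r ^ᵠ j) * (1ℚ - r)
        ≡⟨ solve 3 (λ r x n → (con (+ 1) :+ n) :* (r :* x) :* (con (+ 1) :- r) :=
             r :* (n :* x :* (con (+ 1) :- r)) :+ r :* x :* (con (+ 1) :- r)) r (r ^ᵠ j) (num (suc j)) ⟩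
      r * (num (suc j) * r ^ᵠ j * (1ℚ - r)) + r * r ^ᵠ j * (1ℚ - r)
        ≤⟨ +-monoˡ-≤ _ (*-monoˡ-≤-nonNeg r {{nonNegative 0≤r}} (linear-geometric 0≤r r≤1 j)) ⟩
      r * (1ℚ - r * r ^ᵠ j) + r * r ^ᵠ j * (1ℚ - r)
        ≤⟨ from-difference (subst (0ℚ ≤_) (solve 2 (λ r x → (con (+ 1) :- r) :* (con (+ 1) :- r :* x) :=
             (con (+ 1) :- r :* (r :* x)) :- (r :* (con (+ 1) :- r :* x) :+ r :* x :* (con (+ 1) :- r))) r (r ^ᵠ j))
             (*-≥0 (difference-≥0 r≤1) (difference-≥0 (^ᵠ-≤1 (suc j) 0≤r r≤1)))) ⟩
      1ℚ - r * (r * r ^ᵠ j) ∎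
      where open ≤-Reasoning

    linear-bounded : ∀ {r} → 0ℚ ≤ r → r < 1ℚ → ∃[ B ] (0ℚ ≤ B × ∀ j → num (suc j) * r ^ᵠ j ≤ B)
    linear-bounded {r} 0≤r r<1 with inverse {1ℚ - r} (subst (_< 1ℚ - r) (+-inverseʳ r) (+-monoˡ-< (- r) r<1))
    ... | g , 0<g , g*≡1 = g , <⇒≤ 0<g , λ j → begin
      num (suc j) * r ^ᵠ j
        ≡⟨ trans (sym (*-identityʳ _)) (cong (λ u → num (suc j) * r ^ᵠ j * u) (sym g*≡1)) ⟩
      num (suc j) * r ^ᵠ j * (g * (1ℚ - r))
        ≡⟨ solve 3 (λ x g d → x :* (g :* d) := g :* (x :* d)) (num (suc j) * r ^ᵠ j) g (1ℚ - r) ⟩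
      g * (num (suc j) * r ^ᵠ j * (1ℚ - r))
        ≤⟨ *-monoˡ-≤-nonNeg g {{nonNegative (<⇒≤ 0<g)}} (≤-trans (linear-geometric 0≤r (<⇒≤ r<1) j)
             (from-difference (subst (0ℚ ≤_) (solve 1 (λ x → x := con (+ 1) :- (con (+ 1) :- x)) (r ^ᵠ suc j)) (^ᵠ-≥0 (suc j) 0≤r)))) ⟩
      g * 1ℚ  ≡⟨ *-identityʳ g ⟩
      g ∎
      where open ≤-Reasoning

    product-bounded : ∀ {r B C} x y m j → 0ℚ ≤ r → 0ℚ ≤ x → 0ℚ ≤ y → 0ℚ ≤ m → r ≤ m * m → 0ℚ ≤ C →
      x * m ^ᵠ j ≤ B → y * m ^ᵠ j ≤ C → x * y * r ^ᵠ j ≤ B * C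
    product-bounded {r} {B} {C} x y m j 0≤r 0≤x 0≤y 0≤m r≤m² 0≤C p q = begin
      x * y * r ^ᵠ j
        ≤⟨ *-monoˡ-≤-nonNeg (x * y) {{nonNegative (*-≥0 0≤x 0≤y)}}
             (≤-trans (^ᵠ-mono j 0≤r r≤m²) (≤-reflexive (^ᵠ-* m m j))) ⟩
      x * y * (m ^ᵠ j * m ^ᵠ j)
        ≡⟨ solve 3 (λ n m x → n :* m :* (x :* x) := n :* x :* (m :* x)) x y (m ^ᵠ j) ⟩
      x * m ^ᵠ j * (y * m ^ᵠ j)
        ≤⟨ *-mono-≥0 (*-≥0 0≤x (^ᵠ-≥0 j 0≤m)) 0≤C p q ⟩
      B * C ∎
      where open ≤-Reasoning

    -- With m = mean r, rʲ is at most mʲ mʲ: one factor absorbs j + 1 by `linear-bounded`, the other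
    -- (j + 1)ᵏ by induction.
    power-bounded : ∀ k {r} → 0ℚ ≤ r → r < 1ℚ → ∃[ B ] (0ℚ ≤ B × ∀ j → num (suc j) ^ᵠ k * r ^ᵠ j ≤ B)
    power-bounded zero    {r} 0≤r r<1 = 1ℚ , 0≤1 , λ j → subst (_≤ 1ℚ) (sym (*-identityˡ _)) (^ᵠ-≤1 j 0≤r (<⇒≤ r<1))
    power-bounded (suc k) {r} 0≤r r<1 =
      let B , 0≤B , p = linear-bounded {mean r} (mean-≥0 0≤r) (mean-<1 r<1)
          C , 0≤C , q = power-bounded k {mean r} (mean-≥0 0≤r) (mean-<1 r<1)
      in B * C , *-≥0 0≤B 0≤C , λ j → product-bounded (num (suc j)) (num (suc j) ^ᵠ k) (mean r) j 0≤r
           (num-≥0 (suc j)) (^ᵠ-≥0 k (num-≥0 (suc j))) (mean-≥0 0≤r) (mean-square r) 0≤C (p j) (q j)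

    archimedean : ∀ x → ∃[ n ] x ≤ num n
    archimedean x@(mkℚ n d-1 _) = ℤ.∣ n ∣ , ≤-trans (≤∣∣ x) (subst (∣ x ∣ ≤_) (sym (num-toℚ ℤ.∣ n ∣))
      (toℚᵘ-cancel-≤ (ℚᵘ.≤-respʳ-≃ (ℚᵘ.≃-sym (toℚᵘ-toℚ (+ ℤ.∣ n ∣)))
        (ℚᵘ.*≤* (ℤ.*-monoˡ-≤-nonNeg (+ ℤ.∣ n ∣) (ℤ.+≤+ (ℕ.s≤s ℕ.z≤n)))))))

    num-suc-pos : ∀ n → 0ℚ < num (suc n)
    num-suc-pos n = subst (0ℚ <_) (sym (num-suc n)) (+-mono-<-≤ (positive⁻¹ 1ℚ) (num-≥0 n))

    null-step : ∀ {r ε B C e N} n → 0ℚ ≤ C → 0ℚ < ε → num (suc n) ^ᵠ 2 * r ^ᵠ n ≤ B → e * ε ≡ 1ℚ →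
      B * C * e ≤ num N → N ℕ.≤ n → num (suc n) * C * r ^ᵠ n ≤ ε
    null-step {r} {ε} {B} {C} {e} n 0≤C 0<ε p eε BCe≤N N≤n =
      *-cancelˡ-≤-pos (num (suc n)) {{positive (num-suc-pos n)}} (begin
      num (suc n) * (num (suc n) * C * r ^ᵠ n)
        ≡⟨ solve 3 (λ n c x → n :* (n :* c :* x) := (n :* (n :* con (+ 1)) :* x) :* c) (num (suc n)) C (r ^ᵠ n) ⟩
      num (suc n) ^ᵠ 2 * r ^ᵠ n * C
        ≤⟨ *-monoʳ-≤-nonNeg C {{nonNegative 0≤C}} p ⟩
      B * C
        ≡⟨ trans (sym (*-identityʳ (B * C))) (trans (cong (λ u → B * C * u) (sym eε)) (sym (*-assoc (B * C) e ε))) ⟩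
      B * C * e * ε
        ≤⟨ *-monoʳ-≤-nonNeg ε {{nonNegative (<⇒≤ 0<ε)}} (≤-trans BCe≤N (num-mono (ℕ.m≤n⇒m≤1+n N≤n))) ⟩
      num (suc n) * ε ∎)
      where open ≤-Reasoning

    -- Since (n + 1)² rⁿ is bounded by some B, the term is at most B C / (n + 1); N is an integer
    -- above B C / ε.
    null : ∀ {r} → 0ℚ ≤ r → r < 1ℚ → ∀ C → 0ℚ ≤ C → ∀ ε → 0ℚ < ε →
      ∃[ N ] (∀ n → N ℕ.≤ n → num (suc n) * C * r ^ᵠ n ≤ ε)
    null {r} 0≤r r<1 C 0≤C ε 0<ε =
      let B , 0≤B , p   = power-bounded 2 {r} 0≤r r<1
          e , 0<e , eε  = inverse {ε} 0<ε
          N , BCe≤N     = archimedean (B * C * e)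
      in N , λ n N≤n → null-step n 0≤C 0<ε (p n) eε BCe≤N N≤n

-- Complex numbers with rational coordinates

module Plane where

  open Rationals
  open import Data.Rational.Base
  open import Data.Rational.Properties
  open import Relation.Binary.PropositionalEquality
  open Solver using (solve; _:=_; _:+_; _:*_; _:-_; :-_; con)

  -- A data type, since η for pairs would let the type checker expand every complex expression.
  data K : Set where
    ⟨_,_⟩ : ℚ → ℚ → K

  infixl 6 _+ᴷ_
  infixl 7 _*ᴷ_
  infix  8 -ᴷ_

  _+ᴷ_ _*ᴷ_ : K → K → K
  ⟨ a , b ⟩ +ᴷ ⟨ c , d ⟩ = ⟨ a + c , b + d ⟩
  ⟨ a , b ⟩ *ᴷ ⟨ c , d ⟩ = ⟨ a * c - b * d , a * d + b * c ⟩

  -ᴷ_ : K → K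
  -ᴷ ⟨ a , b ⟩ = ⟨ - a , - b ⟩

  real : ℚ → K
  real x = ⟨ x , 0ℚ ⟩

  abstract
    *ᴷ-assoc : ∀ x y z → (x *ᴷ y) *ᴷ z ≡ x *ᴷ (y *ᴷ z)
    *ᴷ-assoc ⟨ a , b ⟩ ⟨ c , d ⟩ ⟨ e , f ⟩ = cong₂ ⟨_,_⟩
      (solve 6 (λ a b c d e f → (a :* c :- b :* d) :* e :- (a :* d :+ b :* c) :* f :=
         a :* (c :* e :- d :* f) :- b :* (c :* f :+ d :* e)) a b c d e f)
      (solve 6 (λ a b c d e f → (a :* c :- b :* d) :* f :+ (a :* d :+ b :* c) :* e :=
         a :* (c :* f :+ d :* e) :+ b :* (c :* e :- d :* f)) a b c d e f)

    *ᴷ-comm : ∀ x y → x *ᴷ y ≡ y *ᴷ x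
    *ᴷ-comm ⟨ a , b ⟩ ⟨ c , d ⟩ = cong₂ ⟨_,_⟩
      (solve 4 (λ a b c d → a :* c :- b :* d := c :* a :- d :* b) a b c d)
      (solve 4 (λ a b c d → a :* d :+ b :* c := c :* b :+ d :* a) a b c d)

    *ᴷ-identityˡ : ∀ x → real 1ℚ *ᴷ x ≡ x
    *ᴷ-identityˡ ⟨ a , b ⟩ = cong₂ ⟨_,_⟩
      (solve 2 (λ a b → con (+ 1) :* a :- con (+ 0) :* b := a) a b)
      (solve 2 (λ a b → con (+ 1) :* b :+ con (+ 0) :* a := b) a b)

    *ᴷ-distribʳ : ∀ z x y → (x +ᴷ y) *ᴷ z ≡ x *ᴷ z +ᴷ y *ᴷ z
    *ᴷ-distribʳ ⟨ e , f ⟩ ⟨ a , b ⟩ ⟨ c , d ⟩ = cong₂ ⟨_,_⟩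
      (solve 6 (λ a b c d e f → (a :+ c) :* e :- (b :+ d) :* f := (a :* e :- b :* f) :+ (c :* e :- d :* f)) a b c d e f)
      (solve 6 (λ a b c d e f → (a :+ c) :* f :+ (b :+ d) :* e := (a :* f :+ b :* e) :+ (c :* f :+ d :* e)) a b c d e f)

    real-* : ∀ x y → real (x * y) ≡ real x *ᴷ real y
    real-* x y = cong₂ ⟨_,_⟩ (solve 2 (λ x y → x :* y := x :* y :- con (+ 0) :* con (+ 0)) x y)
      (solve 2 (λ x y → con (+ 0) := x :* con (+ 0) :+ con (+ 0) :* y) x y)

    real-+ : ∀ x y → real (x + y) ≡ real x +ᴷ real y
    real-+ x y = cong (λ u → ⟨ x + y , u ⟩) (sym (+-identityˡ 0ℚ))

    real-neg : ∀ x → real (- x) ≡ -ᴷ real x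
    real-neg x = refl

  plane : CommutativeRing 0ℓ 0ℓ
  plane = record
    { Carrier = K ; _≈_ = _≡_ ; _+_ = _+ᴷ_ ; _*_ = _*ᴷ_ ; -_ = -ᴷ_ ; 0# = real 0ℚ ; 1# = real 1ℚ
    ; isCommutativeRing = record
      { isRing = record
        { +-isAbelianGroup = record
          { isGroup = record
            { isMonoid = record
              { isSemigroup = record
                { isMagma = record { isEquivalence = isEquivalence ; ∙-cong = cong₂ _+ᴷ_ }
                ; assoc = λ { ⟨ a , b ⟩ ⟨ c , d ⟩ ⟨ e , f ⟩ → cong₂ ⟨_,_⟩ (+-assoc a c e) (+-assoc b d f) } }
              ; identity = (λ { ⟨ a , b ⟩ → cong₂ ⟨_,_⟩ (+-identityˡ a) (+-identityˡ b) }) ,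
                           (λ { ⟨ a , b ⟩ → cong₂ ⟨_,_⟩ (+-identityʳ a) (+-identityʳ b) }) }
            ; inverse = (λ { ⟨ a , b ⟩ → cong₂ ⟨_,_⟩ (+-inverseˡ a) (+-inverseˡ b) }) ,
                        (λ { ⟨ a , b ⟩ → cong₂ ⟨_,_⟩ (+-inverseʳ a) (+-inverseʳ b) })
            ; ⁻¹-cong = cong -ᴷ_ }
          ; comm = λ { ⟨ a , b ⟩ ⟨ c , d ⟩ → cong₂ ⟨_,_⟩ (+-comm a c) (+-comm b d) } }
        ; *-cong = cong₂ _*ᴷ_
        ; *-assoc = *ᴷ-assoc
        ; *-identity = *ᴷ-identityˡ , λ x → trans (*ᴷ-comm x (real 1ℚ)) (*ᴷ-identityˡ x)
        ; distrib = (λ x y z → trans (*ᴷ-comm x (y +ᴷ z)) (trans (*ᴷ-distribʳ x y z) (cong₂ _+ᴷ_ (*ᴷ-comm y x) (*ᴷ-comm z x)))) ,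
                    *ᴷ-distribʳ }
      ; *-comm = *ᴷ-comm } }

  real-integers : CommutativeRing.rawRing ℤ.+-*-commutativeRing
                  -Raw-AlmostCommutative⟶ fromCommutativeRing plane
  real-integers = record
    { ⟦_⟧ = real ∘ literal
    ; +-homo = λ x y → trans (cong real (literal-+ x y)) (real-+ (literal x) (literal y))
    ; *-homo = λ x y → trans (cong real (literal-* x y)) (real-* (literal x) (literal y))
    ; -‿homo = λ x → cong real (literal-neg x)
    ; 0-homo = refl ; 1-homo = refl }

  module KSolver = PolynomialSolver plane real-integers
  open KSolver public using () renaming
    (solve to solveᴷ; _:+_ to _:+ᴷ_; _:*_ to _:*ᴷ_; :-_ to :-ᴷ_; _:=_ to _:=ᴷ_; con to conᴷ)

  norm² : K → ℚ
  norm² ⟨ x , y ⟩ = x * x + y * y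

  abstract
    norm²-≥0 : ∀ z → 0ℚ ≤ norm² z
    norm²-≥0 ⟨ x , y ⟩ = +-≥0 (square-≥0 x) (square-≥0 y)

    norm²-* : ∀ z w → norm² (z *ᴷ w) ≡ norm² z * norm² w
    norm²-* ⟨ a , b ⟩ ⟨ c , d ⟩ = solve 4 (λ a b c d →
      (a :* c :- b :* d) :* (a :* c :- b :* d) :+ (a :* d :+ b :* c) :* (a :* d :+ b :* c) :=
      (a :* a :+ b :* b) :* (c :* c :+ d :* d)) a b c d

    norm²-real : ∀ x → norm² (real x) ≡ x * x
    norm²-real x = solve 1 (λ x → x :* x :+ con (+ 0) :* con (+ 0) := x :* x) x

  infix 4 _⊴_
  -- The estimate |z| ≤ r without square roots, since the modulus of z need not be rational.
  record _⊴_ (z : K) (r : ℚ) : Set where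
    constructor bound
    field
      radius-≥0 : 0ℚ ≤ r
      norm-≤    : norm² z ≤ r * r
  open _⊴_ public

  abstract
    ⊴-0 : ∀ {r} → 0ℚ ≤ r → real 0ℚ ⊴ r
    ⊴-0 {r} 0≤r = bound 0≤r (≤-trans (≤-reflexive (trans (norm²-real 0ℚ) (*-zeroˡ 0ℚ))) (*-≥0 0≤r 0≤r))

    ⊴-mono : ∀ {z r s} → z ⊴ r → r ≤ s → z ⊴ s
    ⊴-mono (bound 0≤r p) r≤s = bound (≤-trans 0≤r r≤s) (≤-trans p (*-mono-≥0 0≤r (≤-trans 0≤r r≤s) r≤s r≤s))

    ⊴-real : ∀ {x r} → ∣ x ∣ ≤ r → real x ⊴ r
    ⊴-real {x} {r} p = bound (≤-trans (0≤∣p∣ x) p) (≤-trans (≤-reflexive (trans (norm²-real x) (sym (∣∣-square x))))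
      (*-mono-≥0 (0≤∣p∣ x) (≤-trans (0≤∣p∣ x) p) p p))

    ⊴-* : ∀ {z w r s} → z ⊴ r → w ⊴ s → z *ᴷ w ⊴ r * s
    ⊴-* {z} {w} {r} {s} (bound 0≤r p) (bound 0≤s q) = bound (*-≥0 0≤r 0≤s)
      (≤-trans (≤-reflexive (norm²-* z w)) (≤-trans (*-mono-≥0 (norm²-≥0 z) (*-≥0 0≤s 0≤s) p q)
        (≤-reflexive (solve 2 (λ r s → r :* r :* (s :* s) := r :* s :* (r :* s)) r s))))

    ⊴-neg : ∀ {z r} → z ⊴ r → -ᴷ z ⊴ r
    ⊴-neg {⟨ x , y ⟩} (bound 0≤r p) = bound 0≤r (≤-trans (≤-reflexive
      (solve 2 (λ x y → :- x :* :- x :+ :- y :* :- y := x :* x :+ y :* y) x y)) p)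

    -- The Cauchy-Schwarz inequality, from (a² + b²) (c² + d²) = (a c + b d)² + (a d - b c)².
    inner-≤ : ∀ {a b c d r s} → ⟨ a , b ⟩ ⊴ r → ⟨ c , d ⟩ ⊴ s → a * c + b * d ≤ r * s
    inner-≤ {a} {b} {c} {d} {r} {s} (bound 0≤r p) (bound 0≤s q) = ≤-trans (≤∣∣ _) (∣∣-from-square (*-≥0 0≤r 0≤s)
      (≤-trans (from-difference (subst (0ℚ ≤_)
         (solve 4 (λ a b c d → (a :* d :- b :* c) :* (a :* d :- b :* c) :=
            (a :* a :+ b :* b) :* (c :* c :+ d :* d) :- (a :* c :+ b :* d) :* (a :* c :+ b :* d)) a b c d)
         (square-≥0 (a * d - b * c))))
      (≤-trans (*-mono-≥0 (norm²-≥0 ⟨ a , b ⟩) (*-≥0 0≤s 0≤s) p q)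
        (≤-reflexive (solve 2 (λ r s → r :* r :* (s :* s) := r :* s :* (r :* s)) r s)))))

    ⊴-+ : ∀ {z w r s} → z ⊴ r → w ⊴ s → z +ᴷ w ⊴ r + s
    ⊴-+ {⟨ a , b ⟩} {⟨ c , d ⟩} {r} {s} p q = bound (+-≥0 (radius-≥0 p) (radius-≥0 q)) (begin
      (a + c) * (a + c) + (b + d) * (b + d)
        ≡⟨ solve 4 (λ a b c d → (a :+ c) :* (a :+ c) :+ (b :+ d) :* (b :+ d) :=
             (a :* a :+ b :* b) :+ (c :* c :+ d :* d) :+ ((a :* c :+ b :* d) :+ (a :* c :+ b :* d))) a b c d ⟩
      (a * a + b * b) + (c * c + d * d) + ((a * c + b * d) + (a * c + b * d))
        ≤⟨ +-mono-≤ (+-mono-≤ (norm-≤ p) (norm-≤ q)) (+-mono-≤ (inner-≤ p q) (inner-≤ p q)) ⟩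
      r * r + s * s + (r * s + r * s)
        ≡⟨ solve 2 (λ r s → r :* r :+ s :* s :+ (r :* s :+ r :* s) := (r :+ s) :* (r :+ s)) r s ⟩
      (r + s) * (r + s) ∎)
      where open ≤-Reasoning

    ⊴-re : ∀ {x y r} → ⟨ x , y ⟩ ⊴ r → ∣ x ∣ ≤ r
    ⊴-re {x} {y} (bound 0≤r p) = ∣∣-from-square 0≤r (≤-trans (subst₂ _≤_ (+-identityʳ (x * x)) refl (+-monoʳ-≤ (x * x) (square-≥0 y))) p)

    ⊴-im : ∀ {x y r} → ⟨ x , y ⟩ ⊴ r → ∣ y ∣ ≤ r
    ⊴-im {x} {y} (bound 0≤r p) = ∣∣-from-square 0≤r (≤-trans (subst₂ _≤_ (+-identityˡ (y * y)) refl (+-monoˡ-≤ (y * y) (square-≥0 x))) p)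

    -- The factor z is replaced by its bound ρ inside the scalar. In Horner's scheme the scalar
    -- thereby collects the powers of ρ.
    ⊴-scaled-* : ∀ {κ z w ρ r} → z ⊴ ρ → real (κ * ρ) *ᴷ w ⊴ r → real κ *ᴷ (z *ᴷ w) ⊴ r
    ⊴-scaled-* {κ} {z} {w} {ρ} {r} (bound 0≤ρ p) (bound 0≤r q) = bound 0≤r (begin
      norm² (real κ *ᴷ (z *ᴷ w))
        ≡⟨ trans (norm²-* (real κ) (z *ᴷ w)) (cong₂ _*_ (norm²-real κ) (norm²-* z w)) ⟩
      κ * κ * (norm² z * norm² w)
        ≤⟨ *-monoˡ-≤-nonNeg (κ * κ) {{nonNegative (square-≥0 κ)}} (*-monoʳ-≤-nonNeg (norm² w) {{nonNegative (norm²-≥0 w)}} p) ⟩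
      κ * κ * (ρ * ρ * norm² w)
        ≡⟨ solve 3 (λ k r w → k :* k :* (r :* r :* w) := k :* r :* (k :* r) :* w) κ ρ (norm² w) ⟩
      κ * ρ * (κ * ρ) * norm² w
        ≡⟨ sym (trans (norm²-* (real (κ * ρ)) w) (cong (_* norm² w) (norm²-real (κ * ρ)))) ⟩
      norm² (real (κ * ρ) *ᴷ w)  ≤⟨ q ⟩
      r * r ∎)
      where open ≤-Reasoning

  -- Evaluation of truncated power series, with error bounds

  open PowerSeries
  open ThetaSeries

  -- Horner's rule for the first N coefficients; its recursion on `tail` is the one of `_⊗_`.
  ev : ℕ → Series → K → K
  ev zero    a z = real 0ℚ
  ev (suc N) a z = real (toℚ (a 0)) +ᴷ z *ᴷ ev N (tail a) z

  ev-cong : ∀ N {a b} z → (∀ n → a n ≡ b n) → ev N a z ≡ ev N b z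
  ev-cong zero    z eq = refl
  ev-cong (suc N) z eq = cong₂ (λ x w → real (toℚ x) +ᴷ z *ᴷ w) (eq 0) (ev-cong N z (eq ∘ suc))

  abstract
    ev-⊕ : ∀ N a b z → ev N (a ⊕ b) z ≡ ev N a z +ᴷ ev N b z
    ev-⊕ zero    a b z = sym (CommutativeRing.+-identityˡ plane (real 0ℚ))
    ev-⊕ (suc N) a b z = trans (cong₂ (λ x w → x +ᴷ z *ᴷ w)
        (trans (cong real (toℚ-+ (a 0) (b 0))) (real-+ (toℚ (a 0)) (toℚ (b 0)))) (ev-⊕ N (tail a) (tail b) z))
      (solveᴷ 5 (λ x y z u v → (x :+ᴷ y) :+ᴷ z :*ᴷ (u :+ᴷ v) :=ᴷ (x :+ᴷ z :*ᴷ u) :+ᴷ (y :+ᴷ z :*ᴷ v))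
        (real (toℚ (a 0))) (real (toℚ (b 0))) z (ev N (tail a) z) (ev N (tail b) z))

    ev-scale : ∀ N x a z → ev N (scale x a) z ≡ real (toℚ x) *ᴷ ev N a z
    ev-scale zero    x a z = sym (CommutativeRing.zeroʳ plane (real (toℚ x)))
    ev-scale (suc N) x a z = trans (cong₂ (λ y w → y +ᴷ z *ᴷ w)
        (trans (cong real (toℚ-* x (a 0))) (real-* (toℚ x) (toℚ (a 0)))) (ev-scale N x (tail a) z))
      (solveᴷ 4 (λ x y z u → x :*ᴷ y :+ᴷ z :*ᴷ (x :*ᴷ u) :=ᴷ x :*ᴷ (y :+ᴷ z :*ᴷ u))
        (real (toℚ x)) (real (toℚ (a 0))) z (ev N (tail a) z))

    ev-⊗-suc : ∀ N a b z → ev (suc N) (a ⊗ b) z ≡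
      real (toℚ (a 0)) *ᴷ ev (suc N) b z +ᴷ z *ᴷ ev N (tail a ⊗ b) z
    ev-⊗-suc N a b z = trans (cong₂ (λ y w → y +ᴷ z *ᴷ w)
        (trans (cong real (toℚ-* (a 0) (b 0))) (real-* (toℚ (a 0)) (toℚ (b 0))))
        (trans (ev-⊕ N (scale (a 0) (tail b)) (tail a ⊗ b) z) (cong (_+ᴷ ev N (tail a ⊗ b) z) (ev-scale N (a 0) (tail b) z))))
      (solveᴷ 5 (λ x y z u v → x :*ᴷ y :+ᴷ z :*ᴷ (x :*ᴷ u :+ᴷ v) :=ᴷ x :*ᴷ (y :+ᴷ z :*ᴷ u) :+ᴷ z :*ᴷ v)
        (real (toℚ (a 0))) (real (toℚ (b 0))) z (ev N (tail b) z) (ev N (tail a ⊗ b) z))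

  -- κ keeps the condition stable under `tail`, which replaces κ by κ ρ and M by M σ. The inductions
  -- along Horner's rule rely on this.
  record Dominated (κ M ρ σ : ℚ) (a : Series) : Set where
    constructor dominated
    field term-≤ : ∀ j → κ * ∣ toℚ (a j) ∣ * ρ ^ᵠ j ≤ M * σ ^ᵠ j
  open Dominated public

  -- g is the sum 1/(1 - σ) of the geometric series that dominates.
  module Bounds {z ρ σ g} (z⊴ρ : z ⊴ ρ) (0≤σ : 0ℚ ≤ σ) (0≤g : 0ℚ ≤ g) (g-eq : g * (1ℚ - σ) ≡ 1ℚ) where

    abstract
      dominated-tail : ∀ {κ M a} → Dominated κ M ρ σ a → Dominated (κ * ρ) (M * σ) ρ σ (tail a)
      dominated-tail {κ} {M} {a} dom = dominated λ j → subst₂ _≤_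
        (solve 4 (λ k x r p → k :* x :* (r :* p) := k :* r :* x :* p) κ ∣ toℚ (a (suc j)) ∣ ρ (ρ ^ᵠ j))
        (sym (*-assoc M σ (σ ^ᵠ j))) (term-≤ dom (suc j))

      κρ-≥0 : ∀ {κ} → 0ℚ ≤ κ → 0ℚ ≤ κ * ρ
      κρ-≥0 0≤κ = *-≥0 0≤κ (radius-≥0 z⊴ρ)

      head-bound : ∀ {κ M a} → 0ℚ ≤ κ → Dominated κ M ρ σ a → real κ *ᴷ real (toℚ (a 0)) ⊴ M
      head-bound {κ} {M} {a} 0≤κ dom = subst (_⊴ M) (real-* κ (toℚ (a 0))) (⊴-real (begin
        ∣ κ * toℚ (a 0) ∣        ≡⟨ ∣p*q∣≡∣p∣*∣q∣ κ (toℚ (a 0)) ⟩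
        ∣ κ ∣ * ∣ toℚ (a 0) ∣    ≡⟨ cong (_* ∣ toℚ (a 0) ∣) (0≤p⇒∣p∣≡p 0≤κ) ⟩
        κ * ∣ toℚ (a 0) ∣        ≡⟨ sym (*-identityʳ _) ⟩
        κ * ∣ toℚ (a 0) ∣ * 1ℚ   ≤⟨ term-≤ dom 0 ⟩
        M * 1ℚ                   ≡⟨ *-identityʳ M ⟩
        M ∎))
        where open ≤-Reasoning

      geometric-step : ∀ M → M + M * σ * g ≡ M * g
      geometric-step M = begin
        M + M * σ * g             ≡⟨ cong (_+ M * σ * g) (trans (sym (*-identityʳ M)) (cong (M *_) (sym g-eq))) ⟩
        M * (g * (1ℚ - σ)) + M * σ * g
          ≡⟨ solve 3 (λ m g s → m :* (g :* (con (+ 1) :- s)) :+ m :* s :* g := m :* g) M g σ ⟩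
        M * g ∎
        where open ≡-Reasoning

      ev-bound : ∀ N a {κ M} → 0ℚ ≤ κ → 0ℚ ≤ M → Dominated κ M ρ σ a → real κ *ᴷ ev N a z ⊴ M * g
      ev-bound zero    a {κ} {M} 0≤κ 0≤M dom = subst (_⊴ M * g) (sym (CommutativeRing.zeroʳ plane (real κ))) (⊴-0 (*-≥0 0≤M 0≤g))
      ev-bound (suc N) a {κ} {M} 0≤κ 0≤M dom = subst₂ _⊴_
        (sym (CommutativeRing.distribˡ plane (real κ) (real (toℚ (a 0))) (z *ᴷ ev N (tail a) z)))
        (geometric-step M)
        (⊴-+ (head-bound {a = a} 0≤κ dom)
          (⊴-scaled-* z⊴ρ (ev-bound N (tail a) (κρ-≥0 0≤κ) (*-≥0 0≤M 0≤σ) (dominated-tail {a = a} dom))))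

      ev-difference : ∀ N m a {κ M} → 0ℚ ≤ κ → 0ℚ ≤ M → Dominated κ M ρ σ a →
        real κ *ᴷ (ev (N ℕ.+ m) a z +ᴷ -ᴷ ev N a z) ⊴ M * σ ^ᵠ N * g
      ev-difference zero m a {κ} {M} 0≤κ 0≤M dom = subst₂ _⊴_
        (solveᴷ 2 (λ k x → k :*ᴷ x :=ᴷ k :*ᴷ (x :+ᴷ :-ᴷ conᴷ (+ 0))) (real κ) (ev m a z))
        (cong (_* g) (sym (*-identityʳ M))) (ev-bound m a 0≤κ 0≤M dom)
      ev-difference (suc N) m a {κ} {M} 0≤κ 0≤M dom = subst₂ _⊴_
        (solveᴷ 5 (λ k z x u v → k :*ᴷ (z :*ᴷ (u :+ᴷ :-ᴷ v)) :=ᴷ k :*ᴷ ((x :+ᴷ z :*ᴷ u) :+ᴷ :-ᴷ (x :+ᴷ z :*ᴷ v)))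
          (real κ) z (real (toℚ (a 0))) (ev (N ℕ.+ m) (tail a) z) (ev N (tail a) z))
        (cong (_* g) (*-assoc M σ (σ ^ᵠ N)))
        (⊴-scaled-* z⊴ρ (ev-difference N m (tail a) (κρ-≥0 0≤κ) (*-≥0 0≤M 0≤σ) (dominated-tail {a = a} dom)))

      ev-vanish : ∀ N k a {κ M} → 0ℚ ≤ κ → 0ℚ ≤ M → Dominated κ M ρ σ a → (∀ n → n ℕ.< N → a n ≡ + 0) →
        real κ *ᴷ ev k a z ⊴ M * σ ^ᵠ N * g
      ev-vanish zero    k a {κ} {M} 0≤κ 0≤M dom van = subst (λ u → real κ *ᴷ ev k a z ⊴ u * g) (sym (*-identityʳ M)) (ev-bound k a 0≤κ 0≤M dom)
      ev-vanish (suc N) zero a {κ} {M} 0≤κ 0≤M dom van = subst (_⊴ M * σ ^ᵠ suc N * g) (sym (CommutativeRing.zeroʳ plane (real κ)))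
        (⊴-0 (*-≥0 (*-≥0 0≤M (^ᵠ-≥0 (suc N) 0≤σ)) 0≤g))
      ev-vanish (suc N) (suc k) a {κ} {M} 0≤κ 0≤M dom van = subst₂ _⊴_
        (trans (solveᴷ 3 (λ k z u → k :*ᴷ (z :*ᴷ u) :=ᴷ k :*ᴷ (conᴷ (+ 0) :+ᴷ z :*ᴷ u)) (real κ) z (ev k (tail a) z))
          (cong (λ x → real κ *ᴷ (x +ᴷ z *ᴷ ev k (tail a) z)) (cong real (trans (literal-toℚ (+ 0)) (cong toℚ (sym (van 0 (ℕ.s≤s ℕ.z≤n))))))))
        (cong (_* g) (*-assoc M σ (σ ^ᵠ N)))
        (⊴-scaled-* z⊴ρ (ev-vanish N k (tail a) (κρ-≥0 0≤κ) (*-≥0 0≤M 0≤σ) (dominated-tail {a = a} dom) (λ n n<N → van (suc n) (ℕ.s≤s n<N))))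

      error-split : ∀ k z u v w x y →
        k *ᴷ (z *ᴷ (v +ᴷ -ᴷ (u *ᴷ w))) +ᴷ -ᴷ (k *ᴷ (z *ᴷ u) *ᴷ (real 1ℚ *ᴷ (y +ᴷ -ᴷ w))) ≡
        k *ᴷ ((x *ᴷ y +ᴷ z *ᴷ v) +ᴷ -ᴷ ((x +ᴷ z *ᴷ u) *ᴷ y))
      error-split = solveᴷ 7 (λ k z u v w x y →
        k :*ᴷ (z :*ᴷ (v :+ᴷ :-ᴷ (u :*ᴷ w))) :+ᴷ :-ᴷ (k :*ᴷ (z :*ᴷ u) :*ᴷ (conᴷ (+ 1) :*ᴷ (y :+ᴷ :-ᴷ w))) :=ᴷ
        k :*ᴷ ((x :*ᴷ y :+ᴷ z :*ᴷ v) :+ᴷ :-ᴷ ((x :+ᴷ z :*ᴷ u) :*ᴷ y)))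

      error-radius : ∀ n m m′ p →
        n * (m * σ * m′ * g * g) * p + m * σ * g * (m′ * p * g) ≡ (1ℚ + n) * (m * m′ * g * g) * (σ * p)
      error-radius n m m′ p = solve 6 (λ n m s m′ g p →
            n :* (m :* s :* m′ :* g :* g) :* p :+ m :* s :* g :* (m′ :* p :* g) :=
            (con (+ 1) :+ n) :* (m :* m′ :* g :* g) :* (s :* p)) n m σ m′ g p

      -- Peeling off the constant term of a leaves the same error for `tail a` at N, plus a product
      -- of `tail a` with the difference between b truncated at N + 1 and at N. Each of the N steps
      -- thus costs a multiple of σᴺ, whence the factor `num N`.
      ev-⊗-error : ∀ N a b {κ M M′} → 0ℚ ≤ κ → 0ℚ ≤ M → 0ℚ ≤ M′ → Dominated κ M ρ σ a → Dominated 1ℚ M′ ρ σ b →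
        real κ *ᴷ (ev N (a ⊗ b) z +ᴷ -ᴷ (ev N a z *ᴷ ev N b z)) ⊴ num N * (M * M′ * g * g) * σ ^ᵠ N
      ev-⊗-error zero a b {κ} {M} {M′} 0≤κ 0≤M 0≤M′ dom dom′ = subst (_⊴ num 0 * (M * M′ * g * g) * 1ℚ)
        (solveᴷ 1 (λ k → conᴷ (+ 0) :=ᴷ k :*ᴷ (conᴷ (+ 0) :+ᴷ :-ᴷ (conᴷ (+ 0) :*ᴷ conᴷ (+ 0)))) (real κ))
        (⊴-0 (*-≥0 (*-≥0 (num-≥0 0) (*-≥0 (*-≥0 (*-≥0 0≤M 0≤M′) 0≤g) 0≤g)) 0≤1))
      ev-⊗-error (suc N) a b {κ} {M} {M′} 0≤κ 0≤M 0≤M′ dom dom′ = subst₂ _⊴_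
        (trans (cong (λ n → real κ *ᴷ (z *ᴷ (ev N (tail a ⊗ b) z +ᴷ -ᴷ (ev N (tail a) z *ᴷ ev N b z))) +ᴷ
                  -ᴷ (real κ *ᴷ (z *ᴷ ev N (tail a) z) *ᴷ (real 1ℚ *ᴷ (ev n b z +ᴷ -ᴷ ev N b z)))) (ℕ.+-comm N 1))
          (trans (error-split (real κ) z (ev N (tail a) z) (ev N (tail a ⊗ b) z) (ev N b z) (real (toℚ (a 0))) (ev (suc N) b z))
            (cong (λ p → real κ *ᴷ (p +ᴷ -ᴷ ((real (toℚ (a 0)) +ᴷ z *ᴷ ev N (tail a) z) *ᴷ ev (suc N) b z)))
              (sym (ev-⊗-suc N a b z)))))
        (trans (error-radius (num N) M M′ (σ ^ᵠ N)) (cong (λ n → n * (M * M′ * g * g) * (σ * σ ^ᵠ N)) (sym (num-suc N))))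
        (⊴-+ (⊴-scaled-* z⊴ρ (ev-⊗-error N (tail a) b (κρ-≥0 0≤κ) (*-≥0 0≤M 0≤σ) 0≤M′ (dominated-tail dom) dom′))
             (⊴-neg (⊴-* (⊴-scaled-* z⊴ρ (ev-bound N (tail a) (κρ-≥0 0≤κ) (*-≥0 0≤M 0≤σ) (dominated-tail dom)))
                         (ev-difference N 1 b 0≤1 0≤M′ dom′))))

open import Defs
open import Data.Nat.Base using (NonZero)
open import Data.Rational.Base as ℚ using (ℚ; 0ℚ; 1ℚ; ½; _/_)
import Data.Rational.Properties as ℚ
open import Relation.Binary.PropositionalEquality

-- Complex arithmetic through rational approximations

module ComplexField where

  open Rationals
  open Plane
  open Solver using (solve; _:=_; _:+_; _:*_; _:-_; :-_; con)

  at : ℂ → ℕ → K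
  at z n = ⟨ seq (re z) n , seq (im z) n ⟩

  Eventually : (ℕ → Set) → Set
  Eventually P = ∃[ N ] (∀ n → N ℕ.≤ n → P n)

  infix 4 _≋_
  -- Equality stated with the modulus instead of the two coordinates, so that the calculus of `_⊴_`
  -- applies; `from-≋` returns to `_≈_`.
  record _≋_ (z w : ℂ) : Set where
    constructor close
    field closeness : ∀ ε → 0ℚ ℚ.< ε → Eventually (λ n → at z n +ᴷ -ᴷ at w n ⊴ ε)
  open _≋_ public

  abstract
    half-< : ∀ {ε} → 0ℚ ℚ.< ε → ε ℚ.* ½ ℚ.< ε
    half-< {ε} 0<ε = subst₂ ℚ._<_ (ℚ.+-identityʳ (ε ℚ.* ½)) (half+half ε)
      (ℚ.+-monoʳ-< (ε ℚ.* ½) (half ε 0<ε))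

    both : ∀ {P Q : ℕ → Set} → Eventually P → Eventually Q → Eventually (λ n → P n × Q n)
    both (M , p) (N , q) = M ℕ.⊔ N , λ n n≥ → p n (ℕ.m⊔n≤o⇒m≤o M N n≥) , q n (ℕ.m⊔n≤o⇒n≤o M N n≥)

    ⊴-components : ∀ {x y r} → ℚ.∣ x ∣ ℚ.≤ r → ℚ.∣ y ∣ ℚ.≤ r → ⟨ x , y ⟩ ⊴ r ℚ.+ r
    ⊴-components {x} {y} {r} p q = subst (_⊴ r ℚ.+ r)
      (cong₂ ⟨_,_⟩ (solve 2 (λ x y → x :+ (con (+ 0) :* y :- con (+ 1) :* con (+ 0)) := x) x y)
                   (solve 1 (λ y → con (+ 0) :+ (con (+ 0) :* con (+ 0) :+ con (+ 1) :* y) := y) y))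
      (⊴-+ (⊴-real p) (subst (⟨ 0ℚ , 1ℚ ⟩ *ᴷ real y ⊴_) (ℚ.*-identityˡ r)
        (⊴-* {⟨ 0ℚ , 1ℚ ⟩} (bound 0≤1 (ℚ.≤-reflexive refl)) (⊴-real q))))

    from-≋ : ∀ {z w} → z ≋ w → z ≈ w
    from-≋ (close p) =
      (λ ε 0<ε → let N , h = p (ε ℚ.* ½) (half ε 0<ε) in N , λ n n≥ → ℚ.≤-<-trans (⊴-re (h n n≥)) (half-< 0<ε)) ,
      (λ ε 0<ε → let N , h = p (ε ℚ.* ½) (half ε 0<ε) in N , λ n n≥ → ℚ.≤-<-trans (⊴-im (h n n≥)) (half-< 0<ε))

    pointwise-≋ : ∀ {z w} → (∀ n → at z n ≡ at w n) → z ≋ w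
    pointwise-≋ {z} {w} eq = close λ ε 0<ε → 0 , λ n _ → subst (_⊴ ε)
      (trans (sym (CommutativeRing.-‿inverseʳ plane (at z n))) (cong (λ u → at z n +ᴷ -ᴷ u) (eq n)))
      (⊴-0 (ℚ.<⇒≤ 0<ε))

    ≋-refl : ∀ {z} → z ≋ z
    ≋-refl = pointwise-≋ (λ _ → refl)

    ≋-sym : ∀ {z w} → z ≋ w → w ≋ z
    ≋-sym {z} {w} (close p) = close λ ε 0<ε → let N , h = p ε 0<ε in N , λ n n≥ →
      subst (_⊴ ε) (solveᴷ 2 (λ z w → :-ᴷ (z :+ᴷ :-ᴷ w) :=ᴷ w :+ᴷ :-ᴷ z) (at z n) (at w n)) (⊴-neg (h n n≥))

    ≋-trans : ∀ {z w v} → z ≋ w → w ≋ v → z ≋ v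
    ≋-trans {z} {w} {v} (close p) (close q) = close λ ε 0<ε →
      let N , h = both (p (ε ℚ.* ½) (half ε 0<ε)) (q (ε ℚ.* ½) (half ε 0<ε))
      in N , λ n n≥ → subst₂ _⊴_
           (solveᴷ 3 (λ z w v → (z :+ᴷ :-ᴷ w) :+ᴷ (w :+ᴷ :-ᴷ v) :=ᴷ z :+ᴷ :-ᴷ v) (at z n) (at w n) (at v n))
           (half+half ε) (⊴-+ (proj₁ (h n n≥)) (proj₂ (h n n≥)))

    +-cong : ∀ {z z′ w w′} → z ≋ z′ → w ≋ w′ → z + w ≋ z′ + w′
    +-cong {z} {z′} {w} {w′} (close p) (close q) = close λ ε 0<ε →
      let N , h = both (p (ε ℚ.* ½) (half ε 0<ε)) (q (ε ℚ.* ½) (half ε 0<ε))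
      in N , λ n n≥ → subst₂ _⊴_
           (solveᴷ 4 (λ z w x y → (z :+ᴷ :-ᴷ x) :+ᴷ (w :+ᴷ :-ᴷ y) :=ᴷ (z :+ᴷ w) :+ᴷ :-ᴷ (x :+ᴷ y))
             (at z n) (at w n) (at z′ n) (at w′ n))
           (half+half ε) (⊴-+ (proj₁ (h n n≥)) (proj₂ (h n n≥)))

    neg-cong : ∀ {z z′} → z ≋ z′ → - z ≋ - z′
    neg-cong {z} {z′} (close p) = close λ ε 0<ε → let N , h = p ε 0<ε in N , λ n n≥ →
      subst (_⊴ ε) (solveᴷ 2 (λ z w → :-ᴷ (z :+ᴷ :-ᴷ w) :=ᴷ :-ᴷ z :+ᴷ :-ᴷ :-ᴷ w) (at z n) (at z′ n)) (⊴-neg (h n n≥))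

    eventually-bounded : ∀ z → ∃[ B ] (0ℚ ℚ.< B × Eventually (λ n → at z n ⊴ B))
    eventually-bounded z =
      let B , 0<B , M , p = bounded (seq (re z)) (cauchy (re z))
          C , 0<C , N , q = bounded (seq (im z)) (cauchy (im z))
          B≤B+C = subst (ℚ._≤ B ℚ.+ C) (ℚ.+-identityʳ B) (ℚ.+-monoʳ-≤ B (ℚ.<⇒≤ 0<C))
          C≤B+C = subst (ℚ._≤ B ℚ.+ C) (ℚ.+-identityˡ C) (ℚ.+-monoˡ-≤ C (ℚ.<⇒≤ 0<B))
          K , h = both (M , p) (N , q)
          0<B+C = ℚ.<-≤-trans 0<B B≤B+C
      in (B ℚ.+ C) ℚ.+ (B ℚ.+ C) , ℚ.<-≤-trans 0<B+C (subst (ℚ._≤ (B ℚ.+ C) ℚ.+ (B ℚ.+ C)) (ℚ.+-identityʳ (B ℚ.+ C)) (ℚ.+-monoʳ-≤ (B ℚ.+ C) (ℚ.<⇒≤ 0<B+C))) ,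
         K , λ n n≥ → ⊴-components (ℚ.≤-trans (proj₁ (h n n≥)) B≤B+C) (ℚ.≤-trans (proj₂ (h n n≥)) C≤B+C)

    *-congˡ : ∀ {z w w′} → w ≋ w′ → z * w ≋ z * w′
    *-congˡ {z} {w} {w′} (close p) = close λ ε 0<ε →
      let B , 0<B , ev-B = eventually-bounded z
          δ , 0<δ , Bδ   = divide ε B 0<ε 0<B
          N , h          = both ev-B (p δ 0<δ)
      in N , λ n n≥ → subst₂ _⊴_
           (solveᴷ 3 (λ z w x → z :*ᴷ (w :+ᴷ :-ᴷ x) :=ᴷ (z :*ᴷ w) :+ᴷ :-ᴷ (z :*ᴷ x)) (at z n) (at w n) (at w′ n))
           Bδ (⊴-* (proj₁ (h n n≥)) (proj₂ (h n n≥)))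

    *-comm : ∀ z w → z * w ≋ w * z
    *-comm z w = pointwise-≋ (λ n → *ᴷ-comm (at z n) (at w n))

    *-cong : ∀ {z z′ w w′} → z ≋ z′ → w ≋ w′ → z * w ≋ z′ * w′
    *-cong {z} {z′} {w} {w′} p q = ≋-trans (*-congˡ {z} q)
      (≋-trans (*-comm z w′) (≋-trans (*-congˡ {w′} p) (*-comm w′ z′)))

    *-assoc : ∀ x y z → (x * y) * z ≋ x * (y * z)
    *-assoc x y z = pointwise-≋ (λ n → *ᴷ-assoc (at x n) (at y n) (at z n))

    *-identityˡ : ∀ x → 1ᶜ * x ≋ x
    *-identityˡ x = pointwise-≋ (λ n → *ᴷ-identityˡ (at x n))

  limit : ∀ {z : ℕ → ℂ} {l} →
    (∀ ε → 0ℚ ℚ.< ε → ∃[ N ] (∀ n → N ℕ.≤ n → Eventually (λ k → at (z n) k +ᴷ -ᴷ at l k ⊴ ε))) → HasLimit z l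
  limit {z} {l} h ε 0<ε =
    let N , p = h (ε ℚ.* ½) (half ε 0<ε)
    in N , λ n n≥ → let K , r = p n n≥ in
       -- The gap demanded by `_<ᴿ_`: a distance of at most ½ ε leaves room for (½ ε)², since twice
       -- this square is at most ε².
       ε ℚ.* ½ ℚ.* (ε ℚ.* ½) , positive-square (half ε 0<ε) , K , λ k k≥ → enough (norm-≤ (r k k≥))
    where
    abstract
      positive-square : ∀ {x} → 0ℚ ℚ.< x → 0ℚ ℚ.< x ℚ.* x
      positive-square {x} 0<x = subst (ℚ._< x ℚ.* x) (ℚ.*-zeroʳ x) (ℚ.*-monoʳ-<-pos x {{ℚ.positive 0<x}} 0<x)
      enough : ∀ {x} → x ℚ.≤ ε ℚ.* ½ ℚ.* (ε ℚ.* ½) → x ℚ.+ ε ℚ.* ½ ℚ.* (ε ℚ.* ½) ℚ.≤ ε ℚ.* ε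
      enough {x} x≤ = ℚ.≤-trans (ℚ.+-monoˡ-≤ (ε ℚ.* ½ ℚ.* (ε ℚ.* ½)) x≤) (from-difference (subst (0ℚ ℚ.≤_)
        (trans (solve 1 (λ h → h :* h :+ h :* h := (h :+ h) :* (h :+ h) :- (h :* h :+ h :* h)) (ε ℚ.* ½))
          (cong (λ u → u ℚ.* u ℚ.- (ε ℚ.* ½ ℚ.* (ε ℚ.* ½) ℚ.+ ε ℚ.* ½ ℚ.* (ε ℚ.* ½))) (half+half ε)))
        (+-≥0 (square-≥0 (ε ℚ.* ½)) (square-≥0 (ε ℚ.* ½)))))

-- Coefficients of polynomial growth

module Growth where

  open PowerSeries
  open ThetaSeries

  -- The constants are indices in order to express uniformity: one estimate then covers all series
  -- with the same C and k, in particular all remainders of a sum.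
  record Tame (C k : ℕ) (a : Series) : Set where
    constructor tame
    field growth : ∀ n → ℤ.∣ a n ∣ ℕ.≤ C ℕ.* suc n ℕ.^ k
  open Tame public

  abstract
    tame-⊕ : ∀ {C C′ k k′ a b} → Tame C k a → Tame C′ k′ b → Tame (C ℕ.+ C′) (k ℕ.+ k′) (a ⊕ b)
    tame-⊕ {C} {C′} {k} {k′} {a} {b} (tame p) (tame p′) = tame λ n → begin
      ℤ.∣ a n ℤ.+ b n ∣  ≤⟨ ℤ.∣i+j∣≤∣i∣+∣j∣ (a n) (b n) ⟩
      ℤ.∣ a n ∣ ℕ.+ ℤ.∣ b n ∣  ≤⟨ ℕ.+-mono-≤ (p n) (p′ n) ⟩
      C ℕ.* suc n ℕ.^ k ℕ.+ C′ ℕ.* suc n ℕ.^ k′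
        ≤⟨ ℕ.+-mono-≤ (ℕ.*-monoʳ-≤ C (ℕ.^-monoʳ-≤ (suc n) (ℕ.m≤m+n k k′)))
                      (ℕ.*-monoʳ-≤ C′ (ℕ.^-monoʳ-≤ (suc n) (ℕ.m≤n+m k′ k))) ⟩
      C ℕ.* suc n ℕ.^ (k ℕ.+ k′) ℕ.+ C′ ℕ.* suc n ℕ.^ (k ℕ.+ k′)
        ≡⟨ sym (ℕ.*-distribʳ-+ (suc n ℕ.^ (k ℕ.+ k′)) C C′) ⟩
      (C ℕ.+ C′) ℕ.* suc n ℕ.^ (k ℕ.+ k′) ∎
      where open ℕ.≤-Reasoning

    tame-⊖ : ∀ {C k a} → Tame C k a → Tame C k (⊖ a)
    tame-⊖ {C} {k} {a} (tame p) = tame λ n → subst (ℕ._≤ C ℕ.* suc n ℕ.^ k) (sym (ℤ.∣-i∣≡∣i∣ (a n))) (p n)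

    tame-scale : ∀ {C k a} z → Tame C k a → Tame (ℤ.∣ z ∣ ℕ.* C) k (scale z a)
    tame-scale {C} {k} {a} z (tame p) = tame λ n → begin
      ℤ.∣ z ℤ.* a n ∣  ≡⟨ ℤ.∣i*j∣≡∣i∣*∣j∣ z (a n) ⟩
      ℤ.∣ z ∣ ℕ.* ℤ.∣ a n ∣  ≤⟨ ℕ.*-monoʳ-≤ ℤ.∣ z ∣ (p n) ⟩
      ℤ.∣ z ∣ ℕ.* (C ℕ.* suc n ℕ.^ k)  ≡⟨ sym (ℕ.*-assoc ℤ.∣ z ∣ C _) ⟩
      ℤ.∣ z ∣ ℕ.* C ℕ.* suc n ℕ.^ k ∎
      where open ℕ.≤-Reasoning

    tame-const : ∀ z → Tame ℤ.∣ z ∣ 0 (const z)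
    tame-const z = tame λ { zero → ℕ.≤-reflexive (sym (ℕ.*-identityʳ ℤ.∣ z ∣)) ; (suc n) → ℕ.z≤n }

    monomial-≤1 : ∀ m n → ℤ.∣ monomial m n ∣ ℕ.≤ 1
    monomial-≤1 zero    zero    = ℕ.≤-refl
    monomial-≤1 zero    (suc n) = ℕ.z≤n
    monomial-≤1 (suc m) zero    = ℕ.z≤n
    monomial-≤1 (suc m) (suc n) = monomial-≤1 m n

    tame-monomial : ∀ m → Tame 1 0 (monomial m)
    tame-monomial m = tame (monomial-≤1 m)

    progression-≤1 : ∀ ε i x c n → ℤ.∣ ε ∣ ≡ 1 → ℤ.∣ x ∣ ≡ 1 → ℤ.∣ progression ε i x c n ∣ ℕ.≤ 1
    progression-≤1 ε i x zero    zero    p q = ℕ.≤-reflexive q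
    progression-≤1 ε i x zero    (suc n) p q = progression-≤1 ε i (ε ℤ.* x) i n p
      (trans (ℤ.∣i*j∣≡∣i∣*∣j∣ ε x) (cong₂ ℕ._*_ p q))
    progression-≤1 ε i x (suc c) zero    p q = ℕ.z≤n
    progression-≤1 ε i x (suc c) (suc n) p q = progression-≤1 ε i x c n p q

    ⊗-≤ : ∀ {A B} a b n → (∀ m → m ℕ.≤ n → ℤ.∣ a m ∣ ℕ.≤ A) → (∀ m → m ℕ.≤ n → ℤ.∣ b m ∣ ℕ.≤ B) →
      ℤ.∣ (a ⊗ b) n ∣ ℕ.≤ suc n ℕ.* (A ℕ.* B)
    ⊗-≤ {A} {B} a b zero p q = begin
      ℤ.∣ a 0 ℤ.* b 0 ∣  ≡⟨ ℤ.∣i*j∣≡∣i∣*∣j∣ (a 0) (b 0) ⟩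
      ℤ.∣ a 0 ∣ ℕ.* ℤ.∣ b 0 ∣  ≤⟨ ℕ.*-mono-≤ (p 0 ℕ.z≤n) (q 0 ℕ.z≤n) ⟩
      A ℕ.* B  ≡⟨ sym (ℕ.+-identityʳ (A ℕ.* B)) ⟩
      A ℕ.* B ℕ.+ 0 ∎
      where open ℕ.≤-Reasoning
    ⊗-≤ {A} {B} a b (suc n) p q = begin
      ℤ.∣ a 0 ℤ.* b (suc n) ℤ.+ (tail a ⊗ b) n ∣
        ≤⟨ ℤ.∣i+j∣≤∣i∣+∣j∣ (a 0 ℤ.* b (suc n)) ((tail a ⊗ b) n) ⟩
      ℤ.∣ a 0 ℤ.* b (suc n) ∣ ℕ.+ ℤ.∣ (tail a ⊗ b) n ∣
        ≡⟨ cong (ℕ._+ ℤ.∣ (tail a ⊗ b) n ∣) (ℤ.∣i*j∣≡∣i∣*∣j∣ (a 0) (b (suc n))) ⟩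
      ℤ.∣ a 0 ∣ ℕ.* ℤ.∣ b (suc n) ∣ ℕ.+ ℤ.∣ (tail a ⊗ b) n ∣
        ≤⟨ ℕ.+-mono-≤ (ℕ.*-mono-≤ (p 0 ℕ.z≤n) (q (suc n) ℕ.≤-refl))
             (⊗-≤ (tail a) b n (λ m m≤n → p (suc m) (ℕ.s≤s m≤n)) (λ m m≤n → q m (ℕ.m≤n⇒m≤1+n m≤n))) ⟩
      A ℕ.* B ℕ.+ suc n ℕ.* (A ℕ.* B) ∎
      where open ℕ.≤-Reasoning

    growth-mono : ∀ {C k a n} → Tame C k a → ∀ m → m ℕ.≤ n → ℤ.∣ a m ∣ ℕ.≤ C ℕ.* suc n ℕ.^ k
    growth-mono {C} {k} (tame p) m m≤n = ℕ.≤-trans (p m) (ℕ.*-monoʳ-≤ C (ℕ.^-monoˡ-≤ k (ℕ.s≤s m≤n)))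

    tame-⊗ : ∀ {C C′ k k′ a b} → Tame C k a → Tame C′ k′ b → Tame (C ℕ.* C′) (suc (k ℕ.+ k′)) (a ⊗ b)
    tame-⊗ {C} {C′} {k} {k′} {a} {b} p p′ = tame λ n → ℕ.≤-trans (⊗-≤ a b n (growth-mono p) (growth-mono p′))
      (ℕ.≤-reflexive (trans (regroup (suc n) C (suc n ℕ.^ k) C′ (suc n ℕ.^ k′))
        (cong (λ u → C ℕ.* C′ ℕ.* (suc n ℕ.* u)) (sym (ℕ.^-distribˡ-+-* (suc n) k k′)))))
      where
      regroup : ∀ n c x c′ y → n ℕ.* (c ℕ.* x ℕ.* (c′ ℕ.* y)) ≡ c ℕ.* c′ ℕ.* (n ℕ.* (x ℕ.* y))
      regroup = solve 5 (λ n c x c′ y → n :* (c :* x :* (c′ :* y)) := c :* c′ :* (n :* (x :* y))) refl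
        where open ℕ-Solver

    sumℤ-≤ : ∀ n f B → (∀ i → i ℕ.< n → ℤ.∣ f i ∣ ℕ.≤ B) → ℤ.∣ sumℤ n f ∣ ℕ.≤ n ℕ.* B
    sumℤ-≤ zero    f B p = ℕ.z≤n
    sumℤ-≤ (suc n) f B p = ℕ.≤-trans (ℤ.∣i+j∣≤∣i∣+∣j∣ (f 0) (sumℤ n (f ∘ suc)))
      (ℕ.+-mono-≤ (p 0 (ℕ.s≤s ℕ.z≤n)) (sumℤ-≤ n (f ∘ suc) B (λ i i<n → p (suc i) (ℕ.s≤s i<n))))

    sumℤ-snoc : ∀ n f → sumℤ (suc n) f ≡ sumℤ n f ℤ.+ f n
    sumℤ-snoc zero    f = ℤ.+-comm (f 0) (+ 0)
    sumℤ-snoc (suc n) f = trans (cong (λ u → f 0 ℤ.+ u) (sumℤ-snoc n (f ∘ suc))) (sym (ℤ.+-assoc (f 0) _ _))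

  -- A uniformly bounded family with x i = O(qⁱ).
  record Summable (k : ℕ) (x : ℕ → Series) : Set where
    field
      vanish  : ∀ i n → n ℕ.< i → x i n ≡ + 0
      uniform : ∀ i n → ℤ.∣ x i n ∣ ℕ.≤ suc n ℕ.^ k

  partials : (ℕ → Series) → ℕ → Series
  partials x N n = sumℤ N (λ i → x i n)

  module _ {k x} (S : Summable k x) where

    open Summable S

    abstract
      tame-member : ∀ i → Tame 1 k (x i)
      tame-member i = tame λ n → ℕ.≤-trans (uniform i n) (ℕ.≤-reflexive (sym (ℕ.*-identityˡ _)))

      tame-series : Tame 1 (suc k) (series x)
      tame-series = tame λ n → ℕ.≤-trans (sumℤ-≤ (suc n) (λ i → x i n) (suc n ℕ.^ k) (λ i _ → uniform i n))
        (ℕ.≤-reflexive (sym (ℕ.*-identityˡ _)))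

      tame-partials : ∀ N → Tame N k (partials x N)
      tame-partials N = tame λ n → sumℤ-≤ N (λ i → x i n) (suc n ℕ.^ k) (λ i _ → uniform i n)

      partials-suc : ∀ N n → partials x (suc N) n ≡ (partials x N ⊕ x N) n
      partials-suc N n = sumℤ-snoc N (λ i → x i n)

      remainder-vanish : ∀ N n → n ℕ.< N → (series x ⊕ ⊖ partials x N) n ≡ + 0
      remainder-vanish N n n<N = trans (cong (λ u → series x n ℤ.+ ℤ.- u)
        (trans (cong (λ m → sumℤ m (λ i → x i n)) (sym (ℕ.m+[n∸m]≡n n<N)))
          (sumℤ-extend (suc n) (N ℕ.∸ suc n) (λ i → x i n) (λ i n<i → vanish i n n<i))))
        (ℤ.+-inverseʳ (series x n))

      -- The bound must not depend on N. Below qᴺ the remainder vanishes, and for n ≥ N the partial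
      -- sum has at most n + 1 terms, so it obeys the same bound as the whole series.
      tame-remainder : ∀ N → Tame 2 (suc k) (series x ⊕ ⊖ partials x N)
      tame-remainder N = tame λ n → estimate n
        where
        estimate : ∀ n → ℤ.∣ series x n ℤ.+ ℤ.- partials x N n ∣ ℕ.≤ 2 ℕ.* suc n ℕ.^ suc k
        estimate n with n ℕ.<? N
        ... | yes n<N = subst (ℕ._≤ 2 ℕ.* suc n ℕ.^ suc k) (sym (cong ℤ.∣_∣ (remainder-vanish N n n<N))) ℕ.z≤n
        ... | no  n≮N = begin
          ℤ.∣ series x n ℤ.+ ℤ.- partials x N n ∣
            ≤⟨ ℤ.∣i+j∣≤∣i∣+∣j∣ (series x n) (ℤ.- partials x N n) ⟩
          ℤ.∣ series x n ∣ ℕ.+ ℤ.∣ ℤ.- partials x N n ∣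
            ≡⟨ cong (ℤ.∣ series x n ∣ ℕ.+_) (ℤ.∣-i∣≡∣i∣ (partials x N n)) ⟩
          ℤ.∣ series x n ∣ ℕ.+ ℤ.∣ partials x N n ∣
            ≤⟨ ℕ.+-mono-≤ (sumℤ-≤ (suc n) (λ i → x i n) (suc n ℕ.^ k) (λ i _ → uniform i n))
                 (ℕ.≤-trans (growth (tame-partials N) n) (ℕ.*-monoˡ-≤ (suc n ℕ.^ k) (ℕ.m≤n⇒m≤1+n (ℕ.≮⇒≥ n≮N)))) ⟩
          suc n ℕ.^ suc k ℕ.+ suc n ℕ.^ suc k
            ≡⟨ cong (suc n ℕ.^ suc k ℕ.+_) (sym (ℕ.+-identityʳ (suc n ℕ.^ suc k))) ⟩
          2 ℕ.* suc n ℕ.^ suc k ∎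
          where open ℕ.≤-Reasoning

-- The value of a power series inside the unit disk

module Evaluation (q : ℂ) (∣q∣<1 : ∣ q ∣² <ᴿ 1ᴿ) where

  open Rationals
  open Plane
  open PowerSeries
  open ThetaSeries
  open Growth
  open ComplexField
  open Solver using (solve; _:=_; _:+_; _:*_; _:-_; :-_; con)

  -- If |q|² ≤ 1 - δ then |q| ≤ 1 - δ/2.
  abstract
    disk : ∃[ ρ ] (ρ ℚ.< 1ℚ × Eventually (λ n → at q n ⊴ ρ))
    disk = let δ , 0<δ , N , h = ∣q∣<1 in
      1ℚ ℚ.- δ ℚ.* ½ ,
      subst (1ℚ ℚ.- δ ℚ.* ½ ℚ.<_) (ℚ.+-identityʳ 1ℚ) (ℚ.+-monoʳ-< 1ℚ (ℚ.neg-antimono-< (half δ 0<δ))) ,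
      N , λ n n≥ → bound (nonneg {at q n} δ (h n n≥)) (ℚ.≤-trans (from-sum {norm² (at q n)} (h n n≥)) (square δ))
      where
      open ≡-Reasoning
      from-sum : ∀ {x δ} → x ℚ.+ δ ℚ.≤ 1ℚ → x ℚ.≤ 1ℚ ℚ.- δ
      from-sum {x} {δ} p = from-difference (subst (0ℚ ℚ.≤_)
        (solve 2 (λ x d → con (+ 1) :- (x :+ d) := (con (+ 1) :- d) :- x) x δ) (difference-≥0 p))
      square : ∀ δ → 1ℚ ℚ.- δ ℚ.≤ (1ℚ ℚ.- δ ℚ.* ½) ℚ.* (1ℚ ℚ.- δ ℚ.* ½)
      square δ = from-difference (subst (0ℚ ℚ.≤_) (begin
        δ ℚ.* ½ ℚ.* (δ ℚ.* ½)
          ≡⟨ solve 1 (λ h → h :* h := (con (+ 1) :- h) :* (con (+ 1) :- h) :- (con (+ 1) :- (h :+ h))) (δ ℚ.* ½) ⟩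
        (1ℚ ℚ.- δ ℚ.* ½) ℚ.* (1ℚ ℚ.- δ ℚ.* ½) ℚ.- (1ℚ ℚ.- (δ ℚ.* ½ ℚ.+ δ ℚ.* ½))
          ≡⟨ cong (λ u → (1ℚ ℚ.- δ ℚ.* ½) ℚ.* (1ℚ ℚ.- δ ℚ.* ½) ℚ.- (1ℚ ℚ.- u)) (half+half δ) ⟩
        (1ℚ ℚ.- δ ℚ.* ½) ℚ.* (1ℚ ℚ.- δ ℚ.* ½) ℚ.- (1ℚ ℚ.- δ) ∎) (square-≥0 (δ ℚ.* ½)))
      nonneg : ∀ {z} δ → norm² z ℚ.+ δ ℚ.≤ 1ℚ → 0ℚ ℚ.≤ 1ℚ ℚ.- δ ℚ.* ½
      nonneg {z} δ p = subst (0ℚ ℚ.≤_) (begin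
        ½ ℚ.+ (1ℚ ℚ.- δ) ℚ.* ½
          ≡⟨ solve 2 (λ h d → h :+ (con (+ 1) :- d) :* h := (h :+ h) :- d :* h) ½ δ ⟩
        (½ ℚ.+ ½) ℚ.- δ ℚ.* ½ ∎)
        (+-≥0 0≤½ (*-≥0 (ℚ.≤-trans (norm²-≥0 z) (from-sum {norm² z} p)) 0≤½))

  -- As ρ ≤ σ², one factor σʲ can absorb the growth of the coefficients while the other is left for
  -- the geometric series.
  ρ σ : ℚ
  ρ = proj₁ disk
  σ = mean ρ

  inside : Eventually (λ n → at q n ⊴ ρ)
  inside = proj₂ (proj₂ disk)

  abstract
    0≤ρ : 0ℚ ℚ.≤ ρ
    0≤ρ = let N , h = inside in radius-≥0 (h N ℕ.≤-refl)
    ρ<1 : ρ ℚ.< 1ℚ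
    ρ<1 = proj₁ (proj₂ disk)
    0≤σ : 0ℚ ℚ.≤ σ
    0≤σ = mean-≥0 0≤ρ
    σ<1 : σ ℚ.< 1ℚ
    σ<1 = mean-<1 ρ<1

    geometric-sum : ∃[ g ] (0ℚ ℚ.< g × g ℚ.* (1ℚ ℚ.- σ) ≡ 1ℚ)
    geometric-sum = inverse (subst (ℚ._< 1ℚ ℚ.- σ) (ℚ.+-inverseʳ σ) (ℚ.+-monoˡ-< (ℚ.- σ) σ<1))

  g : ℚ
  g = proj₁ geometric-sum

  abstract
    0≤g : 0ℚ ℚ.≤ g
    0≤g = ℚ.<⇒≤ (proj₁ (proj₂ geometric-sum))

    g-eq : g ℚ.* (1ℚ ℚ.- σ) ≡ 1ℚ
    g-eq = proj₂ (proj₂ geometric-sum)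

    num-^ : ∀ n k → num (n ℕ.^ k) ≡ num n ^ᵠ k
    num-^ n zero    = trans (num-suc 0) (trans (cong (1ℚ ℚ.+_) num-zero) (ℚ.+-identityʳ 1ℚ))
    num-^ n (suc k) = trans (num-* n (n ℕ.^ k)) (cong (num n ℚ.*_) (num-^ n k))

    -- M is fixed before the series a, which makes the estimate uniform over all series of the same
    -- growth.
    domination : ∀ C k → ∃[ M ] (0ℚ ℚ.≤ M × (∀ {a} → Tame C k a → Dominated 1ℚ M ρ σ a))
    domination C k = let B , 0≤B , p = power-bounded k {σ} 0≤σ σ<1 in
      num C ℚ.* B , *-≥0 (num-≥0 C) 0≤B , λ {a} t → dominated λ j → estimate a t j (p j)
      where
      open ℚ.≤-Reasoning
      estimate : ∀ {B} a → Tame C k a → ∀ j → num (suc j) ^ᵠ k ℚ.* σ ^ᵠ j ℚ.≤ B →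
        1ℚ ℚ.* ℚ.∣ toℚ (a j) ∣ ℚ.* ρ ^ᵠ j ℚ.≤ num C ℚ.* B ℚ.* σ ^ᵠ j
      estimate {B} a t j p = begin
        1ℚ ℚ.* ℚ.∣ toℚ (a j) ∣ ℚ.* ρ ^ᵠ j
          ≡⟨ cong (ℚ._* ρ ^ᵠ j) (trans (ℚ.*-identityˡ _) (∣toℚ∣ (a j))) ⟩
        num ℤ.∣ a j ∣ ℚ.* ρ ^ᵠ j
          ≤⟨ *-mono-≥0 (num-≥0 ℤ.∣ a j ∣) (*-≥0 (^ᵠ-≥0 j 0≤σ) (^ᵠ-≥0 j 0≤σ)) (num-mono (growth t j))
               (ℚ.≤-trans (^ᵠ-mono j 0≤ρ (mean-square ρ)) (ℚ.≤-reflexive (^ᵠ-* σ σ j))) ⟩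
        num (C ℕ.* suc j ℕ.^ k) ℚ.* (σ ^ᵠ j ℚ.* σ ^ᵠ j)
          ≡⟨ cong (ℚ._* (σ ^ᵠ j ℚ.* σ ^ᵠ j)) (trans (num-* C (suc j ℕ.^ k)) (cong (num C ℚ.*_) (num-^ (suc j) k))) ⟩
        num C ℚ.* num (suc j) ^ᵠ k ℚ.* (σ ^ᵠ j ℚ.* σ ^ᵠ j)
          ≡⟨ solve 3 (λ c n s → c :* n :* (s :* s) := c :* (n :* s) :* s) (num C) (num (suc j) ^ᵠ k) (σ ^ᵠ j) ⟩
        num C ℚ.* (num (suc j) ^ᵠ k ℚ.* σ ^ᵠ j) ℚ.* σ ^ᵠ j
          ≤⟨ ℚ.*-monoʳ-≤-nonNeg (σ ^ᵠ j) {{ℚ.nonNegative (^ᵠ-≥0 j 0≤σ)}}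
               (ℚ.*-monoˡ-≤-nonNeg (num C) {{ℚ.nonNegative (num-≥0 C)}} p) ⟩
        num C ℚ.* B ℚ.* σ ^ᵠ j ∎

    -- Every error term below is at most (n + 1) C σⁿ.
    small : ∀ C → 0ℚ ℚ.≤ C → ∀ ε → 0ℚ ℚ.< ε → Eventually (λ n → num (suc n) ℚ.* C ℚ.* σ ^ᵠ n ℚ.≤ ε)
    small = null 0≤σ σ<1

    small′ : ∀ M → 0ℚ ℚ.≤ M → ∀ ε → 0ℚ ℚ.< ε → Eventually (λ n → M ℚ.* σ ^ᵠ n ℚ.* g ℚ.≤ ε)
    small′ M 0≤M ε 0<ε = let N , h = small (M ℚ.* g) (*-≥0 0≤M 0≤g) ε 0<ε in N , λ n n≥ →
      ℚ.≤-trans (ℚ.≤-trans (ℚ.≤-reflexive (solve 3 (λ m s g → m :* s :* g := con (+ 1) :* (m :* g) :* s) M (σ ^ᵠ n) g))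
        (ℚ.*-monoʳ-≤-nonNeg (σ ^ᵠ n) {{ℚ.nonNegative (^ᵠ-≥0 n 0≤σ)}}
          (ℚ.*-monoʳ-≤-nonNeg (M ℚ.* g) {{ℚ.nonNegative (*-≥0 0≤M 0≤g)}} (one≤ n)))) (h n n≥)
      where
      one≤ : ∀ n → 1ℚ ℚ.≤ num (suc n)
      one≤ n = subst₂ ℚ._≤_ (ℚ.+-identityʳ 1ℚ) (sym (num-suc n)) (ℚ.+-monoʳ-≤ 1ℚ (num-≥0 n))

    unscale : ∀ {z r} → real 1ℚ *ᴷ z ⊴ r → z ⊴ r
    unscale {z} {r} = subst (_⊴ r) (*ᴷ-identityˡ z)

    tail-small : ∀ {C k a} → Tame C k a → ∀ ε → 0ℚ ℚ.< ε →
      ∃[ N ] Eventually (λ n → ∀ m → N ℕ.≤ m → ev m a (at q n) +ᴷ -ᴷ ev N a (at q n) ⊴ ε)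
    tail-small {C} {k} {a} t ε 0<ε =
      let M , 0≤M , dom = domination C k
          N , h         = small′ M 0≤M ε 0<ε
          N₀ , in-disk  = inside
      in N , N₀ , λ n n≥ m m≥ → subst (λ m → ev m a (at q n) +ᴷ -ᴷ ev N a (at q n) ⊴ ε) (ℕ.m+[n∸m]≡n m≥)
           (⊴-mono (unscale (Bounds.ev-difference (in-disk n n≥) 0≤σ 0≤g g-eq N (m ℕ.∸ N) a 0≤1 0≤M (dom t))) (h N ℕ.≤-refl))

  -- `ev` repeated in ℂ: for a fixed degree the Cauchy property then comes with the ring operations.
  polynomial : ℕ → Series → ℂ
  polynomial zero    a = fromℚ 0ℚ
  polynomial (suc N) a = fromℚ (toℚ (a 0)) + q * polynomial N (tail a)

  abstract
    at-polynomial : ∀ N a n → at (polynomial N a) n ≡ ev N a (at q n)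
    at-polynomial zero    a n = refl
    at-polynomial (suc N) a n = cong (λ u → real (toℚ (a 0)) +ᴷ at q n *ᴷ u) (at-polynomial N (tail a) n)

  reᴷ imᴷ : K → ℚ
  reᴷ ⟨ x , y ⟩ = x
  imᴷ ⟨ x , y ⟩ = y

  abstract
    -- The degree and the approximation of q change together, so both members are compared with a
    -- fixed degree N. Each truncation costs ¼ ε and the polynomial of N terms, at two
    -- approximations of q, costs ½ ε. `π` is the real or the imaginary part.
    cauchy-ev : ∀ (π : K → ℚ) → (∀ z w → π (z +ᴷ -ᴷ w) ≡ π z ℚ.- π w) → (∀ {z r} → z ⊴ r → ℚ.∣ π z ∣ ℚ.≤ r) →
      (∀ N a → IsCauchy (λ n → π (at (polynomial N a) n))) →
      ∀ {C k a} → Tame C k a → IsCauchy (λ n → π (ev n a (at q n)))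
    cauchy-ev π π-difference π-bound π-cauchy {a = a} t ε 0<ε =
      let ε′            = ε ℚ.* ½ ℚ.* ½
          0<ε′          = half (ε ℚ.* ½) (half ε 0<ε)
          N , N₁ , h    = tail-small t ε′ 0<ε′
          N₂ , c        = π-cauchy N a (ε ℚ.* ½) (half ε 0<ε)
      in (N ℕ.⊔ N₁) ℕ.⊔ N₂ , λ m n m≥ n≥ →
        let m≥′ = ℕ.m⊔n≤o⇒m≤o (N ℕ.⊔ N₁) N₂ m≥
            n≥′ = ℕ.m⊔n≤o⇒m≤o (N ℕ.⊔ N₁) N₂ n≥
        in combine N m n
          (h m (ℕ.m⊔n≤o⇒n≤o N N₁ m≥′) m (ℕ.m⊔n≤o⇒m≤o N N₁ m≥′))
          (h n (ℕ.m⊔n≤o⇒n≤o N N₁ n≥′) n (ℕ.m⊔n≤o⇒m≤o N N₁ n≥′))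
          (subst₂ (λ u v → ℚ.∣ π u ℚ.- π v ∣ ℚ.< ε ℚ.* ½) (at-polynomial N a m) (at-polynomial N a n)
            (c m n (ℕ.m⊔n≤o⇒n≤o (N ℕ.⊔ N₁) N₂ m≥) (ℕ.m⊔n≤o⇒n≤o (N ℕ.⊔ N₁) N₂ n≥)))
      where
      open ℚ.≤-Reasoning
      combine : ∀ N m n →
        ev m a (at q m) +ᴷ -ᴷ ev N a (at q m) ⊴ ε ℚ.* ½ ℚ.* ½ →
        ev n a (at q n) +ᴷ -ᴷ ev N a (at q n) ⊴ ε ℚ.* ½ ℚ.* ½ →
        ℚ.∣ π (ev N a (at q m)) ℚ.- π (ev N a (at q n)) ∣ ℚ.< ε ℚ.* ½ →
        ℚ.∣ π (ev m a (at q m)) ℚ.- π (ev n a (at q n)) ∣ ℚ.< ε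
      combine N m n p p′ r = begin-strict
        ℚ.∣ A ℚ.- D ∣
          ≡⟨ cong ℚ.∣_∣ (solve 4 (λ a b c d → a :- d := ((a :- b) :- (d :- c)) :+ (b :- c)) A B C D) ⟩
        ℚ.∣ ((A ℚ.- B) ℚ.- (D ℚ.- C)) ℚ.+ (B ℚ.- C) ∣
          ≤⟨ ℚ.∣p+q∣≤∣p∣+∣q∣ ((A ℚ.- B) ℚ.- (D ℚ.- C)) (B ℚ.- C) ⟩
        ℚ.∣ (A ℚ.- B) ℚ.- (D ℚ.- C) ∣ ℚ.+ ℚ.∣ B ℚ.- C ∣
          ≤⟨ ℚ.+-monoˡ-≤ ℚ.∣ B ℚ.- C ∣ (ℚ.∣p-q∣≤∣p∣+∣q∣ (A ℚ.- B) (D ℚ.- C)) ⟩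
        ℚ.∣ A ℚ.- B ∣ ℚ.+ ℚ.∣ D ℚ.- C ∣ ℚ.+ ℚ.∣ B ℚ.- C ∣
          <⟨ ℚ.+-mono-≤-< (ℚ.+-mono-≤
               (subst (λ u → ℚ.∣ u ∣ ℚ.≤ ε ℚ.* ½ ℚ.* ½) (π-difference (ev m a (at q m)) (ev N a (at q m))) (π-bound p))
               (subst (λ u → ℚ.∣ u ∣ ℚ.≤ ε ℚ.* ½ ℚ.* ½) (π-difference (ev n a (at q n)) (ev N a (at q n))) (π-bound p′))) r ⟩
        ε ℚ.* ½ ℚ.* ½ ℚ.+ ε ℚ.* ½ ℚ.* ½ ℚ.+ ε ℚ.* ½
          ≡⟨ trans (cong (ℚ._+ ε ℚ.* ½) (half+half (ε ℚ.* ½))) (half+half ε) ⟩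
        ε ∎
        where
        A B C D : ℚ
        A = π (ev m a (at q m))
        B = π (ev N a (at q m))
        C = π (ev N a (at q n))
        D = π (ev n a (at q n))

    cauchy-re : ∀ {C k a} → Tame C k a → IsCauchy (λ n → reᴷ (ev n a (at q n)))
    cauchy-re = cauchy-ev reᴷ (λ { ⟨ _ , _ ⟩ ⟨ _ , _ ⟩ → refl }) (λ { {⟨ _ , _ ⟩} → ⊴-re }) (λ N a → cauchy (re (polynomial N a)))

    cauchy-im : ∀ {C k a} → Tame C k a → IsCauchy (λ n → imᴷ (ev n a (at q n)))
    cauchy-im = cauchy-ev imᴷ (λ { ⟨ _ , _ ⟩ ⟨ _ , _ ⟩ → refl }) (λ { {⟨ _ , _ ⟩} → ⊴-im }) (λ N a → cauchy (im (polynomial N a)))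

  -- The value of a power series at q; the n-th approximation is the n-th partial sum at the
  -- n-th approximation of q.
  value : ∀ {C k a} → Tame C k a → ℂ
  value {a = a} t = mkℝ (λ n → reᴷ (ev n a (at q n))) (cauchy-re t) +i mkℝ (λ n → imᴷ (ev n a (at q n))) (cauchy-im t)

  abstract
    at-value : ∀ {C k a} (t : Tame C k a) n → at (value t) n ≡ ev n a (at q n)
    at-value {a = a} t n = eta (ev n a (at q n))
      where
      eta : ∀ z → ⟨ reᴷ z , imᴷ z ⟩ ≡ z
      eta ⟨ _ , _ ⟩ = refl

-- The identities coefficient by coefficient

module CoefficientIdentities where

  open PowerSeries
  open ThetaSeries

  infixr 9 _^ˢ_
  _^ˢ_ : Series → ℕ → Series
  a ^ˢ zero  = const (+ 1)
  a ^ˢ suc n = a ⊗ a ^ˢ n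

  detU detG : Series
  detU = (const (+ 16) ⊗ Uˢ 1 ⊕ ⊖ const (+ 2)) ⊗ (const (+ 16) ⊗ Uˢ 5 ⊕ ⊖ const (+ 2)) ⊕
    ⊖ ((const (+ 16) ⊗ Uˢ 3 ⊕ const (+ 1)) ⊗ (const (+ 16) ⊗ Uˢ 3 ⊕ const (+ 1)))
  detG = (const (+ 16) ⊗ Gˢ 3 ⊕ const (+ 1)) ⊗ (const (+ 32) ⊗ Gˢ 7 ⊕ const (+ 17)) ⊕
    ⊖ ((const (+ 16) ⊗ Gˢ 5 ⊕ ⊖ const (+ 2)) ⊗ (const (+ 32) ⊗ Gˢ 5 ⊕ ⊖ const (+ 4)))

  abstract
    -- The coefficient of qⁿ is read off modulo qⁿ⁺¹.
    θ¹⁶ : ∀ n → (const (+ 3) ⊗ θˢ ^ˢ 16) n ≡ detU n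
    θ¹⁶ n = coefficient (At.determinant-Uˢ (suc n)) n ℕ.≤-refl

    θ²⁴ : ∀ n → (const (+ 9) ⊗ θˢ ^ˢ 24) n ≡ detG n
    θ²⁴ n = coefficient (At.determinant-Gˢ (suc n)) n ℕ.≤-refl

    uTerm-quotient : ∀ s i n →
      (uTerm s i ⊗ (const (+ 1) ⊕ monomial (suc i))) n ≡ scale (+ (suc i ℕ.^ s)) (monomial (suc i)) n
    uTerm-quotient s i n = trans (⊗-scaleˡ (+ (suc i ℕ.^ s)) (lambert -[1+ 0 ] i) _ n)
      (cong (+ (suc i ℕ.^ s) ℤ.*_) (coefficient (At.t-quotient (suc n) i) n ℕ.≤-refl))

    gTerm-quotient : ∀ s i n →
      (gTerm s i ⊗ (const (+ 1) ⊕ ⊖ monomial (suc i))) n ≡ scale (+ (suc i ℕ.^ s)) (monomial (suc i)) n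
    gTerm-quotient s i n = trans (⊗-scaleˡ (+ (suc i ℕ.^ s)) (lambert (+ 1) i) _ n)
      (cong (+ (suc i ℕ.^ s) ℤ.*_) (coefficient (At.w-quotient (suc n) i) n ℕ.≤-refl))

-- Evaluation at q as a ring homomorphism

module Values (q : ℂ) (∣q∣<1 : ∣ q ∣² <ᴿ 1ᴿ) where

  open Rationals
  open Plane
  open PowerSeries
  open ThetaSeries
  open Growth
  open ComplexField
  open CoefficientIdentities
  open Evaluation q ∣q∣<1 public
  open Solver using (solve; _:=_; _:+_; _:*_; _:-_; :-_; con)

  abstract
    ev-0 : ∀ N a z → (∀ n → a n ≡ + 0) → ev N a z ≡ real 0ℚ
    ev-0 zero    a z eq = refl
    ev-0 (suc N) a z eq = trans (cong₂ (λ x w → real x +ᴷ z *ᴷ w)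
        (trans (cong toℚ (eq 0)) (sym (literal-toℚ (+ 0)))) (ev-0 N (tail a) z (eq ∘ suc)))
      (solveᴷ 1 (λ z → conᴷ (+ 0) :+ᴷ z :*ᴷ conᴷ (+ 0) :=ᴷ conᴷ (+ 0)) z)

    ev-⊖ : ∀ N a z → ev N (⊖ a) z ≡ -ᴷ ev N a z
    ev-⊖ N a z = trans (ev-cong N z (λ n → sym (ℤ.-1*i≡-i (a n)))) (trans (ev-scale N -[1+ 0 ] a z)
      (trans (cong (λ u → real u *ᴷ ev N a z) (sym (literal-toℚ -[1+ 0 ])))
      (solveᴷ 1 (λ x → conᴷ -[1+ 0 ] :*ᴷ x :=ᴷ :-ᴷ x) (ev N a z))))

    value-cong : ∀ {C C′ k k′ a b} (t : Tame C k a) (t′ : Tame C′ k′ b) → (∀ n → a n ≡ b n) → value t ≋ value t′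
    value-cong t t′ eq = pointwise-≋ (λ n → trans (at-value t n) (trans (ev-cong n (at q n) eq) (sym (at-value t′ n))))

    value-⊕ : ∀ {C C′ k k′ a b} (t : Tame C k a) (t′ : Tame C′ k′ b) → value (tame-⊕ t t′) ≋ value t + value t′
    value-⊕ {a = a} {b = b} t t′ = pointwise-≋ (λ n → trans (at-value (tame-⊕ t t′) n)
      (trans (ev-⊕ n a b (at q n)) (sym (cong₂ _+ᴷ_ (at-value t n) (at-value t′ n)))))

    value-⊖ : ∀ {C k a} (t : Tame C k a) → value (tame-⊖ t) ≋ - value t
    value-⊖ {a = a} t = pointwise-≋ (λ n → trans (at-value (tame-⊖ t) n)
      (trans (ev-⊖ n a (at q n)) (sym (cong -ᴷ_ (at-value t n)))))

    value-scale : ∀ {C k a} z (t : Tame C k a) → value (tame-scale z t) ≋ fromℚ (toℚ z) * value t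
    value-scale {a = a} z t = pointwise-≋ (λ n → trans (at-value (tame-scale z t) n)
      (trans (ev-scale n z a (at q n)) (sym (cong (real (toℚ z) *ᴷ_) (at-value t n)))))

    eventually-≋ : ∀ {z w} → Eventually (λ n → at z n ≡ at w n) → z ≋ w
    eventually-≋ {z} {w} (N , eq) = close λ ε 0<ε → N , λ n n≥ → subst (_⊴ ε)
      (trans (sym (CommutativeRing.-‿inverseʳ plane (at z n))) (cong (λ u → at z n +ᴷ -ᴷ u) (eq n n≥)))
      (⊴-0 (ℚ.<⇒≤ 0<ε))

    ev-const : ∀ n z w → ev (suc n) (const z) w ≡ real (toℚ z)
    ev-const n z w = trans (cong (λ u → real (toℚ z) +ᴷ w *ᴷ u) (ev-0 n (tail (const z)) w (λ _ → refl)))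
      (solveᴷ 2 (λ x w → x :+ᴷ w :*ᴷ conᴷ (+ 0) :=ᴷ x) (real (toℚ z)) w)

    value-const : ∀ z → value (tame-const z) ≋ fromℚ (toℚ z)
    -- The approximation with index 0 uses no coefficients and has the value 0, so equality begins
    -- at 1.
    value-const z = eventually-≋ (1 , λ { (suc n) _ → trans (at-value (tame-const z) (suc n)) (ev-const n z (at q (suc n))) })

    ev-monomial : ∀ m n k → m ℕ.< n → ev n (monomial m) (at q k) ≡ at (q ^ m) k
    ev-monomial zero    (suc n) k _ = trans (ev-const n (+ 1) (at q k)) (cong real (toℚ-/ (+ 1)))
    ev-monomial (suc m) (suc n) k (ℕ.s≤s m<n) = trans
      (cong₂ (λ x w → real x +ᴷ at q k *ᴷ w) (sym (literal-toℚ (+ 0))) (ev-monomial m n k m<n))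
      (CommutativeRing.+-identityˡ plane (at q k *ᴷ at (q ^ m) k))

    value-monomial : ∀ m → value (tame-monomial m) ≋ q ^ m
    value-monomial m = eventually-≋ (suc m , λ n m<n → trans (at-value (tame-monomial m) n) (ev-monomial m n n m<n))

    -- Truncation does not commute with products; at the n-th approximation the defect is of order n
    -- σⁿ by `ev-⊗-error`, which tends to 0.
    value-⊗ : ∀ {C C′ k k′ a b} (t : Tame C k a) (t′ : Tame C′ k′ b) → value (tame-⊗ t t′) ≋ value t * value t′
    value-⊗ {C} {C′} {k} {k′} {a} {b} t t′ = close λ ε 0<ε →
      let M , 0≤M , dom    = domination C k
          M′ , 0≤M′ , dom′ = domination C′ k′
          0≤MM′gg          = *-≥0 (*-≥0 (*-≥0 0≤M 0≤M′) 0≤g) 0≤g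
          N , h            = both inside (small (M ℚ.* M′ ℚ.* g ℚ.* g) 0≤MM′gg ε 0<ε)
      in N , λ n n≥ → subst (_⊴ ε)
           (cong₂ (λ x y → x +ᴷ -ᴷ y) (sym (at-value (tame-⊗ t t′) n)) (sym (cong₂ _*ᴷ_ (at-value t n) (at-value t′ n))))
           (⊴-mono (unscale (Bounds.ev-⊗-error (proj₁ (h n n≥)) 0≤σ 0≤g g-eq n a b 0≤1 0≤M 0≤M′ (dom t) (dom′ t′)))
             (ℚ.≤-trans (step n 0≤MM′gg) (proj₂ (h n n≥))))
      where
      step : ∀ n {C} → 0ℚ ℚ.≤ C → num n ℚ.* C ℚ.* σ ^ᵠ n ℚ.≤ num (suc n) ℚ.* C ℚ.* σ ^ᵠ n
      step n {C} 0≤C = ℚ.*-monoʳ-≤-nonNeg (σ ^ᵠ n) {{ℚ.nonNegative (^ᵠ-≥0 n 0≤σ)}}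
        (ℚ.*-monoʳ-≤-nonNeg C {{ℚ.nonNegative 0≤C}} (num-mono (ℕ.n≤1+n n)))

  degree : ℕ → ℕ → ℕ
  degree k zero    = 0
  degree k (suc n) = suc (k ℕ.+ degree k n)

  tame-^ : ∀ {C k a} → Tame C k a → ∀ n → Tame (C ℕ.^ n) (degree k n) (a ^ˢ n)
  tame-^ t zero    = tame-const (+ 1)
  tame-^ t (suc n) = tame-⊗ t (tame-^ t n)

  abstract
    value-literal : ∀ n → value (tame-const (+ n)) ≋ fromℕ n
    value-literal n = ≋-trans (value-const (+ n)) (pointwise-≋ (λ _ → cong real (toℚ-/ (+ n))))

    value-^ : ∀ {C k a} (t : Tame C k a) n → value (tame-^ t n) ≋ value t ^ n
    value-^ t zero    = value-literal 1
    value-^ t (suc n) = ≋-trans (value-⊗ t (tame-^ t n)) (*-congˡ (value-^ t n))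

  module _ {k x} (S : Summable k x) {f : ℕ → ℂ} (f≋ : ∀ i → f i ≋ value (tame-member S i)) where

    abstract
      partialSum-≋ : ∀ N → partialSum f N ≋ value (tame-partials S N)
      partialSum-≋ zero    = pointwise-≋ (λ n → sym (trans (at-value (tame-partials S 0) n)
        (trans (ev-0 n (partials x 0) (at q n) (λ _ → refl)) (cong real (trans (literal-toℚ (+ 0)) (toℚ-/ (+ 0)))))))
      partialSum-≋ (suc N) = ≋-trans (+-cong (partialSum-≋ N) (f≋ N)) (≋-trans
        (≋-sym (value-⊕ (tame-partials S N) (tame-member S N)))
        (value-cong (tame-⊕ (tame-partials S N) (tame-member S N)) (tame-partials S (suc N)) (λ n → sym (partials-suc S N n))))

      -- The partial sum of n terms is the value of `partials x n`. The remainder starts at qⁿ and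
      -- is tame uniformly in n, so `ev-vanish` bounds it by a multiple of σⁿ at every approximation
      -- j at which q is inside the disk.
      has-sum : HasSum f (value (tame-series S))
      has-sum = limit {partialSum f} {value (tame-series S)} λ ε 0<ε →
        let M , 0≤M , dom = domination 2 (suc k)
            N , h         = small′ M 0≤M (ε ℚ.* ½) (half ε 0<ε)
        in N , λ n n≥ →
          let K , r = both inside (closeness (partialSum-≋ n) (ε ℚ.* ½) (half ε 0<ε))
          in K , λ j j≥ → subst₂ _⊴_ (split n j) (half+half ε)
            (⊴-+ (proj₂ (r j j≥)) (⊴-neg (⊴-mono
              (unscale (Bounds.ev-vanish (proj₁ (r j j≥)) 0≤σ 0≤g g-eq n j (series x ⊕ ⊖ partials x n) 0≤1 0≤M
                (dom (tame-remainder S n)) (remainder-vanish S n)))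
              (h n n≥))))
        where
        split : ∀ n j →
          (at (partialSum f n) j +ᴷ -ᴷ at (value (tame-partials S n)) j) +ᴷ -ᴷ ev j (series x ⊕ ⊖ partials x n) (at q j) ≡
          at (partialSum f n) j +ᴷ -ᴷ at (value (tame-series S)) j
        split n j = trans (cong₂ (λ p r → (at (partialSum f n) j +ᴷ -ᴷ p) +ᴷ -ᴷ r) (at-value (tame-partials S n) j)
            (trans (ev-⊕ j (series x) (⊖ partials x n) (at q j)) (cong (ev j (series x) (at q j) +ᴷ_) (ev-⊖ j (partials x n) (at q j)))))
          (trans (solveᴷ 3 (λ p u v → (p :+ᴷ :-ᴷ u) :+ᴷ :-ᴷ (v :+ᴷ :-ᴷ u) :=ᴷ p :+ᴷ :-ᴷ v)
              (at (partialSum f n) j) (ev j (partials x n) (at q j)) (ev j (series x) (at q j)))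
            (cong (λ u → at (partialSum f n) j +ᴷ -ᴷ u) (sym (at-value (tame-series S) j))))

  -- The theta series, U and G as convergent sums

  abstract
    ∣sgn∣ : ∀ m → ℤ.∣ sgn m ∣ ≡ 1
    ∣sgn∣ zero    = refl
    ∣sgn∣ (suc m) = trans (ℤ.∣-i∣≡∣i∣ (sgn m)) (∣sgn∣ m)

    scale-sgn-≤ : ∀ m a n {B} → ℤ.∣ a n ∣ ℕ.≤ B → ℤ.∣ scale (sgn m) a n ∣ ℕ.≤ B
    scale-sgn-≤ m a n p = ℕ.≤-trans (ℕ.≤-reflexive (trans (ℤ.∣i*j∣≡∣i∣*∣j∣ (sgn m) (a n))
      (trans (cong (ℕ._* ℤ.∣ a n ∣) (∣sgn∣ m)) (ℕ.*-identityˡ ℤ.∣ a n ∣)))) p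

    lambert-term-≤ : ∀ ε s i n → ℤ.∣ ε ∣ ≡ 1 → ℤ.∣ scale (+ (suc i ℕ.^ s)) (lambert ε i) n ∣ ℕ.≤ suc n ℕ.^ s
    lambert-term-≤ ε s i n ∣ε∣ with n ℕ.<? i
    ... | yes n<i = subst (ℕ._≤ suc n ℕ.^ s)
      (sym (cong ℤ.∣_∣ (scale-vanish (+ (suc i ℕ.^ s)) (lambert ε i) n (lambert-vanish ε i n (ℕ.<⇒≤ n<i))))) ℕ.z≤n
    ... | no n≮i = begin
      ℤ.∣ + (suc i ℕ.^ s) ℤ.* lambert ε i n ∣  ≡⟨ ℤ.∣i*j∣≡∣i∣*∣j∣ (+ (suc i ℕ.^ s)) (lambert ε i n) ⟩
      suc i ℕ.^ s ℕ.* ℤ.∣ lambert ε i n ∣  ≤⟨ ℕ.*-mono-≤ (ℕ.^-monoˡ-≤ s (ℕ.s≤s (ℕ.≮⇒≥ n≮i))) (progression-≤1 ε i (+ 1) (suc i) n ∣ε∣ refl) ⟩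
      suc n ℕ.^ s ℕ.* 1  ≡⟨ ℕ.*-identityʳ _ ⟩
      suc n ℕ.^ s ∎
      where open ℕ.≤-Reasoning

    summable-U : ∀ s → Summable s (λ i → scale (sgn i) (uTerm s i))
    summable-U s = record
      { vanish  = λ i n n<i → scale-vanish (sgn i) (uTerm s i) n (uTerm-vanish s i n n<i)
      ; uniform = λ i n → scale-sgn-≤ i (uTerm s i) n (lambert-term-≤ -[1+ 0 ] s i n refl) }

    summable-G : ∀ s → Summable s (λ i → scale (sgn (suc i)) (gTerm s i))
    summable-G s = record
      { vanish  = λ i n n<i → scale-vanish (sgn (suc i)) (gTerm s i) n (gTerm-vanish s i n n<i)
      ; uniform = λ i n → scale-sgn-≤ (suc i) (gTerm s i) n (lambert-term-≤ (+ 1) s i n refl) }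

    summable-θ₊ : Summable 0 θTerm
    summable-θ₊ = record
      { vanish  = θTerm-vanish
      ; uniform = λ i n → scale-sgn-≤ (i ℕ.^ 2) (monomial (i ℕ.^ 2)) n (monomial-≤1 (i ℕ.^ 2) n) }

    summable-θ₋ : Summable 0 (θTerm ∘ suc)
    summable-θ₋ = record
      { vanish  = λ i n n<i → θTerm-vanish (suc i) n (ℕ.m≤n⇒m≤1+n n<i)
      ; uniform = λ i n → scale-sgn-≤ (suc i ℕ.^ 2) (monomial (suc i ℕ.^ 2)) n (monomial-≤1 (suc i ℕ.^ 2) n) }

    tame-lambert : ∀ ε i → ℤ.∣ ε ∣ ≡ 1 → Tame 1 0 (lambert ε i)
    tame-lambert ε i ∣ε∣ = tame λ n → progression-≤1 ε i (+ 1) (suc i) n ∣ε∣ refl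

    sign-power : ∀ m → (- 1ᶜ) ^ m ≋ fromℚ (toℚ (sgn m))
    sign-power m = pointwise-≋ (λ n → eq m n)
      where
      eq : ∀ m n → at ((- 1ᶜ) ^ m) n ≡ real (toℚ (sgn m))
      eq zero    n = cong real (sym (toℚ-/ (+ 1)))
      eq (suc m) n = trans (cong (real (ℚ.- 1ℚ) *ᴷ_) (eq m n))
        (trans (sym (real-* (ℚ.- 1ℚ) (toℚ (sgn m)))) (cong real (trans
          (solve 1 (λ x → :- con (+ 1) :* x := :- x) (toℚ (sgn m))) (sym (toℚ-neg (sgn m))))))

    negated-power : ∀ m → (- q) ^ m ≋ fromℚ (toℚ (sgn m)) * q ^ m
    negated-power m = pointwise-≋ (λ n → eq m n)
      where
      eq : ∀ m n → at ((- q) ^ m) n ≡ real (toℚ (sgn m)) *ᴷ at (q ^ m) n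
      eq zero    n = trans (sym (*ᴷ-identityˡ (real 1ℚ))) (cong (λ u → real u *ᴷ real 1ℚ) (sym (toℚ-/ (+ 1))))
      eq (suc m) n = trans (cong (-ᴷ at q n *ᴷ_) (eq m n)) (trans
        (solveᴷ 3 (λ q x y → :-ᴷ q :*ᴷ (x :*ᴷ y) :=ᴷ :-ᴷ x :*ᴷ (q :*ᴷ y)) (at q n) (real (toℚ (sgn m))) (at (q ^ m) n))
        (cong (_*ᴷ at (q ^ suc m) n) (sym (trans (cong real (toℚ-neg (sgn m))) (real-neg (toℚ (sgn m)))))))

  θ₊-sum θ₋-sum θ-sum : ℂ
  θ₊-sum = value (tame-series summable-θ₊)
  θ₋-sum = value (tame-series summable-θ₋)
  tame-θ : Tame 2 2 θˢ
  tame-θ = tame-⊕ (tame-series summable-θ₊) (tame-series summable-θ₋)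
  θ-sum = value tame-θ

  abstract
    θTerm-≋ : ∀ n {C k} (t : Tame C k (θTerm n)) → (- q) ^ (n ℕ.^ 2) ≋ value t
    θTerm-≋ n t = ≋-trans (negated-power (n ℕ.^ 2)) (≋-trans (*-congˡ (≋-sym (value-monomial (n ℕ.^ 2))))
      (≋-trans (≋-sym (value-scale (sgn (n ℕ.^ 2)) (tame-monomial (n ℕ.^ 2)))) (value-cong _ t (λ _ → refl))))

    is-θ : IsTheta₃ (- q) θ-sum
    is-θ = θ₊-sum , θ₋-sum ,
      has-sum summable-θ₊ (λ i → θTerm-≋ i (tame-member summable-θ₊ i)) ,
      has-sum summable-θ₋ (λ i → θTerm-≋ (suc i) (tame-member summable-θ₋ i)) ,
      from-≋ (value-⊕ (tame-series summable-θ₊) (tame-series summable-θ₋))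

  tame-U : ∀ s → Tame 1 (suc s) (Uˢ s)
  tame-U s = tame-series (summable-U s)

  tame-G : ∀ s → Tame 1 (suc s) (Gˢ s)
  tame-G s = tame-series (summable-G s)

  tame-uTerm : ∀ s i → Tame ((suc i ℕ.^ s) ℕ.* 1) 0 (uTerm s i)
  tame-uTerm s i = tame-scale (+ (suc i ℕ.^ s)) (tame-lambert -[1+ 0 ] i refl)

  tame-gTerm : ∀ s i → Tame ((suc i ℕ.^ s) ℕ.* 1) 0 (gTerm s i)
  tame-gTerm s i = tame-scale (+ (suc i ℕ.^ s)) (tame-lambert (+ 1) i refl)

  -- The terms of U and G as quotients

  abstract
    power-⊴-1 : ∀ m {n} → at q n ⊴ ρ → at (q ^ m) n ⊴ 1ℚ
    power-⊴-1 zero    p = bound 0≤1 (ℚ.≤-reflexive refl)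
    power-⊴-1 (suc m) p = ⊴-mono (⊴-* p (power-⊴-1 m p)) (ℚ.≤-trans (ℚ.≤-reflexive (ℚ.*-identityʳ ρ)) (ℚ.<⇒≤ ρ<1))

    power-⊴-ρ : ∀ m {n} → at q n ⊴ ρ → at (q ^ suc m) n ⊴ ρ
    power-⊴-ρ m p = subst (at (q ^ suc m) _ ⊴_) (ℚ.*-identityʳ ρ) (⊴-* p (power-⊴-1 m p))

    -- The real part suffices: |1 + z| ≥ 1 + Re z ≥ 1 - ρ.
    away-from-0 : ∀ x y → ⟨ x , y ⟩ ⊴ ρ → (1ℚ ℚ.- ρ) ℚ.* (1ℚ ℚ.- ρ) ℚ.≤ norm² (real 1ℚ +ᴷ ⟨ x , y ⟩)
    away-from-0 x y p = ℚ.≤-trans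
      (*-mono-≥0 0≤1-ρ (ℚ.≤-trans 0≤1-ρ 1-ρ≤1+x) 1-ρ≤1+x 1-ρ≤1+x)
      (subst (ℚ._≤ norm² (real 1ℚ +ᴷ ⟨ x , y ⟩)) (ℚ.+-identityʳ ((1ℚ ℚ.+ x) ℚ.* (1ℚ ℚ.+ x)))
        (ℚ.+-monoʳ-≤ ((1ℚ ℚ.+ x) ℚ.* (1ℚ ℚ.+ x)) (square-≥0 (0ℚ ℚ.+ y))))
      where
      0≤1-ρ : 0ℚ ℚ.≤ 1ℚ ℚ.- ρ
      0≤1-ρ = difference-≥0 (ℚ.<⇒≤ ρ<1)
      1-ρ≤1+x : 1ℚ ℚ.- ρ ℚ.≤ 1ℚ ℚ.+ x
      1-ρ≤1+x = ℚ.+-monoʳ-≤ 1ℚ {ℚ.- ρ} {x} (from-difference {ℚ.- ρ} {x} (subst (0ℚ ℚ.≤_)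
        (solve 2 (λ r x → r :- :- x := x :- :- r) ρ x) (difference-≥0 {ℚ.- x} {ρ} (ℚ.≤-trans (-≤∣∣ x) (⊴-re p)))))

    nonvanishing : ∀ z → Eventually (λ n → at z n ⊴ ρ) → 0ᴿ <ᴿ ∣ 1ᶜ + z ∣²
    nonvanishing z (N , h) = (1ℚ ℚ.- ρ) ℚ.* (1ℚ ℚ.- ρ) , positive-square , N , λ n n≥ →
      subst (ℚ._≤ norm² (at (1ᶜ + z) n)) (sym (ℚ.+-identityˡ ((1ℚ ℚ.- ρ) ℚ.* (1ℚ ℚ.- ρ))))
        (away-from-0 (seq (re z) n) (seq (im z) n) (h n n≥))
      where
      0<1-ρ : 0ℚ ℚ.< 1ℚ ℚ.- ρ
      0<1-ρ = subst (ℚ._< 1ℚ ℚ.- ρ) (ℚ.+-inverseʳ ρ) (ℚ.+-monoˡ-< (ℚ.- ρ) ρ<1)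
      positive-square : 0ℚ ℚ.< (1ℚ ℚ.- ρ) ℚ.* (1ℚ ℚ.- ρ)
      positive-square = subst (ℚ._< (1ℚ ℚ.- ρ) ℚ.* (1ℚ ℚ.- ρ)) (ℚ.*-zeroʳ (1ℚ ℚ.- ρ))
        (ℚ.*-monoʳ-<-pos (1ℚ ℚ.- ρ) {{ℚ.positive 0<1-ρ}} 0<1-ρ)

    value-scaled-monomial : ∀ s i → value (tame-scale (+ (suc i ℕ.^ s)) (tame-monomial (suc i))) ≋ fromℕ (suc i ℕ.^ s) * q ^ suc i
    value-scaled-monomial s i = ≋-trans (value-scale (+ (suc i ℕ.^ s)) (tame-monomial (suc i)))
      (*-cong (pointwise-≋ (λ _ → cong real (toℚ-/ (+ (suc i ℕ.^ s))))) (value-monomial (suc i)))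

    u-quotient : ∀ s i → IsQuotient (fromℕ (suc i ℕ.^ s) * q ^ suc i) (1ᶜ + q ^ suc i) (value (tame-uTerm s i))
    u-quotient s i =
      nonvanishing (q ^ suc i) (let N , h = inside in N , λ n n≥ → power-⊴-ρ i (h n n≥)) ,
      from-≋ (≋-trans (*-congˡ (≋-sym (≋-trans (value-⊕ (tame-const (+ 1)) (tame-monomial (suc i)))
                (+-cong (value-literal 1) (value-monomial (suc i))))))
        (≋-trans (≋-sym (value-⊗ (tame-uTerm s i) (tame-⊕ (tame-const (+ 1)) (tame-monomial (suc i)))))
        (≋-trans (value-cong _ (tame-scale (+ (suc i ℕ.^ s)) (tame-monomial (suc i))) (uTerm-quotient s i))
          (value-scaled-monomial s i))))

    g-quotient : ∀ s i → IsQuotient (fromℕ (suc i ℕ.^ s) * q ^ suc i) (1ᶜ - q ^ suc i) (value (tame-gTerm s i))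
    g-quotient s i =
      nonvanishing (- q ^ suc i) (let N , h = inside in N , λ n n≥ → ⊴-neg (power-⊴-ρ i (h n n≥))) ,
      from-≋ (≋-trans (*-congˡ (≋-sym (≋-trans (value-⊕ (tame-const (+ 1)) (tame-⊖ (tame-monomial (suc i))))
                (+-cong (value-literal 1) (≋-trans (value-⊖ (tame-monomial (suc i))) (neg-cong (value-monomial (suc i))))))))
        (≋-trans (≋-sym (value-⊗ (tame-gTerm s i) (tame-⊕ (tame-const (+ 1)) (tame-⊖ (tame-monomial (suc i))))))
        (≋-trans (value-cong _ (tame-scale (+ (suc i ℕ.^ s)) (tame-monomial (suc i))) (gTerm-quotient s i))
          (value-scaled-monomial s i))))

    signed-term : ∀ m {C k C′ k′ a} (t : Tame C k a) (t′ : Tame C′ k′ (scale (sgn m) a)) → (- 1ᶜ) ^ m * value t ≋ value t′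
    signed-term m t t′ = ≋-trans (*-cong (sign-power m) ≋-refl)
      (≋-trans (≋-sym (value-scale (sgn m) t)) (value-cong _ t′ (λ _ → refl)))

    is-U : ∀ s → IsU s q (value (tame-U s))
    is-U s = (λ i → value (tame-uTerm s i)) , u-quotient s ,
      has-sum (summable-U s) (λ i → signed-term i (tame-uTerm s i) (tame-member (summable-U s) i))

    is-G : ∀ s → IsG s q (value (tame-G s))
    is-G s = (λ i → value (tame-gTerm s i)) , g-quotient s ,
      has-sum (summable-G s) (λ i → signed-term (suc i) (tame-gTerm s i) (tame-member (summable-G s) i))

  -- Evaluation of the two determinants

  tame-affine : ∀ {C k a b D l} m → Tame C k a → Tame D l b → Tame (m ℕ.* C ℕ.+ D) (suc k ℕ.+ l) (const (+ m) ⊗ a ⊕ b)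
  tame-affine m t t′ = tame-⊕ (tame-⊗ (tame-const (+ m)) t) t′

  abstract
    value-affine : ∀ {C k a b D l} m (t : Tame C k a) (t′ : Tame D l b) {z} → value t′ ≋ z →
      value (tame-affine m t t′) ≋ fromℕ m * value t + z
    value-affine m t t′ p = ≋-trans (value-⊕ (tame-⊗ (tame-const (+ m)) t) t′)
      (+-cong (≋-trans (value-⊗ (tame-const (+ m)) t) (*-cong (value-literal m) ≋-refl)) p)

    value-minus : ∀ n → value (tame-⊖ (tame-const (+ n))) ≋ - fromℕ n
    value-minus n = ≋-trans (value-⊖ (tame-const (+ n))) (neg-cong (value-literal n))

    value-det : ∀ {C₁ k₁ a C₂ k₂ b C₃ k₃ c C₄ k₄ d}
      (ta : Tame C₁ k₁ a) (tb : Tame C₂ k₂ b) (tc : Tame C₃ k₃ c) (td : Tame C₄ k₄ d) {x y z w} →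
      value ta ≋ x → value tb ≋ y → value tc ≋ z → value td ≋ w →
      value (tame-⊕ (tame-⊗ ta td) (tame-⊖ (tame-⊗ tb tc))) ≋ det ((x ∷ y ∷ []) ∷ (z ∷ w ∷ []) ∷ [])
    value-det ta tb tc td p q r s = ≋-trans (value-⊕ (tame-⊗ ta td) (tame-⊖ (tame-⊗ tb tc)))
      (+-cong (≋-trans (value-⊗ ta td) (*-cong p s))
        (≋-trans (value-⊖ (tame-⊗ tb tc)) (neg-cong (≋-trans (value-⊗ tb tc) (*-cong q r)))))

    divided : ∀ {x d : ℂ} c n → c * fromℕ n ≋ 1ᶜ → fromℕ n * x ≋ d → x ≋ c * d
    divided {x} {d} c n p q = ≋-trans (≋-sym (*-identityˡ x)) (≋-trans (*-cong (≋-sym p) ≋-refl)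
      (≋-trans (*-assoc c (fromℕ n) x) (*-congˡ q)))

    θ-power : ∀ m n → value (tame-⊗ (tame-const (+ m)) (tame-^ tame-θ n)) ≋ fromℕ m * θ-sum ^ n
    θ-power m n = ≋-trans (value-⊗ (tame-const (+ m)) (tame-^ tame-θ n)) (*-cong (value-literal m) (value-^ tame-θ n))

    θ-sum¹⁶ : θ-sum ^ 16 ≈ fromℚ (+ 1 / 3) * det
      ( (fromℕ 16 * value (tame-U 1) - fromℕ 2 ∷ fromℕ 16 * value (tame-U 3) + fromℕ 1 ∷ [])
      ∷ (fromℕ 16 * value (tame-U 3) + fromℕ 1 ∷ fromℕ 16 * value (tame-U 5) - fromℕ 2 ∷ []) ∷ [] )
    -- That ⅓ times 3 is 1 holds by computation with closed rationals; likewise for 9 and the square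
    -- of ⅓ below.
    θ-sum¹⁶ = from-≋ (divided (fromℚ (+ 1 / 3)) 3 (pointwise-≋ (λ _ → refl))
      (≋-trans (≋-sym (θ-power 3 16)) (≋-trans (value-cong _ _ θ¹⁶)
        (value-det
          (tame-affine 16 (tame-U 1) (tame-⊖ (tame-const (+ 2)))) (tame-affine 16 (tame-U 3) (tame-const (+ 1)))
          (tame-affine 16 (tame-U 3) (tame-const (+ 1))) (tame-affine 16 (tame-U 5) (tame-⊖ (tame-const (+ 2))))
          (value-affine 16 (tame-U 1) _ (value-minus 2)) (value-affine 16 (tame-U 3) _ (value-literal 1))
          (value-affine 16 (tame-U 3) _ (value-literal 1)) (value-affine 16 (tame-U 5) _ (value-minus 2))))))

    θ-sum²⁴ : θ-sum ^ 24 ≈ fromℚ (+ 1 / 3) ^ 2 * det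
      ( (fromℕ 16 * value (tame-G 3) + fromℕ 1 ∷ fromℕ 16 * value (tame-G 5) - fromℕ 2 ∷ [])
      ∷ (fromℕ 32 * value (tame-G 5) - fromℕ 4 ∷ fromℕ 32 * value (tame-G 7) + fromℕ 17 ∷ []) ∷ [] )
    θ-sum²⁴ = from-≋ (divided (fromℚ (+ 1 / 3) ^ 2) 9 (pointwise-≋ (λ _ → refl))
      (≋-trans (≋-sym (θ-power 9 24)) (≋-trans (value-cong _ _ θ²⁴)
        (value-det
          (tame-affine 16 (tame-G 3) (tame-const (+ 1))) (tame-affine 16 (tame-G 5) (tame-⊖ (tame-const (+ 2))))
          (tame-affine 32 (tame-G 5) (tame-⊖ (tame-const (+ 4)))) (tame-affine 32 (tame-G 7) (tame-const (+ 17)))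
          (value-affine 16 (tame-G 3) _ (value-literal 1)) (value-affine 16 (tame-G 5) _ (value-minus 2))
          (value-affine 32 (tame-G 5) _ (value-minus 4)) (value-affine 32 (tame-G 7) _ (value-literal 17))))))

theorem1p6 : (q : ℂ) → 0ᴿ <ᴿ ∣ q ∣² → ∣ q ∣² <ᴿ 1ᴿ →
    Σ[ θ ∈ ℂ ] Σ[ U ∈ (ℕ → ℂ) ] Σ[ G ∈ (ℕ → ℂ) ]
    ( IsTheta₃ (- q) θ
    × ((s : ℕ) → .{{NonZero s}} → IsU s q (U s))
    × ((s : ℕ) → .{{NonZero s}} → IsG s q (G s))
    × ( θ ^ 16 ≈ fromℚ (+ 1 / 3) * det
    ( (fromℕ 16 * U 1 - fromℕ 2 ∷ fromℕ 16 * U 3 + fromℕ 1 ∷ [])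
    ∷ (fromℕ 16 * U 3 + fromℕ 1 ∷ fromℕ 16 * U 5 - fromℕ 2 ∷ [])
    ∷ [] ) )
    × ( θ ^ 24 ≈ fromℚ (+ 1 / 3) ^ 2 * det
    ( (fromℕ 16 * G 3 + fromℕ 1 ∷ fromℕ 16 * G 5 - fromℕ 2 ∷ [])
    ∷ (fromℕ 32 * G 5 - fromℕ 4 ∷ fromℕ 32 * G 7 + fromℕ 17 ∷ [])
    ∷ [] ) ) )
theorem1p6 q _ ∣q∣<1 = θ-sum , (λ s → value (tame-U s)) , (λ s → value (tame-G s)) ,
  is-θ , (λ s → is-U s) , (λ s → is-G s) , θ-sum¹⁶ , θ-sum²⁴
  where open Values q ∣q∣<1
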